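{- For every $\varepsilon>0$ there exist $\delta>0$ and $N_0$ such that for every $n\ge N_0$ the following holds. If $\mathcal H$ is an $n$-vertex $C_5^{3- }$-free $3$-graph with at least $\frac14\binom{n}{3}-\delta n^3$ edges, then one can remove at most $\varepsilon n^3$ edges from $\mathcal H$ so that the resulting $3$-graph is a $T_{\mathrm{rec}}$-subconstruction.
   Context: $C_5^{3- }$ is the $3$-graph on $\{1,\dots,5\}$ with edges $\{1,2,3\},\{2,3,4\},\{3,4,5\},\{4,5,1\}$; a $3$-graph is $C_5^{3- }$-free if it contains no copy of $C_5^{3- }$ as a subgraph. For pairwise disjoint sets $V_1,V_2,V_3$, $\mathcal K[V_1,V_2,V_3]$ is the complete $3$-partite $3$-graph consisting of all triples with exactly one vertex in each $V_i$. $T_{\mathrm{rec}}$-constructions are defined recursively: for $n\in\{0,1,2\}$ the $n$-vertex $T_{\mathrm{rec}}$-construction is the empty $3$-graph on $n$ vertices; for $n\ge 3$, an $n$-vertex $3$-graph is a $T_{\mathrm{rec}}$-construction if its vertex set has a partition $V_1\cup V_2\cup V_3$ into non-empty parts such that it is obtained from $\mathcal K[V_1,V_2,V_3]$ by adding, inside each $V_i$, a $T_{\mathrm{rec}}$-construction on $V_i$. A $T_{\mathrm{rec}}$-subconstruction is a subgraph of some $T_{\mathrm{rec}}$-construction (on the same vertex set). -}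

module Defs where

open import Data.Nat using (ℕ; zero; suc; _+_; _≡ᵇ_)
open import Data.Bool using (Bool; true; false; _∧_; if_then_else_)
open import Data.List using (List; []; _∷_; map; _++_)
open import Data.Nat.ListAction using (sum)
open import Data.Fin using (Fin)
open import Data.Fin.Subset using (Subset; ⁅_⁆; _∪_; _∩_; _⊆_; ∣_∣; ⊥; ⊤; Nonempty; inside; outside)
open import Data.Vec using (_∷_; [])
open import Data.Product using (_×_; Σ; ∃; _,_)
open import Data.Sum using (_⊎_)
open import Function.Definitions using (Injective)
open import Relation.Binary.PropositionalEquality using (_≡_)
open import Relation.Nullary using (¬_)

-- A 3-graph on vertex set Fin n: a Boolean-valued predicate on subsets of Fin n.
-- Its edge set is { e : ∣ e ∣ ≡ 3 and H e ≡ true } (values on non-3-sets are ignored).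
Graph3 : ℕ → Set
Graph3 n = Subset n → Bool

IsEdge : ∀ {n} → Graph3 n → Subset n → Set
IsEdge H e = (∣ e ∣ ≡ 3) × (H e ≡ true)

allSubsets : ∀ n → List (Subset n)
allSubsets zero = [] ∷ []
allSubsets (suc n) = map (outside ∷_) (allSubsets n) ++ map (inside ∷_) (allSubsets n)

edgeCount : ∀ {n} → Graph3 n → ℕ
edgeCount {n} H = sum (map (λ e → if (∣ e ∣ ≡ᵇ 3) ∧ H e then 1 else 0) (allSubsets n))

triple : ∀ {n} → Fin n → Fin n → Fin n → Subset n
triple a b c = ⁅ a ⁆ ∪ (⁅ b ⁆ ∪ ⁅ c ⁆)

C53-Copy : ∀ {n} → Graph3 n → Set
C53-Copy {n} H = Σ (Fin 5 → Fin n) λ f → Injective _≡_ _≡_ f ×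
  (IsEdge H (triple (f v1) (f v2) (f v3)) × IsEdge H (triple (f v2) (f v3) (f v4)) ×
   IsEdge H (triple (f v3) (f v4) (f v5)) × IsEdge H (triple (f v4) (f v5) (f v1)))
  where
  v1 v2 v3 v4 v5 : Fin 5
  v1 = Fin.zero
  v2 = Fin.suc Fin.zero
  v3 = Fin.suc (Fin.suc Fin.zero)
  v4 = Fin.suc (Fin.suc (Fin.suc Fin.zero))
  v5 = Fin.suc (Fin.suc (Fin.suc (Fin.suc Fin.zero)))

C53-free : ∀ {n} → Graph3 n → Set
C53-free H = ¬ C53-Copy H

Crossing : ∀ {n} → Subset n → Subset n → Subset n → Subset n → Set
Crossing V₁ V₂ V₃ e = (∣ e ∩ V₁ ∣ ≡ 1) × (∣ e ∩ V₂ ∣ ≡ 1) × (∣ e ∩ V₃ ∣ ≡ 1)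

-- IsTrec S G : the 3-graph induced by G on the vertex set S (its edges being the
-- 3-sets e ⊆ S with G e ≡ true) is a T_rec-construction on S.
data IsTrec {n : ℕ} (S : Subset n) (G : Graph3 n) : Set where
  small : ¬ (3 Data.Nat.≤ ∣ S ∣) →
          (∀ e → e ⊆ S → ¬ IsEdge G e) → IsTrec S G
  split : (V₁ V₂ V₃ : Subset n) →
          3 Data.Nat.≤ ∣ S ∣ →
          V₁ ∪ (V₂ ∪ V₃) ≡ S →
          V₁ ∩ V₂ ≡ ⊥ → V₁ ∩ V₃ ≡ ⊥ → V₂ ∩ V₃ ≡ ⊥ →
          Nonempty V₁ → Nonempty V₂ → Nonempty V₃ →
          IsTrec V₁ G → IsTrec V₂ G → IsTrec V₃ G →
          (∀ e → e ⊆ S → ∣ e ∣ ≡ 3 → Crossing V₁ V₂ V₃ e → G e ≡ true) →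
          (∀ e → e ⊆ S → IsEdge G e →
             Crossing V₁ V₂ V₃ e ⊎ (e ⊆ V₁ ⊎ (e ⊆ V₂ ⊎ e ⊆ V₃))) →
          IsTrec S G

IsTrecConstruction : ∀ {n} → Graph3 n → Set
IsTrecConstruction G = IsTrec ⊤ G

_⊑_ : ∀ {n} → Graph3 n → Graph3 n → Set
H ⊑ G = ∀ e → IsEdge H e → IsEdge G e

IsTrecSubconstruction : ∀ {n} → Graph3 n → Set
IsTrecSubconstruction H = ∃ λ G → IsTrecConstruction G × (H ⊑ G)

removedCount : ∀ {n} → Graph3 n → Graph3 n → ℕ
removedCount {n} H H' =
  sum (map (λ e → if (∣ e ∣ ≡ᵇ 3) ∧ H e ∧ Data.Bool.not (H' e) then 1 else 0) (allSubsets n))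

{-# OPTIONS --safe #-}

-- Call x and y similar at v if the link of v contains at least k paths x–w–y. In a C₅⁻-free graph no
-- triple xyz has y, z similar at x and also x, z similar at y, since two such paths span a C₅⁻; and few
-- edges xyz have y, z similar at x, since each of them lies in k copies of K₄⁻ with apex x, and a triple
-- has at most one apex. So edges and similar pairs together number at most C(n,3) + o(n³). On the other
-- hand any graph has about as many ordered pairs with common neighbours as ordered edges, because
-- Σ_{x~y} deg y / deg x ≥ Σ_{x~y} 1; applied to all the links this gives 4e ≤ C(n,3) + o(n³).
--
-- If this is nearly tight, then almost every link is nearly a disjoint union of balanced complete
-- bipartite graphs, and almost every non-edge has a similar pair. For a typical edge xyz with codegree
-- d(xy) ≥ n/5 the sets A = N(yz), B = N(xz), C = N(xy) are nearly disjoint, of nearly equal size, and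
-- almost no edge abw with a ∈ A, b ∈ B has w ∉ C (likewise for the other two pairs). A vertex w outside
-- A ∪ B ∪ C finds almost all of B ∪ C similar to most a ∈ A, so that nearly d(wa) ≥ |B ∪ C| > n/3; as the
-- three codegrees of a typical edge are nearly equal with sum at most n, there are few such w. This gives
-- the top-level partition. The parts inherit near-extremality from abc + Σ a³/24 ≤ (a+b+c)³/24, and
-- Σ |Vᵢ|³ ≤ (16/25) n³ makes a bounded number of recursion levels sufficient.

module Submission where

open import Defs

-- All counts run over ordered triples and stay in ℕ: bounds are multiplied out and deviations are
-- truncated differences. The ratio argument divides by degrees, which may be tiny. Padding every
-- degree by `t` tames the contribution of dissimilar pairs and dictates the scales `m * m ≤ k`,
-- `m * m * k ≤ t`, `m * m * t ≤ n`. The same argument has to yield stability: the AM-GM loss in a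
-- pair of reciprocal ratios is quadratic in the gap between the degrees, so a deficit of relative
-- order `1 / (m * m)` in the density gives errors of order `1 / m` everywhere else. This is why the
-- density is measured by `q = m * m`.
--
-- The threshold n/5 only has to lie between n/6 and n/4: below the average codegree n/4, so that
-- many edges qualify, and above n/6, so that |B ∪ C| exceeds n/3 by a fixed margin.
--
-- In the recursion the density demanded by the lower levels is fixed before `m` is chosen, so that
-- the loss of order `1 / m` at the top stays within what the parts tolerate. At depth zero any
-- construction will do, at the price of all triples; each further level multiplies the price by
-- 3/4.

module Development where

  open import Data.Nat using (ℕ; zero; suc; _+_; _*_; _∸_; _≤_; _<_; _≥_; _≤ᵇ_; _≡ᵇ_; _^_; _!; z≤n; s≤s; s≤s⁻¹; NonZero; >-nonZero)
  open import Data.Nat.Properties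
  open import Data.Nat.Tactic.RingSolver using (solve-∀)
  open import Data.Nat.Divisibility using (_∣_; ∣-trans; m∣m*n; m≤n⇒m!∣n!)
  open import Data.Nat.DivMod using (_/_; m/n*n≤m; /-mono-≤; m*n/n≡m)
  open import Data.Nat.Combinatorics using (_C_; nC1≡n; nCk+nC[k+1]≡[n+1]C[k+1])
  open import Data.Nat.ListAction using (sum)
  open import Data.Bool using (Bool; true; false; _∧_; _∨_; not; T; if_then_else_)
  open import Data.Bool.Properties using (∧-zeroʳ; ∨-identityʳ; ∨-zeroʳ)
  open import Data.List.Properties using (map-tabulate)
  open import Data.List.Relation.Unary.Unique.Propositional.Properties using (filter⁺; allFin⁺)
  open import Data.List using (List; []; _∷_; map; _++_; length; filterᵇ; allFin)
  open import Data.List.Relation.Unary.All using (All; []; _∷_)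
  open import Data.List.Relation.Unary.AllPairs using ([]; _∷_)
  open import Data.List.Relation.Unary.Unique.Propositional using (Unique)
  open import Data.Product using (Σ; _×_; ∃; _,_; proj₁; proj₂)
  open import Data.Sum using (_⊎_; inj₁; inj₂)
  open import Data.Empty using (⊥-elim) renaming (⊥ to ⊥₀)
  open import Data.Unit using (tt)
  open import Function using (_∘_; id)
  open import Relation.Nullary using (¬_; Dec; yes; no; does)
  open import Relation.Binary.PropositionalEquality using (_≡_; _≢_; refl; sym; trans; cong; cong₂; subst; subst₂)
  open import Data.Fin using (Fin; zero; suc)
  open import Data.Fin.Subset using (Subset; ⁅_⁆; _∪_; _∩_; _⊆_; _∈_; _∉_; ∣_∣; ⊥; ⊤; Nonempty; _-_)
  open import Data.Fin.Subset.Properties using (x∈⁅x⁆; x∈⁅y⁆⇒x≡y; ∣⁅x⁆∣≡1; ⊆-antisym; _⊆?_; p⊆q⇒∣p∣≤∣q∣; Empty-unique; ∣⊥∣≡0; ∣⊤∣≡n; x∈p∩q⁺; x∈p∩q⁻; x∈p∪q⁺; x∈p∪q⁻; ∪-comm; ∪-assoc; p⊂q⇒∣p∣<∣q∣; x∈p∧x≢y⇒x∈p-y; p─q⊆p; p─⊥≡p; _∈?_)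
  open import Data.Vec using (Vec; lookup; tabulate) renaming ([] to []ᵛ; _∷_ to _∷ᵛ_)
  open import Data.Vec.Properties using ([]=⇒lookup; lookup⇒[]=; lookup∘tabulate; ≡-dec; lookup-replicate)
  open import Data.Fin.Properties using (any?)
  open import Relation.Nullary.Decidable using (T?; dec-true; dec-false; decidable-stable; _×-dec_; ¬?)
  open import Data.Vec.Relation.Unary.All using () renaming ([] to []ᵃ; _∷_ to _∷ᵃ_)
  open import Data.Vec.Relation.Unary.AllPairs using () renaming ([] to []ᵖ; _∷_ to _∷ᵖ_)
  open import Data.Vec.Relation.Unary.Unique.Propositional using () renaming (Unique to VecUnique)
  open import Data.Vec.Relation.Unary.Unique.Propositional.Properties using (lookup-injective)

  -- Inequalities between natural numbers and between indicators

  -- A Farkas certificate: l ≤ r, multiplied out and padded by s, yields L ≤ R.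
  certify : ∀ {L R l r} s → l ≤ r → L + r + s ≡ R + l → L ≤ R
  certify {L} {R} {l} {r} s l≤r eq = +-cancelʳ-≤ r L R (begin
    L + r      ≤⟨ m≤m+n (L + r) s ⟩
    L + r + s  ≡⟨ eq ⟩
    R + l      ≤⟨ +-monoʳ-≤ R l≤r ⟩
    R + r      ∎)
    where open ≤-Reasoning

  square-cancel-≤ : ∀ {x y} → x * x ≤ y * y → x ≤ y
  square-cancel-≤ {x} {y} p = ≮⇒≥ λ y<x → <⇒≱ (*-mono-< y<x y<x) p

  amgm₁ : ∀ a e → 4 * (a * (a + e)) + e * e ≡ (a + (a + e)) * (a + (a + e))
  amgm₁ = solve-∀

  4ab≤[a+b]² : ∀ a b → 4 * (a * b) ≤ (a + b) * (a + b)
  4ab≤[a+b]² a b with ≤-total a b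
  ... | inj₁ a≤b = subst (λ b → 4 * (a * b) ≤ (a + b) * (a + b)) (m+[n∸m]≡n a≤b)
                     (subst (4 * (a * (a + (b ∸ a))) ≤_) (amgm₁ a (b ∸ a)) (m≤m+n _ _))
  ... | inj₂ b≤a = subst (λ a → 4 * (a * b) ≤ (a + b) * (a + b)) (m+[n∸m]≡n b≤a)
                     (subst₂ _≤_ (cong (4 *_) (*-comm b _)) (cong (λ c → c * c) (+-comm b _))
                     (subst (4 * (b * (b + (a ∸ b))) ≤_) (amgm₁ b (a ∸ b)) (m≤m+n _ _)))

  [2c]²≡4c² : ∀ c → 2 * c * (2 * c) ≡ 4 * (c * c)
  [2c]²≡4c² = solve-∀

  amgm : ∀ {a b} c → c * c ≡ a * b → 2 * c ≤ a + b
  amgm {a} {b} c eq = square-cancel-≤ (begin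
    2 * c * (2 * c)    ≡⟨ [2c]²≡4c² c ⟩
    4 * (c * c)        ≡⟨ cong (4 *_) eq ⟩
    4 * (a * b)        ≤⟨ 4ab≤[a+b]² a b ⟩
    (a + b) * (a + b)  ∎)
    where open ≤-Reasoning

  cube : ℕ → ℕ
  cube a = a * (a * a)

  ⟦_⟧ : Bool → ℕ
  ⟦ true ⟧ = 1
  ⟦ false ⟧ = 0

  ⟦⟧≤1 : ∀ b → ⟦ b ⟧ ≤ 1
  ⟦⟧≤1 true = ≤-refl
  ⟦⟧≤1 false = z≤n

  ⟦⟧*≤ : ∀ b c → ⟦ b ⟧ * c ≤ c
  ⟦⟧*≤ b c = subst (⟦ b ⟧ * c ≤_) (*-identityˡ c) (*-monoˡ-≤ c (⟦⟧≤1 b))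

  -- Inequalities between indicators are decided by evaluating all cases.
  BoolFun : ℕ → Set
  BoolFun zero = Bool
  BoolFun (suc k) = Bool → BoolFun k

  tautology : ∀ k → BoolFun k → Bool
  tautology zero b = b
  tautology (suc k) f = tautology k (f true) ∧ tautology k (f false)

  Holds : ∀ k → BoolFun k → Set
  Holds zero b = T b
  Holds (suc k) f = ∀ x → Holds k (f x)

  T-∧ : ∀ {a b} → T (a ∧ b) → T a × T b
  T-∧ {true} {true} _ = tt , tt

  tautology-sound : ∀ k (f : BoolFun k) → T (tautology k f) → Holds k f
  tautology-sound zero b p = p
  tautology-sound (suc k) f p true = tautology-sound k (f true) (proj₁ (T-∧ p))
  tautology-sound (suc k) f p false = tautology-sound k (f false) (proj₂ (T-∧ {tautology k (f true)} p))

  -- Finite and iterated sums over a list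

  module Sums {X : Set} where

    ∑ : List X → (X → ℕ) → ℕ
    ∑ U f = sum (map f U)

    ∑-mono : ∀ U {f g : X → ℕ} → (∀ x → f x ≤ g x) → ∑ U f ≤ ∑ U g
    ∑-mono [] p = z≤n
    ∑-mono (x ∷ U) p = +-mono-≤ (p x) (∑-mono U p)

    ∑-cong : ∀ U {f g : X → ℕ} → (∀ x → f x ≡ g x) → ∑ U f ≡ ∑ U g
    ∑-cong [] p = refl
    ∑-cong (x ∷ U) p = cong₂ _+_ (p x) (∑-cong U p)

    interchange : ∀ a b c d → a + b + (c + d) ≡ a + c + (b + d)
    interchange = solve-∀

    ∑-+ : ∀ U (f g : X → ℕ) → ∑ U (λ x → f x + g x) ≡ ∑ U f + ∑ U g
    ∑-+ [] f g = refl
    ∑-+ (x ∷ U) f g = trans (cong (f x + g x +_) (∑-+ U f g)) (interchange (f x) (g x) (∑ U f) (∑ U g))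

    ∑-*ˡ : ∀ U c (f : X → ℕ) → ∑ U (λ x → c * f x) ≡ c * ∑ U f
    ∑-*ˡ [] c f = sym (*-zeroʳ c)
    ∑-*ˡ (x ∷ U) c f = trans (cong (c * f x +_) (∑-*ˡ U c f)) (sym (*-distribˡ-+ c (f x) (∑ U f)))

    ∑-*ʳ : ∀ U c (f : X → ℕ) → ∑ U (λ x → f x * c) ≡ ∑ U f * c
    ∑-*ʳ U c f = trans (∑-cong U (λ x → *-comm (f x) c)) (trans (∑-*ˡ U c f) (*-comm c (∑ U f)))

    ∑-const : ∀ U c → ∑ U (λ _ → c) ≡ length U * c
    ∑-const [] c = refl
    ∑-const (x ∷ U) c = cong (c +_) (∑-const U c)

    ∑-swap : ∀ U V (f : X → X → ℕ) → ∑ U (λ x → ∑ V (f x)) ≡ ∑ V (λ y → ∑ U (λ x → f x y))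
    ∑-swap [] V f = sym (trans (∑-const V 0) (*-zeroʳ (length V)))
    ∑-swap (x ∷ U) V f = trans (cong (∑ V (f x) +_) (∑-swap U V f)) (sym (∑-+ V (f x) _))

    ∑-pos : ∀ U {f : X → ℕ} → 0 < ∑ U f → ∃ λ x → 0 < f x
    ∑-pos (x ∷ U) {f} p with f x in eq
    ... | suc a = x , subst (0 <_) (sym eq) (s≤s z≤n)
    ... | zero = ∑-pos U p

    -- Averaging of a cost `g` against a weight `f`. Positivity of the weight at the chosen point is
    -- part of the result, since it is what later makes the chosen triple an edge on a large pair.
    pigeonhole : ∀ U c {f g : X → ℕ} → 0 < ∑ U f → ∑ U g ≤ c * ∑ U f →
      ∃ λ x → 0 < f x × g x ≤ c * f x
    pigeonhole (x ∷ U) c {f} {g} pos le with f x in eq | g x ≤? c * f x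
    ... | zero | _ = pigeonhole U c pos (≤-trans (m≤n+m _ (g x)) le)
    ... | suc a | yes p = x , subst (0 <_) (sym eq) (s≤s z≤n) , subst (λ z → g x ≤ c * z) (sym eq) p
    ... | suc a | no p with ∑ U f in eqU
    ...   | zero = ⊥-elim (p (subst (λ z → g x ≤ c * z) (+-identityʳ (suc a)) (≤-trans (m≤m+n _ _) le)))
    ...   | suc b = pigeonhole U c (subst (0 <_) (sym eqU) (s≤s z≤n))
                      (subst (λ z → ∑ U g ≤ c * z) (sym eqU)
                      (+-cancelˡ-≤ (c * suc a) _ _ (begin
        c * suc a + ∑ U g      ≤⟨ +-monoˡ-≤ _ (≰⇒≥ p) ⟩
        g x + ∑ U g            ≤⟨ le ⟩
        c * (suc a + suc b)    ≡⟨ *-distribˡ-+ c (suc a) (suc b) ⟩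
        c * suc a + c * suc b  ∎)))
      where open ≤-Reasoning

    private
      zero-sum : ∀ {U} {f : X → Bool} {x} → All (x ≢_) U → (∀ y → T (f y) → x ≡ y) → ∑ U (λ y → ⟦ f y ⟧) ≡ 0
      zero-sum [] u = refl
      zero-sum {y ∷ U} {f} (x≢y ∷ a) u with f y in eq
      ... | true = ⊥-elim (x≢y (u y (subst T (sym eq) tt)))
      ... | false = zero-sum a u

    ∑-atMostOne : ∀ {U} {f : X → Bool} → Unique U → (∀ x y → T (f x) → T (f y) → x ≡ y) → ∑ U (λ x → ⟦ f x ⟧) ≤ 1
    ∑-atMostOne [] u = z≤n
    ∑-atMostOne {x ∷ U} {f} (a ∷ uq) u with f x in eq
    ... | true = ≤-reflexive (cong suc (zero-sum a (λ y → u x y (subst T (sym eq) tt))))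
    ... | false = ∑-atMostOne uq u

    Fun : ℕ → Set
    Fun zero = ℕ
    Fun (suc k) = X → Fun k

    ∑ⁿ : List X → ∀ k → Fun k → ℕ
    ∑ⁿ U zero f = f
    ∑ⁿ U (suc k) f = ∑ U (λ x → ∑ⁿ U k (f x))

    swapAt : ℕ → ∀ k → Fun k → Fun k
    swapAt zero (suc (suc k)) f x y = f y x
    swapAt (suc i) (suc k) f x = swapAt i k (f x)
    swapAt _ _ f = f

    swapsAt : List ℕ → ∀ k → Fun k → Fun k
    swapsAt [] k f = f
    swapsAt (i ∷ is) k f = swapAt i k (swapsAt is k f)

    ∑-swapAt : ∀ U i k f → ∑ⁿ U k f ≡ ∑ⁿ U k (swapAt i k f)
    ∑-swapAt U zero zero f = refl
    ∑-swapAt U zero (suc zero) f = refl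
    ∑-swapAt U zero (suc (suc k)) f = ∑-swap U U (λ x y → ∑ⁿ U k (f x y))
    ∑-swapAt U (suc i) zero f = refl
    ∑-swapAt U (suc i) (suc k) f = ∑-cong U (λ x → ∑-swapAt U i k (f x))

    -- Fubini for an arbitrary reordering. The list spells the permutation as adjacent
    -- transpositions, and `swapsAt` computes, so a use gives only the positions and the summand
    -- with its variables in the new order.
    ∑-permute : ∀ U is k f → ∑ⁿ U k (swapsAt is k f) ≡ ∑ⁿ U k f
    ∑-permute U [] k f = refl
    ∑-permute U (i ∷ is) k f = trans (sym (∑-swapAt U i k (swapsAt is k f))) (∑-permute U is k f)

    Pointwise : ∀ k → Fun k → Fun k → Set
    Pointwise zero f g = f ≤ g
    Pointwise (suc k) f g = ∀ x → Pointwise k (f x) (g x)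

    ∑ⁿ-mono : ∀ U k {f g : Fun k} → Pointwise k f g → ∑ⁿ U k f ≤ ∑ⁿ U k g
    ∑ⁿ-mono U zero p = p
    ∑ⁿ-mono U (suc k) p = ∑-mono U (λ x → ∑ⁿ-mono U k (p x))

    plusⁿ : ∀ k → Fun k → Fun k → Fun k
    plusⁿ zero f g = f + g
    plusⁿ (suc k) f g x = plusⁿ k (f x) (g x)

    ∑ⁿ-+ : ∀ U k (f g : Fun k) → ∑ⁿ U k (plusⁿ k f g) ≡ ∑ⁿ U k f + ∑ⁿ U k g
    ∑ⁿ-+ U zero f g = refl
    ∑ⁿ-+ U (suc k) f g = trans (∑-cong U λ x → ∑ⁿ-+ U k (f x) (g x)) (∑-+ U _ _)

    scaleⁿ : ∀ k → ℕ → Fun k → Fun k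
    scaleⁿ zero c f = c * f
    scaleⁿ (suc k) c f x = scaleⁿ k c (f x)

    ∑ⁿ-*ˡ : ∀ U k c (f : Fun k) → ∑ⁿ U k (scaleⁿ k c f) ≡ c * ∑ⁿ U k f
    ∑ⁿ-*ˡ U zero c f = refl
    ∑ⁿ-*ˡ U (suc k) c f = trans (∑-cong U λ x → ∑ⁿ-*ˡ U k c (f x)) (∑-*ˡ U c _)

    PointwiseEq : ∀ k → Fun k → Fun k → Set
    PointwiseEq zero f g = f ≡ g
    PointwiseEq (suc k) f g = ∀ x → PointwiseEq k (f x) (g x)

    ∑ⁿ-cong : ∀ U k {f g : Fun k} → PointwiseEq k f g → ∑ⁿ U k f ≡ ∑ⁿ U k g
    ∑ⁿ-cong U zero p = p
    ∑ⁿ-cong U (suc k) p = ∑-cong U (λ x → ∑ⁿ-cong U k (p x))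

    ∑³-1 : ∀ U → ∑ⁿ U 3 (λ _ _ _ → 1) ≡ cube (length U)
    ∑³-1 U = trans (∑-cong U λ _ → trans (∑-cong U λ _ → trans (∑-const U 1) (*-identityʳ _)) (∑-const U _)) (∑-const U _)

    pigeonhole³ : ∀ U c (f g : Fun 3) → 0 < ∑ⁿ U 3 f → ∑ⁿ U 3 g ≤ c * ∑ⁿ U 3 f →
      ∃ λ x → ∃ λ y → ∃ λ z → 0 < f x y z × g x y z ≤ c * f x y z
    pigeonhole³ U c f g p le with pigeonhole U c p le
    ... | x , px , lx with pigeonhole U c px lx
    ... | y , py , ly with pigeonhole U c py ly
    ... | z , pz , lz = x , y , z , pz , lz

  ∣-factorial : ∀ {a b} → 0 < a → a ≤ b → a ∣ b !
  ∣-factorial {suc a} _ a≤b = ∣-trans (m∣m*n (a !)) (m≤n⇒m!∣n! a≤b)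

  -- Similarity and degree ratios in a single link graph

  module LinkGraph {X : Set} (U : List X) (g : X → X → Bool) (g-sym : ∀ x y → g x y ≡ g y x) (k : ℕ) where
    open Sums {X}
    open ≤-Reasoning

    n : ℕ
    n = length U

    deg : X → ℕ
    deg x = ∑ U λ y → ⟦ g x y ⟧

    codeg : X → X → ℕ
    codeg x y = ∑ U λ w → ⟦ g x w ⟧ * ⟦ g y w ⟧

    similar : X → X → Bool
    similar x y = k ≤ᵇ codeg x y

    sdeg : X → ℕ
    sdeg x = ∑ U λ y → ⟦ similar x y ⟧

    ∑-bounded : ∀ {f : X → ℕ} c → (∀ x → f x ≤ c) → ∑ U f ≤ n * c
    ∑-bounded {f} c p = ≤-trans (∑-mono U p) (≤-reflexive (∑-const U c))

    deg≤n : ∀ x → deg x ≤ n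
    deg≤n x = subst (deg x ≤_) (*-identityʳ n) (∑-bounded 1 (λ y → ⟦⟧≤1 (g x y)))

    codeg≤deg : ∀ x y → codeg x y ≤ deg x
    codeg≤deg x y = ∑-mono U λ w → subst (⟦ g x w ⟧ * ⟦ g y w ⟧ ≤_) (*-identityʳ _) (*-monoʳ-≤ ⟦ g x w ⟧ (⟦⟧≤1 (g y w)))

    k*similar≤codeg : ∀ x y → k * ⟦ similar x y ⟧ ≤ codeg x y
    k*similar≤codeg x y with k ≤ᵇ codeg x y in eq
    ... | true = ≤-trans (≤-reflexive (*-identityʳ k)) (≤ᵇ⇒≤ k (codeg x y) (subst T (sym eq) tt))
    ... | false = ≤-trans (≤-reflexive (*-zeroʳ k)) z≤n

    codeg*dissimilar≤k : ∀ x y → codeg x y * ⟦ not (similar x y) ⟧ ≤ k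
    codeg*dissimilar≤k x y with k ≤ᵇ codeg x y in eq
    ... | true = ≤-trans (≤-reflexive (*-zeroʳ (codeg x y))) z≤n
    ... | false = ≤-trans (≤-reflexive (*-identityʳ _)) (≰⇒≥ λ le → subst T eq (≤⇒≤ᵇ le))

    codeg≤deg*similar+k : ∀ x y → codeg x y ≤ deg x * ⟦ similar x y ⟧ + k
    codeg≤deg*similar+k x y with similar x y | codeg*dissimilar≤k x y
    ... | true | _ = ≤-trans (codeg≤deg x y) (≤-trans (≤-reflexive (sym (*-identityʳ _))) (m≤m+n _ k))
    ... | false | p = ≤-trans (≤-reflexive (sym (*-identityʳ _))) (≤-trans p (m≤n+m k _))

    -- Both sides count the walks `r`-`b`-`u`.
    ∑-neighbour-deg : ∀ r → ∑ U (λ b → ⟦ g r b ⟧ * deg b) ≡ ∑ U (codeg r)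
    ∑-neighbour-deg r = begin-equality
      ∑ U (λ b → ⟦ g r b ⟧ * deg b)                         ≡⟨ ∑-cong U (λ b → sym (∑-*ˡ U ⟦ g r b ⟧ _)) ⟩
      ∑ U (λ b → ∑ U (λ u → ⟦ g r b ⟧ * ⟦ g b u ⟧))         ≡⟨ ∑-swap U U _ ⟩
      ∑ U (λ u → ∑ U (λ b → ⟦ g r b ⟧ * ⟦ g b u ⟧))         ≡⟨ ∑-cong U (λ u → ∑-cong U (λ b → cong (λ c → ⟦ g r b ⟧ * ⟦ c ⟧) (g-sym b u))) ⟩
      ∑ U (codeg r)                                         ∎

    ∑-neighbour-deg≤ : ∀ r → ∑ U (λ b → ⟦ g r b ⟧ * deg b) ≤ deg r * sdeg r + n * k
    ∑-neighbour-deg≤ r = begin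
      ∑ U (λ b → ⟦ g r b ⟧ * deg b)                         ≡⟨ ∑-neighbour-deg r ⟩
      ∑ U (codeg r)                                         ≤⟨ ∑-mono U (codeg≤deg*similar+k r) ⟩
      ∑ U (λ u → deg r * ⟦ similar r u ⟧ + k)               ≡⟨ ∑-+ U _ _ ⟩
      ∑ U (λ u → deg r * ⟦ similar r u ⟧) + ∑ U (λ _ → k)   ≡⟨ cong₂ _+_ (∑-*ˡ U (deg r) _) (∑-const U k) ⟩
      deg r * sdeg r + n * k                                ∎

    module Weighted (t q : ℕ) (0<t : 0 < t) (qt≤n : q * t ≤ n) (qk≤t : q * k ≤ t) where

      -- Padding by `t` keeps denominators away from zero: the up to `k` walks to a dissimilar
      -- vertex are divided by at least `t`, a fraction of at most `1 / q`, while the padding itself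
      -- costs a row at most `t`, hence at most `n / q`.
      D : X → ℕ
      D x = deg x + t

      -- A common multiple of all possible padded degrees, so that `M / D x` is a natural number.
      M : ℕ
      M = (n + t) !

      private instance
        M≢0 : NonZero M
        M≢0 = (n + t) !≢0

      D∣M : ∀ x → D x ∣ M
      D∣M x = ∣-factorial (≤-trans 0<t (m≤n+m t (deg x))) (+-monoˡ-≤ t (deg≤n x))

      -- M / D x
      w : X → ℕ
      w x = _∣_.quotient (D∣M x)

      wD≡M : ∀ x → w x * D x ≡ M
      wD≡M x = sym (_∣_.equality (D∣M x))

      -- The ratio D y / D x, scaled by M.
      ρ : X → X → ℕ
      ρ x y = D y * w x

      -- The AM-GM gap of two reciprocal ratios. Their product is `M * M`, so their sum is at least
      -- `2 * M` and the truncated subtraction is exact.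
      excess : X → X → ℕ
      excess x y = ρ x y + ρ y x ∸ 2 * M

      Y : X → ℕ
      Y x = ∑ U λ y → ⟦ g x y ⟧ * ρ x y

      private
        ρρ-rearrange : ∀ Dx Dy wx wy → wx * Dx * (wy * Dy) ≡ Dy * wx * (Dx * wy)
        ρρ-rearrange = solve-∀

      ρρ≡MM : ∀ x y → M * M ≡ ρ x y * ρ y x
      ρρ≡MM x y = trans (sym (cong₂ _*_ (wD≡M x) (wD≡M y))) (ρρ-rearrange (D x) (D y) (w x) (w y))

      2M+excess : ∀ x y → 2 * M + excess x y ≡ ρ x y + ρ y x
      2M+excess x y = m+[n∸m]≡n (amgm {ρ x y} {ρ y x} M (ρρ≡MM x y))

      -- For `p = M + e` the hypotheses give `e * e ≡ p * x`, and AM-GM applied to `p` and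
      -- `m * m * x` bounds `2 * (m * e)`. A quadratic gap `x` thus controls the linear deviation of
      -- `p` from `M`, at the price of a fraction `1 / 2m` of `p`.
      ratio-deviation : ∀ m p p' → M * M ≡ p * p' → ∀ x → 2 * M + x ≡ p + p' →
        2 * m * p ≤ 2 * m * M + (p + m * m * x)
      ratio-deviation m p p' pp' x px with ≤-total p M
      ... | inj₁ p≤M = ≤-trans (*-monoʳ-≤ (2 * m) p≤M) (m≤m+n _ _)
      ... | inj₂ M≤p = subst (λ p → 2 * m * p ≤ 2 * m * M + (p + m * m * x)) (m+[n∸m]≡n M≤p) (begin
          2 * m * (M + e)                           ≡⟨ unfold-M+e m M e ⟩
          2 * m * M + 2 * (m * e)                   ≤⟨ +-monoʳ-≤ (2 * m * M) (amgm {M + e} {m * m * x} (m * e) sq) ⟩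
          2 * m * M + (M + e + m * m * x)           ∎)
        where
        e = p ∸ M
        unfold-M+e : ∀ m M e → 2 * m * (M + e) ≡ 2 * m * M + 2 * (m * e)
        unfold-M+e = solve-∀
        pe : p ≡ M + e
        pe = sym (m+[n∸m]≡n M≤p)
        expand : ∀ M e p' x → (M + e) * (2 * M + x) + M * M + e * e ≡ ((M + e) * x + M * M) + (M + e) * (M + e) + M * M
        expand = solve-∀
        collect : ∀ M e p' → (M + e) * (M + e + p') + M * M + e * e ≡ (e * e + (M + e) * p') + (M + e) * (M + e) + M * M
        collect = solve-∀
        -- Multiply `2 * M + x ≡ p + p'` by `p` and replace `p * p'` by `M * M`; adding the same
        -- terms on both sides avoids subtraction.
        ee : e * e ≡ (M + e) * x
        ee = +-cancelʳ-≡ (M * M) _ _ (+-cancelʳ-≡ ((M + e) * (M + e)) _ _ (+-cancelʳ-≡ (M * M) _ _ (begin-equality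
          e * e + M * M + (M + e) * (M + e) + M * M             ≡⟨ cong (λ z → e * e + z + (M + e) * (M + e) + M * M) (trans pp' (cong (_* p') pe)) ⟩
          e * e + (M + e) * p' + (M + e) * (M + e) + M * M      ≡⟨ sym (collect M e p') ⟩
          (M + e) * (M + e + p') + M * M + e * e                ≡⟨ cong (λ z → (M + e) * z + M * M + e * e) (sym (trans px (cong (_+ p') pe))) ⟩
          (M + e) * (2 * M + x) + M * M + e * e                 ≡⟨ expand M e p' x ⟩
          (M + e) * x + M * M + (M + e) * (M + e) + M * M       ∎)))
        square : ∀ m M e x → m * m * ((M + e) * x) ≡ (M + e) * (m * m * x)
        square = solve-∀
        regroup : ∀ m e → m * e * (m * e) ≡ m * m * (e * e)
        regroup = solve-∀
        sq : m * e * (m * e) ≡ (M + e) * (m * m * x)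
        sq = trans (regroup m e) (trans (cong (m * m *_) ee) (square m M e x))

      -- The two errors are `n * k / D r` and `deg r * t / D r`. Since `D r` is at least `t` and at
      -- least `deg r`, each is at most `n / q`.
      Y-upper : ∀ r → q * Y r ≤ M * (q * sdeg r + 2 * n)
      Y-upper r = begin
        q * Y r                                                   ≡⟨ cong (q *_) (trans (∑-cong U (λ b → expand ⟦ g r b ⟧ (deg b) t (w r))) (trans (∑-*ʳ U (w r) _) (cong (_* w r) (trans (∑-+ U _ _) (cong (∑ U (λ b → ⟦ g r b ⟧ * deg b) +_) (∑-*ʳ U t _)))))) ⟩
        q * ((∑ U (λ b → ⟦ g r b ⟧ * deg b) + deg r * t) * w r)   ≤⟨ *-monoʳ-≤ q (*-monoˡ-≤ (w r) (+-monoˡ-≤ (deg r * t) (∑-neighbour-deg≤ r))) ⟩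
        q * ((deg r * sdeg r + n * k + deg r * t) * w r)          ≡⟨ arrange q (deg r) (sdeg r) n k t (w r) ⟩
        w r * deg r * (q * sdeg r) + n * (w r * (q * k)) + w r * deg r * (q * t)
          ≤⟨ +-mono-≤ (+-mono-≤ (*-monoˡ-≤ (q * sdeg r) wd≤M) (*-monoʳ-≤ n (≤-trans (*-monoʳ-≤ (w r) qk≤t) wt≤M))) (*-mono-≤ wd≤M qt≤n) ⟩
        M * (q * sdeg r) + n * M + M * n                          ≡⟨ finish M (q * sdeg r) n ⟩
        M * (q * sdeg r + 2 * n)                                  ∎
        where
        expand : ∀ G d t w → G * ((d + t) * w) ≡ (G * d + G * t) * w
        expand = solve-∀
        arrange : ∀ q d P n k t w → q * ((d * P + n * k + d * t) * w) ≡ w * d * (q * P) + n * (w * (q * k)) + w * d * (q * t)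
        arrange = solve-∀
        finish : ∀ M a n → M * a + n * M + M * n ≡ M * (a + 2 * n)
        finish = solve-∀
        wd≤M : w r * deg r ≤ M
        wd≤M = ≤-trans (*-monoʳ-≤ (w r) (m≤m+n (deg r) t)) (≤-reflexive (wD≡M r))
        wt≤M : w r * t ≤ M
        wt≤M = ≤-trans (*-monoʳ-≤ (w r) (m≤n+m t (deg r))) (≤-reflexive (wD≡M r))

      totalExcess : ℕ
      totalExcess = ∑ U λ r → ∑ U λ b → ⟦ g r b ⟧ * excess r b

      -- Every edge is met from both ends, and its two ratios add up to `2 * M` plus their excess.
      2∑Y : 2 * ∑ U Y ≡ 2 * M * ∑ U deg + totalExcess
      2∑Y = begin-equality
        2 * ∑ U Y             ≡⟨ double (∑ U Y) ⟩
        ∑ U Y + ∑ U Y         ≡⟨ cong (∑ U Y +_) (trans (∑-swap U U _) (∑-cong U λ r → ∑-cong U λ b → cong (λ c → ⟦ c ⟧ * ρ b r) (g-sym b r))) ⟩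
        ∑ U Y + ∑ U (λ r → ∑ U λ b → ⟦ g r b ⟧ * ρ b r)   ≡⟨ sym (∑-+ U _ _) ⟩
        ∑ U (λ r → Y r + ∑ U λ b → ⟦ g r b ⟧ * ρ b r)     ≡⟨ ∑-cong U row ⟩
        ∑ U (λ r → 2 * M * deg r + ∑ U λ b → ⟦ g r b ⟧ * excess r b)   ≡⟨ ∑-+ U _ _ ⟩
        ∑ U (λ r → 2 * M * deg r) + totalExcess           ≡⟨ cong (_+ totalExcess) (∑-*ˡ U (2 * M) deg) ⟩
        2 * M * ∑ U deg + totalExcess                     ∎
        where
        double : ∀ a → 2 * a ≡ a + a
        double = solve-∀
        factor : ∀ G M x → G * (M + x) ≡ M * G + G * x
        factor = solve-∀
        row : ∀ r → Y r + ∑ U (λ b → ⟦ g r b ⟧ * ρ b r) ≡ 2 * M * deg r + ∑ U (λ b → ⟦ g r b ⟧ * excess r b)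
        row r = trans (sym (∑-+ U _ _)) (trans
          (∑-cong U λ b → trans (sym (*-distribˡ-+ ⟦ g r b ⟧ _ _)) (trans (cong (⟦ g r b ⟧ *_) (sym (2M+excess r b))) (factor ⟦ g r b ⟧ (2 * M) (excess r b))))
          (trans (∑-+ U _ _) (cong (_+ ∑ U (λ b → ⟦ g r b ⟧ * excess r b)) (∑-*ˡ U (2 * M) _))))

      M∑deg≤∑Y : 2 * M * ∑ U deg ≤ 2 * ∑ U Y
      M∑deg≤∑Y = subst (2 * M * ∑ U deg ≤_) (sym 2∑Y) (m≤m+n _ _)

      total : ℕ
      total = q * ∑ U sdeg + 2 * (n * n)

      ∑bound : ∑ U (λ r → M * (q * sdeg r + 2 * n)) ≡ M * total
      ∑bound = trans (∑-*ˡ U M _) (cong (M *_) (trans (∑-+ U _ _) (cong₂ _+_ (∑-*ˡ U q sdeg) (trans (∑-const U (2 * n)) (flip₂ n)))))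
        where
        flip₂ : ∀ n → n * (2 * n) ≡ 2 * (n * n)
        flip₂ = solve-∀

      q∑Y≤Mtotal : q * ∑ U Y ≤ M * total
      q∑Y≤Mtotal = subst₂ _≤_ (∑-*ˡ U q Y) ∑bound (∑-mono U Y-upper)

      ∑deg≤∑sdeg : q * ∑ U deg ≤ q * ∑ U sdeg + 2 * (n * n)
      ∑deg≤∑sdeg = *-cancelˡ-≤ (2 * M) {{m*n≢0 2 M}} (certify 0 (+-mono-≤ (*-monoʳ-≤ q M∑deg≤∑Y) (*-monoʳ-≤ 2 q∑Y≤Mtotal))
        (arith q M (∑ U deg) (∑ U Y) total))
        where
        arith : ∀ q M d Y T → 2 * M * (q * d) + (q * (2 * Y) + 2 * (M * T)) + 0 ≡ 2 * M * T + (q * (2 * M * d) + 2 * (q * Y))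
        arith = solve-∀

      -- The loss in `Y-upper`. Together with the excess it makes up everything that is lost between
      -- degrees and similarities, so both are small when the comparison is nearly tight.
      slack : X → ℕ
      slack r = M * (q * sdeg r + 2 * n) ∸ q * Y r

      ∑slack : ∑ U slack + q * ∑ U Y ≡ M * total
      ∑slack = trans (cong (∑ U slack +_) (sym (∑-*ˡ U q Y))) (trans (sym (∑-+ U _ _)) (trans (∑-cong U (λ r → m∸n+n≡m (Y-upper r))) ∑bound))

      module _ (m : ℕ) where

        2mY≤ : ∀ r → 2 * m * Y r ≤ 2 * m * M * deg r + (Y r + m * m * ∑ U (λ b → ⟦ g r b ⟧ * excess r b))
        2mY≤ r = begin
          2 * m * Y r                                                  ≡⟨ sym (∑-*ˡ U (2 * m) _) ⟩
          ∑ U (λ b → 2 * m * (⟦ g r b ⟧ * ρ r b))                      ≤⟨ ∑-mono U pointwise ⟩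
          ∑ U (λ b → 2 * m * M * ⟦ g r b ⟧ + (⟦ g r b ⟧ * ρ r b + m * m * (⟦ g r b ⟧ * excess r b)))
            ≡⟨ trans (∑-+ U _ _) (cong₂ _+_ (∑-*ˡ U (2 * m * M) _) (trans (∑-+ U _ _) (cong (Y r +_) (∑-*ˡ U (m * m) _)))) ⟩
          2 * m * M * deg r + (Y r + m * m * ∑ U (λ b → ⟦ g r b ⟧ * excess r b))  ∎
          where
          left : ∀ m G p → 2 * m * (G * p) ≡ G * (2 * m * p)
          left = solve-∀
          right : ∀ m M G p x → G * (2 * m * M + (p + m * m * x)) ≡ 2 * m * M * G + (G * p + m * m * (G * x))
          right = solve-∀
          pointwise : ∀ b → 2 * m * (⟦ g r b ⟧ * ρ r b) ≤ 2 * m * M * ⟦ g r b ⟧ + (⟦ g r b ⟧ * ρ r b + m * m * (⟦ g r b ⟧ * excess r b))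
          pointwise b = subst₂ _≤_ (sym (left m ⟦ g r b ⟧ (ρ r b))) (right m M ⟦ g r b ⟧ (ρ r b) (excess r b))
            (*-monoʳ-≤ ⟦ g r b ⟧ (ratio-deviation m (ρ r b) (ρ b r) (ρρ≡MM r b) (excess r b) (2M+excess r b)))

        -- By definition of the slack, `q * M * sdeg r` is at most `slack r + q * Y r`, and `2mY≤`
        -- replaces `Y r` by `M * deg r` up to the excess.
        surplus-bound : ∀ r → 2 * m * q * M * (sdeg r ∸ deg r) ≤ 2 * m * slack r + (q * Y r + q * (m * m) * ∑ U (λ b → ⟦ g r b ⟧ * excess r b))
        surplus-bound r with ≤-total (sdeg r) (deg r)
        ... | inj₁ P≤d rewrite m≤n⇒m∸n≡0 P≤d = ≤-trans (≤-reflexive (*-zeroʳ (2 * m * q * M))) z≤n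
        ... | inj₂ d≤P = certify (4 * m * n * M) (+-mono-≤ (*-monoʳ-≤ q (2mY≤ r)) (≤-reflexive (cong (2 * m *_) balance)))
                (arith m q M (sdeg r ∸ deg r) (slack r) (Y r) (∑ U (λ b → ⟦ g r b ⟧ * excess r b)) (deg r) n)
          where
          balance : M * (q * (deg r + (sdeg r ∸ deg r)) + 2 * n) ≡ slack r + q * Y r
          balance = sym (trans (m∸n+n≡m (Y-upper r)) (cong (λ P → M * (q * P + 2 * n)) (sym (m+[n∸m]≡n d≤P))))
          arith : ∀ m q M e Z Y x d n →
            2 * m * q * M * e + (q * (2 * m * M * d + (Y + m * m * x)) + 2 * m * (Z + q * Y)) + 4 * m * n * M
            ≡ 2 * m * Z + (q * Y + q * (m * m) * x) + (q * (2 * m * Y) + 2 * m * (M * (q * (d + e) + 2 * n)))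
          arith = solve-∀

        -- When `total` agrees with `q * ∑ U deg` up to a relative `1 / q`, the terms of order
        -- `m * m` nearly cancel, and what remains bounds the surplus by a relative `1 / m`.
        ∑surplus-bound : 2 * m * q * ∑ U (λ r → sdeg r ∸ deg r) + (2 * m + 2 * (m * m)) * q * ∑ U deg
          ≤ (2 * m + 2 * (m * m) + 1) * total
        ∑surplus-bound = *-cancelˡ-≤ M (certify ((2 * (m * m) + 1) * ∑ U slack)
          (+-mono-≤ (+-mono-≤ summed (*-monoʳ-≤ (q * (m * m)) (≤-reflexive (sym 2∑Y))))
            (+-mono-≤ (*-monoʳ-≤ (q * m) M∑deg≤∑Y) (*-monoʳ-≤ (2 * m + 2 * (m * m) + 1) (≤-reflexive ∑slack))))
          (arith m q M (∑ U (λ r → sdeg r ∸ deg r)) (∑ U deg) total (∑ U Y) totalExcess (∑ U slack)))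
          where
          summed : 2 * m * q * M * ∑ U (λ r → sdeg r ∸ deg r) ≤ 2 * m * ∑ U slack + (q * ∑ U Y + q * (m * m) * totalExcess)
          summed = subst₂ _≤_ (∑-*ˡ U (2 * m * q * M) _)
            (trans (∑-+ U _ _) (cong₂ _+_ (∑-*ˡ U (2 * m) slack) (trans (∑-+ U _ _) (cong₂ _+_ (∑-*ˡ U q Y) (∑-*ˡ U (q * (m * m)) _)))))
            (∑-mono U surplus-bound)
          arith : ∀ m q M F d T Y x Z →
            M * (2 * m * q * F + (2 * m + 2 * (m * m)) * q * d)
              + (2 * m * Z + (q * Y + q * (m * m) * x) + q * (m * m) * (2 * Y) + (q * m * (2 * Y) + (2 * m + 2 * (m * m) + 1) * (M * T)))
              + (2 * (m * m) + 1) * Z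
            ≡ M * ((2 * m + 2 * (m * m) + 1) * T)
              + (2 * m * q * M * F + q * (m * m) * (2 * M * d + x) + (q * m * (2 * M * d) + (2 * m + 2 * (m * m) + 1) * (Z + q * Y)))
          arith = solve-∀

  -- Defects of a link from a union of balanced complete bipartite graphs

  module LinkPaths {X : Set} (U : List X) (g : X → X → Bool) (g-sym : ∀ x y → g x y ≡ g y x) (k : ℕ) where
    open Sums {X}
    open LinkGraph U g g-sym k
    open ≤-Reasoning

    surplus : ℕ
    surplus = ∑ U λ r → sdeg r ∸ deg r

    -- For positive `k` this vanishes on disjoint unions of complete bipartite graphs, where
    -- vertices with a common neighbour have the same neighbourhood.
    missingAt : X → X → X → ℕ
    missingAt r b u = ⟦ g r b ⟧ * (⟦ similar r u ⟧ * ⟦ not (g b u) ⟧)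

    missing : ℕ
    missing = ∑ⁿ U 3 missingAt

    -- A path on four vertices that does not close into a four-cycle. Disjoint unions of complete
    -- bipartite graphs have none, and the closing of such paths is the tool by which edges are
    -- later deduced from other edges.
    openPathAt : X → X → X → X → ℕ
    openPathAt p q r s = ⟦ g p q ⟧ * (⟦ g q r ⟧ * (⟦ g r s ⟧ * ⟦ not (g p s) ⟧))

    openPaths : ℕ
    openPaths = ∑ⁿ U 4 openPathAt

    imbalance : ℕ
    imbalance = ∑ U λ r → ∑ U λ b → ⟦ g r b ⟧ * (deg b ∸ deg r)

    error : ℕ
    error = n * surplus + n * (n * k)

    private
      deg-sdeg : ∀ d P → d ≤ n → d * P ≤ n * (P ∸ d) + d * d
      deg-sdeg d P d≤n with ≤-total P d
      ... | inj₁ P≤d = ≤-trans (*-monoʳ-≤ d P≤d) (m≤n+m _ _)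
      ... | inj₂ d≤P = subst (λ z → d * z ≤ n * (P ∸ d) + d * d) (m∸n+n≡m d≤P)
        (≤-trans (≤-reflexive (*-distribˡ-+ d (P ∸ d) d)) (+-monoˡ-≤ (d * d) (*-monoˡ-≤ (P ∸ d) d≤n)))

      -- The pairs of a neighbour `b` of `r` and a vertex `u` similar to `r` comprise the missing
      -- pairs and the walks `r`-`b`-`u` with similar ends. The walks with dissimilar ends number at
      -- most `k` for each `u`.
      missing-row : ∀ r → ∑ⁿ U 2 (missingAt r) + ∑ U (codeg r) ≤ deg r * sdeg r + n * k
      missing-row r = begin
        ∑ⁿ U 2 (missingAt r) + ∑ U (codeg r)   ≡⟨ cong (∑ⁿ U 2 (missingAt r) +_) (sym (∑-neighbour-deg r)) ⟩
        ∑ⁿ U 2 (missingAt r) + ∑ U (λ b → ⟦ g r b ⟧ * deg b)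
          ≡⟨ trans (cong (∑ⁿ U 2 (missingAt r) +_) (∑-cong U λ b → sym (∑-*ˡ U ⟦ g r b ⟧ _))) (trans (sym (∑-+ U _ _)) (∑-cong U λ b → sym (∑-+ U _ _))) ⟩
        ∑ U (λ b → ∑ U λ u → missingAt r b u + ⟦ g r b ⟧ * ⟦ g b u ⟧)
          ≤⟨ ∑-mono U (λ b → ∑-mono U λ u → pointwise (g r b) (similar r u) (g b u)) ⟩
        ∑ U (λ b → ∑ U λ u → ⟦ g r b ⟧ * ⟦ similar r u ⟧ + ⟦ g r b ⟧ * ⟦ g b u ⟧ * ⟦ not (similar r u) ⟧)
          ≡⟨ trans (∑-cong U λ b → ∑-+ U _ _) (∑-+ U _ _) ⟩
        ∑ U (λ b → ∑ U λ u → ⟦ g r b ⟧ * ⟦ similar r u ⟧) + ∑ U (λ b → ∑ U λ u → ⟦ g r b ⟧ * ⟦ g b u ⟧ * ⟦ not (similar r u) ⟧)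
          ≡⟨ cong₂ _+_ (trans (∑-cong U λ b → ∑-*ˡ U ⟦ g r b ⟧ _) (∑-*ʳ U (sdeg r) _))
               (trans (∑-swap U U _) (∑-cong U λ u → trans (∑-*ʳ U ⟦ not (similar r u) ⟧ _) (cong (_* ⟦ not (similar r u) ⟧) (∑-cong U λ b → cong (λ c → ⟦ g r b ⟧ * ⟦ c ⟧) (g-sym b u))))) ⟩
        deg r * sdeg r + ∑ U (λ u → codeg r u * ⟦ not (similar r u) ⟧)
          ≤⟨ +-monoʳ-≤ (deg r * sdeg r) (∑-bounded k (codeg*dissimilar≤k r)) ⟩
        deg r * sdeg r + n * k  ∎
        where
        pointwise : ∀ a s b → ⟦ a ⟧ * (⟦ s ⟧ * ⟦ not b ⟧) + ⟦ a ⟧ * ⟦ b ⟧ ≤ ⟦ a ⟧ * ⟦ s ⟧ + ⟦ a ⟧ * ⟦ b ⟧ * ⟦ not s ⟧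
        pointwise false _ _ = z≤n
        pointwise true true true = ≤-refl
        pointwise true true false = ≤-refl
        pointwise true false true = ≤-refl
        pointwise true false false = z≤n

      ∑codeg≡∑deg² : ∑ U (λ r → ∑ U (codeg r)) ≡ ∑ U λ b → deg b * deg b
      ∑codeg≡∑deg² = begin-equality
        ∑ U (λ r → ∑ U (codeg r))                       ≡⟨ ∑-cong U (λ r → sym (∑-neighbour-deg r)) ⟩
        ∑ U (λ r → ∑ U (λ b → ⟦ g r b ⟧ * deg b))       ≡⟨ ∑-swap U U _ ⟩
        ∑ U (λ b → ∑ U (λ r → ⟦ g r b ⟧ * deg b))       ≡⟨ ∑-cong U (λ b → trans (∑-*ʳ U (deg b) _) (cong (_* deg b) (∑-cong U λ r → cong ⟦_⟧ (g-sym r b)))) ⟩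
        ∑ U (λ b → deg b * deg b)                       ∎

    -- The walks with two edges number `∑ deg²` in total. Summing the rows therefore leaves
    -- `deg * sdeg` minus `deg * deg`, which is controlled by the surplus.
    missing≤ : missing ≤ error
    missing≤ = +-cancelʳ-≤ (∑ U λ r → deg r * deg r) _ _ (begin
      missing + ∑ U (λ r → deg r * deg r)                   ≡⟨ trans (cong (missing +_) (sym ∑codeg≡∑deg²)) (sym (∑-+ U _ _)) ⟩
      ∑ U (λ r → ∑ⁿ U 2 (missingAt r) + ∑ U (codeg r))      ≤⟨ ∑-mono U missing-row ⟩
      ∑ U (λ r → deg r * sdeg r + n * k)                    ≤⟨ ∑-mono U (λ r → +-monoˡ-≤ (n * k) (deg-sdeg (deg r) (sdeg r) (deg≤n r))) ⟩
      ∑ U (λ r → n * (sdeg r ∸ deg r) + deg r * deg r + n * k)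
        ≡⟨ trans (∑-+ U _ _) (cong₂ _+_ (trans (∑-+ U _ _) (cong (_+ ∑ U (λ r → deg r * deg r)) (∑-*ˡ U n _))) (∑-const U (n * k))) ⟩
      n * surplus + ∑ U (λ r → deg r * deg r) + n * (n * k) ≡⟨ shuffle (n * surplus) _ (n * (n * k)) ⟩
      error + ∑ U (λ r → deg r * deg r)                     ∎)
      where
      shuffle : ∀ a b c → a + b + c ≡ a + c + b
      shuffle = solve-∀

    ∑²-dissimilar-paths : ∑ⁿ U 3 (λ r b u → ⟦ g r b ⟧ * ⟦ g b u ⟧ * ⟦ not (similar r u) ⟧) ≤ n * (n * k)
    ∑²-dissimilar-paths = ∑-bounded (n * k) λ r → ≤-trans (≤-reflexive (trans (∑-swap U U _) (∑-cong U λ u →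
      trans (∑-*ʳ U ⟦ not (similar r u) ⟧ _) (cong (_* ⟦ not (similar r u) ⟧) (∑-cong U λ b → cong (λ c → ⟦ g r b ⟧ * ⟦ c ⟧) (g-sym b u))))))
      (∑-bounded k (codeg*dissimilar≤k r))

    -- A neighbour `u` of `b` is reached from `r` through `b`, so it is similar to `r` unless the
    -- walk `r`-`b`-`u` has dissimilar ends. Up to such walks `deg b` is at most `sdeg r`.
    imbalance≤ : imbalance ≤ error
    imbalance≤ = begin
      imbalance ≤⟨ ∑-mono U (λ r → ∑-mono U λ b → pointwise r b) ⟩
      ∑ U (λ r → ∑ U λ b → (sdeg r ∸ deg r) + ∑ U λ u → ⟦ g r b ⟧ * ⟦ g b u ⟧ * ⟦ not (similar r u) ⟧)
        ≡⟨ trans (∑-cong U λ r → trans (∑-+ U _ _) (cong (_+ ∑ⁿ U 2 (λ b u → ⟦ g r b ⟧ * ⟦ g b u ⟧ * ⟦ not (similar r u) ⟧)) (∑-const U _)))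
            (trans (∑-+ U _ _) (cong (_+ ∑ⁿ U 3 (λ r b u → ⟦ g r b ⟧ * ⟦ g b u ⟧ * ⟦ not (similar r u) ⟧)) (∑-*ˡ U n _))) ⟩
      n * surplus + ∑ⁿ U 3 (λ r b u → ⟦ g r b ⟧ * ⟦ g b u ⟧ * ⟦ not (similar r u) ⟧) ≤⟨ +-monoʳ-≤ (n * surplus) ∑²-dissimilar-paths ⟩
      error ∎
      where
      dissimilar-part : X → X → ℕ
      dissimilar-part r b = ∑ U λ u → ⟦ g b u ⟧ * ⟦ not (similar r u) ⟧
      cover : ∀ a s → ⟦ a ⟧ ≤ ⟦ s ⟧ + ⟦ a ⟧ * ⟦ not s ⟧
      cover false s = z≤n
      cover true true = ≤-refl
      cover true false = ≤-refl
      deg≤ : ∀ r b → deg b ≤ sdeg r + dissimilar-part r b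
      deg≤ r b = ≤-trans (∑-mono U λ u → cover (g b u) (similar r u)) (≤-reflexive (∑-+ U _ _))
      pointwise : ∀ r b → ⟦ g r b ⟧ * (deg b ∸ deg r) ≤ (sdeg r ∸ deg r) + ∑ U λ u → ⟦ g r b ⟧ * ⟦ g b u ⟧ * ⟦ not (similar r u) ⟧
      pointwise r b = begin
        ⟦ g r b ⟧ * (deg b ∸ deg r)   ≤⟨ *-monoʳ-≤ ⟦ g r b ⟧ (≤-trans (∸-monoˡ-≤ (deg r) (deg≤ r b)) (m+n∸o≤ (sdeg r) (dissimilar-part r b) (deg r))) ⟩
        ⟦ g r b ⟧ * ((sdeg r ∸ deg r) + dissimilar-part r b)   ≡⟨ *-distribˡ-+ ⟦ g r b ⟧ _ _ ⟩
        ⟦ g r b ⟧ * (sdeg r ∸ deg r) + ⟦ g r b ⟧ * dissimilar-part r b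
          ≤⟨ +-mono-≤ (⟦⟧*≤ (g r b) _) (≤-reflexive (trans (sym (∑-*ˡ U ⟦ g r b ⟧ _)) (∑-cong U λ u → sym (*-assoc ⟦ g r b ⟧ _ _)))) ⟩
        (sdeg r ∸ deg r) + ∑ U (λ u → ⟦ g r b ⟧ * ⟦ g b u ⟧ * ⟦ not (similar r u) ⟧) ∎
        where
        m+n∸o≤ : ∀ a b c → a + b ∸ c ≤ (a ∸ c) + b
        m+n∸o≤ a b c = m≤n+o⇒m∸n≤o (a + b) c (≤-trans (+-monoˡ-≤ b (m≤n+m∸n a c)) (≤-reflexive (+-assoc c (a ∸ c) b)))

    -- If `p` and `r` are similar, the non-edge `ps` is missing at `r`; otherwise `r`-`q`-`p` is a
    -- walk with dissimilar ends. Either way the remaining vertex is free and gives the extra factor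
    -- `n`.
    openPaths≤ : openPaths ≤ n * missing + n * (n * (n * k))
    openPaths≤ = begin
      openPaths ≤⟨ ∑ⁿ-mono U 4 pointwise ⟩
      ∑ⁿ U 4 (λ p q r s → missingAt r s p + ⟦ g r q ⟧ * ⟦ g q p ⟧ * ⟦ not (similar r p) ⟧)
        ≡⟨ split-sum ⟩
      ∑ⁿ U 4 (λ p q r s → missingAt r s p) + ∑ⁿ U 4 (λ p q r s → ⟦ g r q ⟧ * ⟦ g q p ⟧ * ⟦ not (similar r p) ⟧)
        ≡⟨ cong₂ _+_ (trans (∑-permute U (0 ∷ 1 ∷ 2 ∷ []) 4 λ q r s p → missingAt r s p) (∑-const U missing))
            (trans (∑-permute U (0 ∷ 1 ∷ 2 ∷ 0 ∷ 1 ∷ 0 ∷ []) 4 λ s r q p → ⟦ g r q ⟧ * ⟦ g q p ⟧ * ⟦ not (similar r p) ⟧) (∑-const U _)) ⟩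
      n * missing + n * ∑ⁿ U 3 (λ r b u → ⟦ g r b ⟧ * ⟦ g b u ⟧ * ⟦ not (similar r u) ⟧)
        ≤⟨ +-monoʳ-≤ (n * missing) (*-monoʳ-≤ n ∑²-dissimilar-paths) ⟩
      n * missing + n * (n * (n * k)) ∎
      where
      bools : ∀ pq qr rs ps sim → ⟦ pq ⟧ * (⟦ qr ⟧ * (⟦ rs ⟧ * ⟦ not ps ⟧)) ≤ ⟦ rs ⟧ * (⟦ sim ⟧ * ⟦ not ps ⟧) + ⟦ qr ⟧ * ⟦ pq ⟧ * ⟦ not sim ⟧
      bools false _ _ _ _ = z≤n
      bools true false _ _ _ = z≤n
      bools true true false _ _ = z≤n
      bools true true true true _ = z≤n
      bools true true true false true = ≤-refl
      bools true true true false false = ≤-refl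
      pointwise : ∀ p q r s → openPathAt p q r s ≤ missingAt r s p + ⟦ g r q ⟧ * ⟦ g q p ⟧ * ⟦ not (similar r p) ⟧
      pointwise p q r s rewrite g-sym s p | g-sym r q | g-sym q p = bools (g p q) (g q r) (g r s) (g p s) (similar r p)
      split-sum : _
      split-sum = trans (∑-cong U λ p → trans (∑-cong U λ q → trans (∑-cong U λ r → ∑-+ U _ _) (∑-+ U _ _)) (∑-+ U _ _)) (∑-+ U _ _)

  -- Edges against similar pairs in a C₅⁻-free graph

  private
    -- The conflicts leave at most one of the three similarities, so only an edge that also has one
    -- can push the sum beyond 1.
    conflict-free-sum : ∀ e a b c → (T a → T b → ⊥₀) → (T a → T c → ⊥₀) → (T b → T c → ⊥₀) →
      ⟦ e ⟧ + (⟦ a ⟧ + (⟦ b ⟧ + ⟦ c ⟧)) + ⟦ not (e ∨ (a ∨ (b ∨ c))) ⟧ ≤ 1 + (⟦ e ⟧ * ⟦ a ⟧ + (⟦ e ⟧ * ⟦ b ⟧ + ⟦ e ⟧ * ⟦ c ⟧))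
    conflict-free-sum _ true true _ ab _ _ = ⊥-elim (ab tt tt)
    conflict-free-sum _ true false true _ ac _ = ⊥-elim (ac tt tt)
    conflict-free-sum _ false true true _ _ bc = ⊥-elim (bc tt tt)
    conflict-free-sum true true false false _ _ _ = ≤-refl
    conflict-free-sum true false true false _ _ _ = ≤-refl
    conflict-free-sum true false false true _ _ _ = ≤-refl
    conflict-free-sum true false false false _ _ _ = ≤-refl
    conflict-free-sum false true false false _ _ _ = ≤-refl
    conflict-free-sum false false true false _ _ _ = ≤-refl
    conflict-free-sum false false false true _ _ _ = ≤-refl
    conflict-free-sum false false false false _ _ _ = ≤-refl

  ⟦∧⟧ : ∀ a b → ⟦ a ∧ b ⟧ ≡ ⟦ a ⟧ * ⟦ b ⟧
  ⟦∧⟧ true b = sym (+-identityʳ ⟦ b ⟧)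
  ⟦∧⟧ false b = refl

  0<⟦⟧⇒T : ∀ b → 0 < ⟦ b ⟧ → T b
  0<⟦⟧⇒T true _ = tt

  module Hypergraph {X : Set} (h : X → X → X → Bool)
    (h-swap₁ : ∀ x y z → h x y z ≡ h y x z) (h-swap₂ : ∀ x y z → h x y z ≡ h x z y)
    (C₅⁻-free : ∀ {a b c d e} → T (h a b c) → T (h b c d) → T (h c d e) → T (h d e a) → b ≡ e) where

    open Sums {X}
    open ≤-Reasoning

    h-swap₁₃ : ∀ x y z → h x y z ≡ h z y x
    h-swap₁₃ x y z = trans (h-swap₁ x y z) (trans (h-swap₂ y x z) (h-swap₁ y z x))

    h-rot : ∀ x y z → h x y z ≡ h y z x
    h-rot x y z = trans (h-swap₁ x y z) (h-swap₂ y x z)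

    module Counting (U : List X) (unique : Unique U) (k : ℕ) (2≤k : 2 ≤ k) where

      module L (v : X) = LinkGraph U (h v) (h-swap₂ v) k
      module LP (v : X) = LinkPaths U (h v) (h-swap₂ v) k
      open L using (deg; codeg; similar; sdeg)

      n : ℕ
      n = length U

      edges : ℕ
      edges = ∑ⁿ U 3 λ x y z → ⟦ h x y z ⟧

      similarities : ℕ
      similarities = ∑ⁿ U 3 λ v x y → ⟦ similar v x y ⟧

      codeg-sym : ∀ v x y → codeg v x y ≡ codeg v y x
      codeg-sym v x y = ∑-cong U λ w → *-comm ⟦ h v x w ⟧ ⟦ h v y w ⟧

      similar-sym : ∀ v x y → similar v x y ≡ similar v y x
      similar-sym v x y = cong (k ≤ᵇ_) (codeg-sym v x y)

      K₄⁻-count : ℕ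
      K₄⁻-count = ∑ⁿ U 3 λ x y z → ⟦ h x y z ⟧ * codeg x y z

      K₄⁻-count≤ : K₄⁻-count ≤ n * (n * n)
      K₄⁻-count≤ = begin
        K₄⁻-count
          ≡⟨ ∑-cong U (λ x → ∑-cong U λ y → ∑-cong U λ z → trans (sym (∑-*ˡ U ⟦ h x y z ⟧ _)) (∑-cong U λ w →
               sym (trans (⟦∧⟧ (h x y z) _) (cong (⟦ h x y z ⟧ *_) (⟦∧⟧ (h x y w) (h x z w)))))) ⟩
        ∑ⁿ U 4 (λ x y z w → ⟦ h x y z ∧ (h x y w ∧ h x z w) ⟧)
          ≡⟨ ∑-permute U (0 ∷ 1 ∷ 2 ∷ []) 4 (λ y z w x → ⟦ h x y z ∧ (h x y w ∧ h x z w) ⟧) ⟩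
        ∑ⁿ U 4 (λ y z w x → ⟦ h x y z ∧ (h x y w ∧ h x z w) ⟧)
          ≤⟨ ∑ⁿ-mono U 3 {g = λ _ _ _ → 1} (λ y z w → ∑-atMostOne unique (one-apex y z w)) ⟩
        ∑ⁿ U 3 (λ _ _ _ → 1)
          ≡⟨ ∑³-1 U ⟩
        n * (n * n) ∎
        where
        one-apex : ∀ y z w x x' → T (h x y z ∧ (h x y w ∧ h x z w)) → T (h x' y z ∧ (h x' y w ∧ h x' z w)) → x ≡ x'
        one-apex y z w x x' p p' with T-∧ {h x y z} p | T-∧ {h x' y z} p'
        ... | xyz , q | x'yz , q' with T-∧ {h x y w} q | T-∧ {h x' y w} q'
        -- In the cyclic order `y`, `x`, `z`, `w`, `x'` four consecutive triples are edges, and the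
        -- two apexes take the places of the one pair that C₅⁻-freeness forces to coincide.
        ... | xyw , xzw | x'yw , x'zw = C₅⁻-free {y} {x} {z} {w} {x'}
          (subst T (h-swap₁ x y z) xyz) xzw (subst T (h-rot x' z w) x'zw) (subst T (trans (h-swap₁₃ x' y w) (h-swap₂ w y x')) x'yw)

      -- Fix one path `y`-`w`-`z` in the link of `x`. Any path `x`-`u`-`z` in the link of `y` must
      -- then have `u ≡ w`, so there is at most one, against `2 ≤ k`.
      similar-conflict : ∀ x y z → T (similar x y z) → T (similar y x z) → ⊥₀
      similar-conflict x y z p q = <⇒≱ 2≤k (≤-trans (≤ᵇ⇒≤ k (codeg y x z) q)
          (≤-trans (≤-reflexive (∑-cong U λ u → sym (⟦∧⟧ (h y x u) (h y z u)))) (∑-atMostOne unique λ u u' a b → trans (≡w u a) (sym (≡w u' b)))))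
        where
        witness : ∃ λ w → 0 < ⟦ h x y w ⟧ * ⟦ h x z w ⟧
        witness = ∑-pos U (≤-trans (≤-trans (s≤s z≤n) 2≤k) (≤ᵇ⇒≤ k (codeg x y z) p))
        w = proj₁ witness
        xyw∧xzw = T-∧ {h x y w} (0<⟦⟧⇒T _ (subst (0 <_) (sym (⟦∧⟧ (h x y w) (h x z w))) (proj₂ witness)))
        ≡w : ∀ u → T (h y x u ∧ h y z u) → u ≡ w
        ≡w u t with T-∧ {h y x u} t
        ... | yxu , yzu = C₅⁻-free {z} {u} {y} {x} {w}
          (subst T (h-rot y z u) yzu) (subst T (sym (h-rot u y x)) yxu)
          (subst T (h-swap₁ x y w) (proj₁ xyw∧xzw)) (subst T (h-swap₂ x z w) (proj₂ xyw∧xzw))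

      uncoveredAt : X → X → X → ℕ
      uncoveredAt x y z = ⟦ not (h x y z ∨ (similar x y z ∨ (similar y x z ∨ similar z x y))) ⟧

      uncovered : ℕ
      uncovered = ∑ⁿ U 3 uncoveredAt

      similarEdges : ℕ
      similarEdges = ∑ⁿ U 3 λ x y z → ⟦ h x y z ⟧ * ⟦ similar x y z ⟧

      k*similarEdges≤ : k * similarEdges ≤ n * (n * n)
      k*similarEdges≤ = begin
        k * similarEdges ≡⟨ sym (trans (∑-cong U λ x → trans (∑-cong U λ y → ∑-*ˡ U k _) (∑-*ˡ U k _)) (∑-*ˡ U k _)) ⟩
        ∑ⁿ U 3 (λ x y z → k * (⟦ h x y z ⟧ * ⟦ similar x y z ⟧)) ≤⟨ ∑ⁿ-mono U 3 pointwise ⟩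
        K₄⁻-count ≤⟨ K₄⁻-count≤ ⟩
        n * (n * n) ∎
        where
        move : ∀ k a b → k * (a * b) ≡ a * (k * b)
        move = solve-∀
        pointwise : ∀ x y z → k * (⟦ h x y z ⟧ * ⟦ similar x y z ⟧) ≤ ⟦ h x y z ⟧ * codeg x y z
        pointwise x y z = subst (_≤ ⟦ h x y z ⟧ * codeg x y z) (sym (move k ⟦ h x y z ⟧ ⟦ similar x y z ⟧))
          (*-monoʳ-≤ ⟦ h x y z ⟧ (L.k*similar≤codeg x y z))

      covering : edges + 3 * similarities + uncovered ≤ n * (n * n) + 3 * similarEdges
      covering = subst₂ _≤_ lhs rhs (∑ⁿ-mono U 3 λ x y z → conflict-free-sum (h x y z) (similar x y z) (similar y x z) (similar z x y)
          (similar-conflict x y z)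
          (λ p q → similar-conflict x z y (subst T (similar-sym x y z) p) q)
          (λ p q → similar-conflict y z x (subst T (similar-sym y x z) p) (subst T (similar-sym z x y) q)))
        where
        triple-sum : ∀ a → a + (a + a) ≡ 3 * a
        triple-sum = solve-∀
        lhs : _ ≡ edges + 3 * similarities + uncovered
        lhs = trans (∑ⁿ-+ U 3 _ uncoveredAt) (cong (_+ uncovered) (trans (∑ⁿ-+ U 3 _ _) (cong (edges +_) (trans (∑ⁿ-+ U 3 _ _) (trans (cong (similarities +_)
          (trans (∑ⁿ-+ U 3 _ _) (cong₂ _+_ (∑-permute U (0 ∷ []) 3 λ y x z → ⟦ similar y x z ⟧) (∑-permute U (1 ∷ 0 ∷ []) 3 λ z x y → ⟦ similar z x y ⟧))))
          (triple-sum similarities))))))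
        rhs : _ ≡ n * (n * n) + 3 * similarEdges
        rhs = trans (∑ⁿ-+ U 3 _ _) (cong₂ _+_ (∑³-1 U) (trans (∑ⁿ-+ U 3 _ _) (trans (cong (similarEdges +_) (trans (∑ⁿ-+ U 3 _ _) (cong₂ _+_
            (trans (∑-cong U λ x → ∑-cong U λ y → ∑-cong U λ z → cong (λ e → ⟦ e ⟧ * ⟦ similar y x z ⟧) (h-swap₁ x y z)) (∑-permute U (0 ∷ []) 3 λ y x z → ⟦ h y x z ⟧ * ⟦ similar y x z ⟧))
            (trans (∑-cong U λ x → ∑-cong U λ y → ∑-cong U λ z → cong (λ e → ⟦ e ⟧ * ⟦ similar z x y ⟧) (sym (h-rot z x y))) (∑-permute U (1 ∷ 0 ∷ []) 3 λ z x y → ⟦ h z x y ⟧ * ⟦ similar z x y ⟧)))))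
          (triple-sum similarEdges))))

  -- The density bound and its stability, summed over all links

  module Estimates {X : Set} (h : X → X → X → Bool)
    (h-swap₁ : ∀ x y z → h x y z ≡ h y x z) (h-swap₂ : ∀ x y z → h x y z ≡ h x z y)
    (C₅⁻-free : ∀ {a b c d e} → T (h a b c) → T (h b c d) → T (h c d e) → T (h d e a) → b ≡ e)
    (U : List X) (unique : Unique U) (m t k : ℕ) (2≤m : 2 ≤ m) (0<t : 0 < t)
    (m²t≤n : m * m * t ≤ length U) (m²k≤t : m * m * k ≤ t) (m²≤k : m * m ≤ k) where

    open Sums {X}
    open ≤-Reasoning
    open Hypergraph h h-swap₁ h-swap₂ C₅⁻-free

    q : ℕ
    q = m * m

    m≤q : m ≤ q
    m≤q = subst (_≤ q) (*-identityʳ m) (*-monoʳ-≤ m (≤-trans (s≤s z≤n) 2≤m))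

    1≤q : 1 ≤ q
    1≤q = ≤-trans (≤-trans (s≤s z≤n) 2≤m) m≤q

    open Counting U unique k (≤-trans 2≤m (≤-trans m≤q m²≤k)) public

    private
      instance
        q≢0 : NonZero q
        q≢0 = >-nonZero 1≤q

    a≤qa : ∀ a → a ≤ q * a
    a≤qa a = subst (_≤ q * a) (*-identityˡ a) (*-monoˡ-≤ a 1≤q)

    k≤n : k ≤ n
    k≤n = ≤-trans (a≤qa k) (≤-trans m²k≤t (≤-trans (a≤qa t) m²t≤n))

    m≤n : m ≤ n
    m≤n = ≤-trans m≤q (≤-trans m²≤k k≤n)

    mk≤n : m * k ≤ n
    mk≤n = ≤-trans (*-monoˡ-≤ k m≤q) (≤-trans m²k≤t (≤-trans (a≤qa t) m²t≤n))

    n³ : ℕ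
    n³ = n * (n * n)

    module W (v : X) = LinkGraph.Weighted U (h v) (h-swap₂ v) k t q 0<t m²t≤n m²k≤t

    edges≤similarities : q * edges ≤ q * similarities + 2 * n³
    edges≤similarities = subst₂ _≤_ (∑-*ˡ U q _) (trans (∑-+ U _ _) (cong₂ _+_ (∑-*ˡ U q _) (trans (∑-const U _) (assoc n))))
        (∑-mono U W.∑deg≤∑sdeg)
      where
      assoc : ∀ n → n * (2 * (n * n)) ≡ 2 * (n * (n * n))
      assoc = solve-∀

    q*similarEdges≤ : q * similarEdges ≤ n³
    q*similarEdges≤ = ≤-trans (*-monoˡ-≤ similarEdges m²≤k) k*similarEdges≤

    -- Three copies of `edges≤similarities` turn the similarities in `covering` into edges with
    -- error 6, and three copies of `q*similarEdges≤` add another 3.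
    density : 4 * (q * edges) ≤ q * n³ + 9 * n³
    density = certify (q * uncovered) (+-mono-≤ (*-monoʳ-≤ q covering) (+-mono-≤ (*-monoʳ-≤ 3 q*similarEdges≤) (*-monoʳ-≤ 3 edges≤similarities)))
        (arith q edges similarities uncovered similarEdges n³)
      where
      arith : ∀ q E S V H N → 4 * (q * E) + (q * (N + 3 * H) + (3 * N + 3 * (q * S + 2 * N))) + q * V
        ≡ q * N + 9 * N + (q * (E + 3 * S + V) + (3 * (q * H) + 3 * (q * E)))
      arith = solve-∀

    surplus : ℕ
    surplus = ∑ U LP.surplus

    missing : ℕ
    missing = ∑ U LP.missing

    openPaths : ℕ
    openPaths = ∑ U LP.openPaths

    imbalance : ℕ
    imbalance = ∑ U LP.imbalance

    module Dense (dense : q * n³ ≤ 4 * (q * edges) + n³) where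

      total : ℕ
      total = q * similarities + 2 * n³

      q*uncovered≤ : q * uncovered ≤ 10 * n³
      q*uncovered≤ = certify 0 (+-mono-≤ (+-mono-≤ (*-monoʳ-≤ q covering) (*-monoʳ-≤ 3 q*similarEdges≤)) (+-mono-≤ (*-monoʳ-≤ 3 edges≤similarities) dense))
          (arith q edges similarities uncovered similarEdges n³)
        where
        arith : ∀ q E S V H N → q * V + (q * (N + 3 * H) + 3 * N + (3 * (q * S + 2 * N) + (4 * (q * E) + N))) + 0
          ≡ 10 * N + (q * (E + 3 * S + V) + 3 * (q * H) + (3 * (q * E) + q * N))
        arith = solve-∀

      m*uncovered≤ : m * uncovered ≤ 10 * n³
      m*uncovered≤ = ≤-trans (*-monoˡ-≤ uncovered m≤q) q*uncovered≤

      3total≤ : 3 * total ≤ 3 * (q * edges) + 10 * n³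
      3total≤ = certify (q * uncovered) (+-mono-≤ (*-monoʳ-≤ q covering) (+-mono-≤ (*-monoʳ-≤ 3 q*similarEdges≤) dense))
          (arith q edges similarities uncovered similarEdges n³)
        where
        arith : ∀ q E S V H N → 3 * (q * S + 2 * N) + (q * (N + 3 * H) + (3 * N + (4 * (q * E) + N))) + q * V
          ≡ 3 * (q * E) + 10 * N + (q * (E + 3 * S + V) + (3 * (q * H) + q * N))
        arith = solve-∀

      total≤ : total ≤ (q + 2) * n³
      total≤ = begin
        q * similarities + 2 * n³   ≤⟨ +-monoˡ-≤ (2 * n³) (*-monoʳ-≤ q similarities≤) ⟩
        q * n³ + 2 * n³             ≡⟨ sym (*-distribʳ-+ n³ q 2) ⟩
        (q + 2) * n³                ∎
        where
        similarities≤ : similarities ≤ n³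
        similarities≤ = ≤-trans (∑ⁿ-mono U 3 {g = λ _ _ _ → 1} λ v x y → ⟦⟧≤1 (L.similar v x y)) (≤-reflexive (∑³-1 U))

      -- By `3total≤` the comparison of similarities and edges is tight up to a constant multiple of
      -- `n³`, a relative `1 / q`. Multiplied by the factor of order `m` lost in `∑surplus-bound`
      -- this is a relative `1 / m`, because `q = m * m`.
      m*surplus≤ : m * surplus ≤ 9 * n³
      m*surplus≤ = *-cancelˡ-≤ (6 * q) {{m*n≢0 6 q}} (certify (5 * (q * n³))
          (+-mono-≤ (+-mono-≤ (*-monoʳ-≤ 3 summed) (*-monoʳ-≤ (2 * m + 2 * q) 3total≤))
            (+-mono-≤ (*-monoʳ-≤ 3 total≤) (+-mono-≤ (*-monoʳ-≤ 20 (*-monoˡ-≤ n³ m≤q)) (*-monoʳ-≤ 6 (*-monoˡ-≤ n³ 1≤q)))))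
          (arith m q surplus edges total n³))
        where
        summed : 2 * m * q * surplus + (2 * m + 2 * q) * q * edges ≤ (2 * m + 2 * q + 1) * total
        summed = subst₂ _≤_ (trans (∑-+ U _ _) (cong₂ _+_ (∑-*ˡ U (2 * m * q) _) (∑-*ˡ U ((2 * m + 2 * q) * q) _)))
            (trans (∑-*ˡ U (2 * m + 2 * q + 1) _) (cong ((2 * m + 2 * q + 1) *_) (trans (∑-+ U _ _) (cong₂ _+_ (∑-*ˡ U q _) (trans (∑-const U _) (assoc n))))))
            (∑-mono U λ v → W.∑surplus-bound v m)
          where
          assoc : ∀ n → n * (2 * (n * n)) ≡ 2 * (n * (n * n))
          assoc = solve-∀
        arith : ∀ m q F E T N →
          6 * q * (m * F) + (3 * ((2 * m + 2 * q + 1) * T) + (2 * m + 2 * q) * (3 * (q * E) + 10 * N) + (3 * ((q + 2) * N) + (20 * (q * N) + 6 * (q * N)))) + 5 * (q * N)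
          ≡ 6 * q * (9 * N) + (3 * (2 * m * q * F + (2 * m + 2 * q) * q * E) + (2 * m + 2 * q) * (3 * T) + (3 * T + (20 * (m * N) + 6 * (1 * N))))
        arith = solve-∀

      private
        m*error≤ : m * ∑ U LP.error ≤ 10 * (n * n³)
        m*error≤ = begin
          m * ∑ U LP.error ≡⟨ cong (m *_) (trans (∑-+ U _ _) (cong₂ _+_ (∑-*ˡ U n _) (∑-const U _))) ⟩
          m * (n * surplus + n * (n * (n * k)))    ≡⟨ shuffle m n surplus k ⟩
          n * (m * surplus) + n * (n * n) * (m * k)  ≤⟨ +-mono-≤ (*-monoʳ-≤ n m*surplus≤) (*-monoʳ-≤ n³ mk≤n) ⟩
          n * (9 * n³) + n³ * n                    ≡⟨ collect n n³ ⟩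
          10 * (n * n³)                            ∎
          where
          shuffle : ∀ m n F k → m * (n * F + n * (n * (n * k))) ≡ n * (m * F) + n * (n * n) * (m * k)
          shuffle = solve-∀
          collect : ∀ n N → n * (9 * N) + N * n ≡ 10 * (n * N)
          collect = solve-∀

      m*missing≤ : m * missing ≤ 10 * (n * n³)
      m*missing≤ = ≤-trans (*-monoʳ-≤ m (∑-mono U LP.missing≤)) m*error≤

      m*imbalance≤ : m * imbalance ≤ 10 * (n * n³)
      m*imbalance≤ = ≤-trans (*-monoʳ-≤ m (∑-mono U LP.imbalance≤)) m*error≤

      m*openPaths≤ : m * openPaths ≤ 11 * (n * (n * n³))
      m*openPaths≤ = begin
        m * openPaths                                          ≤⟨ *-monoʳ-≤ m (∑-mono U LP.openPaths≤) ⟩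
        m * ∑ U (λ v → n * LP.missing v + n * (n * (n * k)))   ≡⟨ cong (m *_) (trans (∑-+ U _ _) (cong₂ _+_ (∑-*ˡ U n _) (∑-const U _))) ⟩
        m * (n * missing + n * (n * (n * (n * k))))            ≡⟨ shuffle m n missing k ⟩
        n * (m * missing) + n * (n * (n * n)) * (m * k)        ≤⟨ +-mono-≤ (*-monoʳ-≤ n m*missing≤) (*-monoʳ-≤ (n * n³) mk≤n) ⟩
        n * (10 * (n * n³)) + n * n³ * n                       ≡⟨ collect n n³ ⟩
        11 * (n * (n * n³))                                    ∎
        where
        shuffle : ∀ m n F k → m * (n * F + n * (n * (n * (n * k)))) ≡ n * (m * F) + n * (n * (n * n)) * (m * k)
        shuffle = solve-∀
        collect : ∀ n N → n * (10 * (n * N)) + n * N * n ≡ 11 * (n * (n * N))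
        collect = solve-∀

  -- Defects seen from a single edge

  module Costs {X : Set} (h : X → X → X → Bool)
    (h-swap₁ : ∀ x y z → h x y z ≡ h y x z) (h-swap₂ : ∀ x y z → h x y z ≡ h x z y)
    (C₅⁻-free : ∀ {a b c d e} → T (h a b c) → T (h b c d) → T (h c d e) → T (h d e a) → b ≡ e)
    (U : List X) (unique : Unique U) (m t k : ℕ) (2≤m : 2 ≤ m) (0<t : 0 < t)
    (m²t≤n : m * m * t ≤ length U) (m²k≤t : m * m * k ≤ t) (m²≤k : m * m ≤ k) where

    open Sums {X}
    open ≤-Reasoning
    open Hypergraph h h-swap₁ h-swap₂ C₅⁻-free
    open Estimates h h-swap₁ h-swap₂ C₅⁻-free U unique m t k 2≤m 0<t m²t≤n m²k≤t m²≤k public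
    open L using (deg; codeg; similar; sdeg)
    open LP using (openPathAt; missingAt)

    deg-sym : ∀ x y → deg x y ≡ deg y x
    deg-sym x y = ∑-cong U λ z → cong ⟦_⟧ (h-swap₁ x y z)

    -- For an edge xyz put A = N(yz), B = N(xz), C = N(xy).
    -- strayEdges counts the edges abw with a ∈ A, b ∈ B, w ∉ C.
    strayEdges : X → X → X → ℕ
    strayEdges x y z = ∑ⁿ U 3 λ a b w → ⟦ h a y z ⟧ * (⟦ h x b z ⟧ * (⟦ h w a b ⟧ * ⟦ not (h x y w) ⟧))

    -- In an exact construction a vertex similar at `b` to an element `a` of A lies in A itself.
    straySimilar : X → X → X → ℕ
    straySimilar x y z = ∑ⁿ U 3 λ a b w → ⟦ h a y z ⟧ * (⟦ h x b z ⟧ * (⟦ similar b w a ⟧ * ⟦ not (h w y z) ⟧))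

    private
      bools₁ : ∀ xyz ayz xbz wab xyw abz bwx →
        ⟦ xyz ⟧ * (⟦ ayz ⟧ * (⟦ xbz ⟧ * (⟦ wab ⟧ * ⟦ not xyw ⟧))) ≤
        ⟦ ayz ⟧ * (⟦ xyz ⟧ * (⟦ xbz ⟧ * ⟦ not abz ⟧)) +
        (⟦ wab ⟧ * (⟦ abz ⟧ * (⟦ xbz ⟧ * ⟦ not bwx ⟧)) + ⟦ bwx ⟧ * (⟦ xbz ⟧ * (⟦ xyz ⟧ * ⟦ not xyw ⟧)))
      bools₁ false _ _ _ _ _ _ = z≤n
      bools₁ true false _ _ _ _ _ = z≤n
      bools₁ true true false _ _ _ _ = z≤n
      bools₁ true true true false _ _ _ = z≤n
      bools₁ true true true true true _ _ = z≤n
      bools₁ true true true true false false _ = s≤s z≤n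
      bools₁ true true true true false true false = s≤s z≤n
      bools₁ true true true true false true true = s≤s z≤n

      bools₂ : ∀ xyz ayz xbz s wyz abz bzw →
        ⟦ xyz ⟧ * (⟦ ayz ⟧ * (⟦ xbz ⟧ * (⟦ s ⟧ * ⟦ not wyz ⟧))) ≤
        ⟦ ayz ⟧ * (⟦ xyz ⟧ * (⟦ xbz ⟧ * ⟦ not abz ⟧)) +
        (⟦ abz ⟧ * (⟦ s ⟧ * ⟦ not bzw ⟧) + ⟦ bzw ⟧ * (⟦ xbz ⟧ * (⟦ xyz ⟧ * ⟦ not wyz ⟧)))
      bools₂ false _ _ _ _ _ _ = z≤n
      bools₂ true false _ _ _ _ _ = z≤n
      bools₂ true true false _ _ _ _ = z≤n
      bools₂ true true true false _ _ _ = z≤n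
      bools₂ true true true true true _ _ = z≤n
      bools₂ true true true true false false _ = s≤s z≤n
      bools₂ true true true true false true false = s≤s z≤n
      bools₂ true true true true false true true = s≤s z≤n

      -- Three paths should close in turn: `a`-`y`-`x`-`b` in the link of `z` to give `abz`, then
      -- `w`-`a`-`z`-`x` in the link of `b` to give `bwx`, then `w`-`b`-`z`-`y` in the link of `x`
      -- to give `xyw`, which contradicts `w` outside C. The first path that stays open is charged.
      stray-pointwise : ∀ x y z a b w →
        ⟦ h x y z ⟧ * (⟦ h a y z ⟧ * (⟦ h x b z ⟧ * (⟦ h w a b ⟧ * ⟦ not (h x y w) ⟧))) ≤
        openPathAt z a y x b + (openPathAt b w a z x + openPathAt x w b z y)
      stray-pointwise x y z a b w
        rewrite h-rot z a y | trans (h-rot z y x) (h-swap₁ y x z) | h-rot z x b | h-rot z a b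
          | h-rot b w a | h-swap₁ b a z | trans (h-swap₁₃ b z x) (h-swap₂ x z b)
          | h-swap₁₃ x w b | h-swap₂ x z y | h-swap₂ x w y
          = bools₁ (h x y z) (h a y z) (h x b z) (h w a b) (h x y w) (h a b z) (h b w x)

      -- In the link of `z` the path `a`-`y`-`x`-`b` should give `abz`. At `b`, the similarity of
      -- `w` and `a` should carry the neighbour `z` of `a` over to `w`. Then `w`-`b`-`x`-`y` in the
      -- link of `z` should give `wyz`. The first step that fails is charged.
      similar-pointwise : ∀ x y z a b w →
        ⟦ h x y z ⟧ * (⟦ h a y z ⟧ * (⟦ h x b z ⟧ * (⟦ similar b w a ⟧ * ⟦ not (h w y z) ⟧))) ≤
        openPathAt z a y x b + (missingAt b a z w + openPathAt z w b x y)
      similar-pointwise x y z a b w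
        rewrite h-rot z a y | trans (h-rot z y x) (h-swap₁ y x z) | h-rot z x b | h-rot z a b
          | h-swap₁ b a z | similar-sym b w a | h-rot z w b | h-rot w b z | h-swap₂ b z w | h-rot z b x | h-swap₁ b x z | h-rot z w y
          | h-rot z x y
          = bools₂ (h x y z) (h a y z) (h x b z) (similar b a w) (h w y z) (h a b z) (h b w z)

    ∑E : (X → X → X → ℕ) → ℕ
    ∑E F = ∑ⁿ U 3 λ x y z → ⟦ h x y z ⟧ * F x y z

    ∑E-+ : ∀ F G → ∑E (λ x y z → F x y z + G x y z) ≡ ∑E F + ∑E G
    ∑E-+ F G = trans (∑ⁿ-cong U 3 λ x y z → *-distribˡ-+ ⟦ h x y z ⟧ (F x y z) (G x y z)) (∑ⁿ-+ U 3 _ _)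

    ∑E-swap₁ : ∀ F → ∑E (λ x y z → F y x z) ≡ ∑E F
    ∑E-swap₁ F = trans (∑ⁿ-cong U 3 λ x y z → cong (λ e → ⟦ e ⟧ * F y x z) (h-swap₁ x y z))
      (∑-permute U (0 ∷ []) 3 λ y x z → ⟦ h y x z ⟧ * F y x z)

    ∑E-swap₂ : ∀ F → ∑E (λ x y z → F x z y) ≡ ∑E F
    ∑E-swap₂ F = trans (∑ⁿ-cong U 3 λ x y z → cong (λ e → ⟦ e ⟧ * F x z y) (h-swap₂ x y z))
      (∑-permute U (1 ∷ []) 3 λ x z y → ⟦ h x z y ⟧ * F x z y)

    ∑E-rot : ∀ F → ∑E (λ x y z → F y z x) ≡ ∑E F
    ∑E-rot F = trans (∑E-swap₁ λ x y z → F x z y) (∑E-swap₂ F)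

    ∑E-rot⁻¹ : ∀ F → ∑E (λ x y z → F z x y) ≡ ∑E F
    ∑E-rot⁻¹ F = trans (∑E-swap₂ λ x y z → F y x z) (∑E-swap₁ F)

    private
      ∑E-nested : ∀ (F : X → X → X → X → X → X → ℕ) → ∑E (λ x y z → ∑ⁿ U 3 (F x y z)) ≡ ∑ⁿ U 6 (λ x y z a b w → ⟦ h x y z ⟧ * F x y z a b w)
      ∑E-nested F = ∑ⁿ-cong U 3 λ x y z → sym (∑ⁿ-*ˡ U 3 ⟦ h x y z ⟧ (F x y z))

    -- An open path together with the vertex whose link contains it fixes five of the six vertices,
    -- and the sixth gives the factor `n`. A missing pair fixes only four, whence `n * n` in
    -- `∑E-straySimilar≤`.
    ∑E-strayEdges≤ : ∑E strayEdges ≤ n * openPaths + (n * openPaths + n * openPaths)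
    ∑E-strayEdges≤ = begin
      ∑E strayEdges ≡⟨ ∑E-nested (λ x y z a b w → ⟦ h a y z ⟧ * (⟦ h x b z ⟧ * (⟦ h w a b ⟧ * ⟦ not (h x y w) ⟧))) ⟩
      ∑ⁿ U 6 (λ x y z a b w → ⟦ h x y z ⟧ * (⟦ h a y z ⟧ * (⟦ h x b z ⟧ * (⟦ h w a b ⟧ * ⟦ not (h x y w) ⟧))))
        ≤⟨ ∑ⁿ-mono U 6 stray-pointwise ⟩
      ∑ⁿ U 6 (λ x y z a b w → openPathAt z a y x b + (openPathAt b w a z x + openPathAt x w b z y))
        ≡⟨ trans (∑ⁿ-+ U 6 _ _) (cong₂ _+_
             (trans (∑-permute U (4 ∷ 3 ∷ 2 ∷ 1 ∷ 0 ∷ 2 ∷ 1 ∷ 3 ∷ 2 ∷ 3 ∷ []) 6 λ w z a y x b → openPathAt z a y x b) (∑-const U openPaths))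
             (trans (∑ⁿ-+ U 6 _ _) (cong₂ _+_
               (trans (∑-permute U (0 ∷ 3 ∷ 2 ∷ 1 ∷ 4 ∷ 3 ∷ 2 ∷ 4 ∷ 3 ∷ 4 ∷ []) 6 λ y b w a z x → openPathAt b w a z x) (∑-const U openPaths))
               (trans (∑-permute U (2 ∷ 1 ∷ 0 ∷ 4 ∷ 3 ∷ 2 ∷ 4 ∷ 3 ∷ 4 ∷ []) 6 λ a x w b z y → openPathAt x w b z y) (∑-const U openPaths))))) ⟩
      n * openPaths + (n * openPaths + n * openPaths) ∎

    ∑E-straySimilar≤ : ∑E straySimilar ≤ n * openPaths + (n * (n * missing) + n * openPaths)
    ∑E-straySimilar≤ = begin
      ∑E straySimilar ≡⟨ ∑E-nested (λ x y z a b w → ⟦ h a y z ⟧ * (⟦ h x b z ⟧ * (⟦ similar b w a ⟧ * ⟦ not (h w y z) ⟧))) ⟩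
      ∑ⁿ U 6 (λ x y z a b w → ⟦ h x y z ⟧ * (⟦ h a y z ⟧ * (⟦ h x b z ⟧ * (⟦ similar b w a ⟧ * ⟦ not (h w y z) ⟧))))
        ≤⟨ ∑ⁿ-mono U 6 similar-pointwise ⟩
      ∑ⁿ U 6 (λ x y z a b w → openPathAt z a y x b + (missingAt b a z w + openPathAt z w b x y))
        ≡⟨ trans (∑ⁿ-+ U 6 _ _) (cong₂ _+_
             (trans (∑-permute U (4 ∷ 3 ∷ 2 ∷ 1 ∷ 0 ∷ 2 ∷ 1 ∷ 3 ∷ 2 ∷ 3 ∷ []) 6 λ w z a y x b → openPathAt z a y x b) (∑-const U openPaths))
             (trans (∑ⁿ-+ U 6 _ _) (cong₂ _+_
               (trans (∑-permute U (3 ∷ 2 ∷ 3 ∷ []) 6 λ x y b a z w → missingAt b a z w) (trans (∑-cong U λ _ → ∑-const U missing) (∑-const U (n * missing))))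
               (trans (∑-permute U (2 ∷ 1 ∷ 0 ∷ 2 ∷ 1 ∷ 4 ∷ 3 ∷ 2 ∷ 4 ∷ 3 ∷ []) 6 λ a z w b x y → openPathAt z w b x y) (∑-const U openPaths))))) ⟩
      n * openPaths + (n * (n * missing) + n * openPaths) ∎

    -- The three codegrees are the sizes of the pairwise intersections of A, B and C.
    coincidence : X → X → X → ℕ
    coincidence x y z = codeg x y z + (codeg y x z + codeg z x y)

    ∑E-coincidence≤ : ∑E coincidence ≤ n³ + (n³ + n³)
    ∑E-coincidence≤ = ≤-trans (≤-reflexive (trans (∑E-+ _ _) (cong (∑E codeg +_) (trans (∑E-+ _ _) (cong₂ _+_ (∑E-swap₁ codeg) (∑E-rot⁻¹ codeg))))))
      (+-mono-≤ K₄⁻-count≤ (+-mono-≤ K₄⁻-count≤ K₄⁻-count≤))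

    -- The amounts by which |C| exceeds |A| and |B|. They bound A and B from below once `deg x y` is
    -- large, and they bound `deg x y` from above by about a third of `n`.
    asymmetry : X → X → X → ℕ
    asymmetry x y z = (deg x y ∸ deg y z) + (deg x y ∸ deg x z)

    ∑E-asymmetry : ∑E asymmetry ≡ imbalance + imbalance
    ∑E-asymmetry = trans (∑E-+ _ _) (cong₂ _+_
      (trans (∑ⁿ-cong U 3 λ x y z → cong (λ d → ⟦ h x y z ⟧ * (d ∸ deg y z)) (deg-sym x y)) (∑E-rot λ x r b → deg x b ∸ deg x r))
      (∑E-swap₂ λ x r b → deg x b ∸ deg x r))

    strays : X → X → X → ℕ
    strays x y z = strayEdges x y z + (strayEdges x z y + strayEdges y z x)

    -- The four instances charged by `failB≤` and `failC≤`.
    similars : X → X → X → ℕ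
    similars x y z = straySimilar x y z + (straySimilar y x z + (straySimilar x z y + straySimilar z x y))

    deviation : X → X → X → ℕ
    deviation x y z = asymmetry x y z + coincidence x y z

    -- The first two terms count triples and the deviation counts vertices; the factor `n * n` makes
    -- them comparable.
    cost : X → X → X → ℕ
    cost x y z = strays x y z + (similars x y z + n * n * deviation x y z)

    ∑E-cost : ∑E cost ≡ 3 * ∑E strayEdges + (4 * ∑E straySimilar + n * n * ∑E deviation)
    ∑E-cost = trans (∑E-+ _ _) (cong₂ _+_
      (trans (∑E-+ _ _) (trans (cong (∑E strayEdges +_) (trans (∑E-+ _ _) (cong₂ _+_ (∑E-swap₂ strayEdges) (∑E-rot strayEdges)))) (thrice (∑E strayEdges))))
      (trans (∑E-+ _ _) (cong₂ _+_
        (trans (∑E-+ _ _) (trans (cong (∑E straySimilar +_) (trans (∑E-+ _ _) (cong₂ _+_ (∑E-swap₁ straySimilar)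
          (trans (∑E-+ _ _) (cong₂ _+_ (∑E-swap₂ straySimilar) (∑E-rot⁻¹ straySimilar)))))) (four-times (∑E straySimilar))))
        (trans (∑ⁿ-cong U 3 λ x y z → move ⟦ h x y z ⟧ (n * n) (deviation x y z)) (∑ⁿ-*ˡ U 3 (n * n) _)))))
      where
      thrice : ∀ a → a + (a + a) ≡ 3 * a
      thrice = solve-∀
      four-times : ∀ a → a + (a + (a + a)) ≡ 4 * a
      four-times = solve-∀
      move : ∀ a b c → a * (b * c) ≡ b * (a * c)
      move = solve-∀

    -- Selecting a typical edge on a large pair

    module Selection (10≤q : 10 ≤ q) (dense : q * n³ ≤ 4 * (q * edges) + n³) where
      open Dense dense public

      m*∑E-deviation≤ : m * ∑E deviation ≤ 23 * (n * n³)
      m*∑E-deviation≤ = begin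
        m * ∑E deviation                                     ≡⟨ cong (m *_) (trans (∑E-+ _ _) (cong (_+ ∑E coincidence) ∑E-asymmetry)) ⟩
        m * (imbalance + imbalance + ∑E coincidence)             ≤⟨ *-monoʳ-≤ m (+-monoʳ-≤ (imbalance + imbalance) ∑E-coincidence≤) ⟩
        m * (imbalance + imbalance + (n³ + (n³ + n³)))       ≡⟨ expand m imbalance n³ ⟩
        2 * (m * imbalance) + 3 * (m * n³)                   ≤⟨ +-mono-≤ (*-monoʳ-≤ 2 m*imbalance≤) (*-monoʳ-≤ 3 (*-monoˡ-≤ n³ m≤n)) ⟩
        2 * (10 * (n * n³)) + 3 * (n * n³)                   ≡⟨ collect (n * n³) ⟩
        23 * (n * n³)                                        ∎
        where
        expand : ∀ m b N → m * (b + b + (N + (N + N))) ≡ 2 * (m * b) + 3 * (m * N)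
        expand = solve-∀
        collect : ∀ a → 2 * (10 * a) + 3 * a ≡ 23 * a
        collect = solve-∀

      m*∑E-cost≤ : m * ∑E cost ≤ 250 * (n³ * n³)
      m*∑E-cost≤ = begin
        m * ∑E cost ≡⟨ cong (m *_) ∑E-cost ⟩
        m * (3 * ∑E strayEdges + (4 * ∑E straySimilar + n * n * ∑E deviation))
          ≤⟨ *-monoʳ-≤ m (+-mono-≤ (*-monoʳ-≤ 3 ∑E-strayEdges≤) (+-monoˡ-≤ (n * n * ∑E deviation) (*-monoʳ-≤ 4 ∑E-straySimilar≤))) ⟩
        m * (3 * (n * openPaths + (n * openPaths + n * openPaths)) + (4 * (n * openPaths + (n * (n * missing) + n * openPaths)) + n * n * ∑E deviation))
          ≡⟨ expand m n openPaths missing (∑E deviation) ⟩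
        -- The open paths occur `3 * 3 + 4 * 2` times, and `17 * 11 + 4 * 10 + 23` is 250.
        17 * (n * (m * openPaths)) + (4 * (n * (n * (m * missing))) + n * n * (m * ∑E deviation))
          ≤⟨ +-mono-≤ (*-monoʳ-≤ 17 (*-monoʳ-≤ n m*openPaths≤)) (+-mono-≤ (*-monoʳ-≤ 4 (*-monoʳ-≤ n (*-monoʳ-≤ n m*missing≤))) (*-monoʳ-≤ (n * n) m*∑E-deviation≤)) ⟩
        17 * (n * (11 * (n * (n * n³)))) + (4 * (n * (n * (10 * (n * n³)))) + n * n * (23 * (n * n³)))
          ≡⟨ collect n n³ ⟩
        250 * (n³ * n³) ∎
        where
        expand : ∀ m n P M D → m * (3 * (n * P + (n * P + n * P)) + (4 * (n * P + (n * (n * M) + n * P)) + n * n * D))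
          ≡ 17 * (n * (m * P)) + (4 * (n * (n * (m * M))) + n * n * (m * D))
        expand = solve-∀
        collect : ∀ n N → 17 * (n * (11 * (n * (n * N)))) + (4 * (n * (n * (10 * (n * N)))) + n * n * (23 * (n * N))) ≡ 250 * (n * (n * n) * N)
        collect = solve-∀

      large : X → X → Bool
      large x y = n ≤ᵇ 5 * deg x y

      weight : X → X → X → ℕ
      weight x y z = ⟦ h x y z ⟧ * ⟦ large x y ⟧

      -- The pairs that are not large carry at most n/5 edges each.
      5edges≤ : 5 * edges ≤ 5 * ∑ⁿ U 3 weight + n³
      5edges≤ = subst₂ _≤_ (trans (∑-cong U λ x → ∑-*ˡ U 5 _) (∑-*ˡ U 5 _))
          (trans (∑ⁿ-+ U 2 _ _) (cong₂ _+_ (trans (∑-cong U λ x → ∑-*ˡ U 5 _) (∑-*ˡ U 5 _)) (trans (∑-cong U λ x → ∑-const U n) (∑-const U (n * n)))))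
          (∑ⁿ-mono U 2 pointwise)
        where
        pointwise : ∀ x y → 5 * deg x y ≤ 5 * ∑ U (weight x y) + n
        pointwise x y with n ≤ᵇ 5 * deg x y in eq
        ... | true = ≤-trans (≤-reflexive (cong (5 *_) (∑-cong U λ z → sym (*-identityʳ _)))) (m≤m+n _ n)
        ... | false = ≤-trans (≰⇒≥ λ le → subst T eq (≤⇒≤ᵇ le)) (m≤n+m n _)

      -- The density 1/4 less the 1/5 on small pairs leaves 1/20, of which the deficit `1 / 4q`
      -- takes at most half because `10 ≤ q`.
      n³≤40weight : n³ ≤ 40 * ∑ⁿ U 3 weight
      n³≤40weight = *-cancelˡ-≤ q {{>-nonZero 1≤q}} (certify 0
          (+-mono-≤ (*-monoʳ-≤ (8 * q) 5edges≤) (+-mono-≤ (*-monoʳ-≤ 10 dense) (*-monoˡ-≤ n³ 10≤q)))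
          (arith q n³ edges (∑ⁿ U 3 weight)))
        where
        arith : ∀ q N E w → q * N + (8 * q * (5 * w + N) + (10 * (4 * (q * E) + N) + q * N)) + 0
           ≡ q * (40 * w) + (8 * q * (5 * E) + (10 * (q * N) + 10 * N))
        arith = solve-∀

      selected : ∃ λ x → ∃ λ y → ∃ λ z → T (h x y z) × n ≤ 5 * deg x y × m * cost x y z ≤ 10000 * n³
      -- The constant is `250 * 40`, from the total cost and the lower bound on the total weight.
      selected = let (x , y , z , p , c) = pigeonhole³ U (10000 * n³) weight (λ x y z → m * (⟦ h x y z ⟧ * cost x y z)) total-pos total-cost
                 in x , y , z , conclude (10000 * n³) x y z (h x y z) (large x y) refl p c
        where
        1≤n : 1 ≤ n
        1≤n = ≤-trans (≤-trans (s≤s z≤n) 2≤m) m≤n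
        total-pos : 0 < ∑ⁿ U 3 weight
        total-pos = *-cancelˡ-< 40 0 _ (≤-trans (*-mono-≤ 1≤n (*-mono-≤ 1≤n 1≤n)) n³≤40weight)
        shuffle : ∀ N w → 250 * (N * (40 * w)) ≡ 10000 * N * w
        shuffle = solve-∀
        total-cost : ∑ⁿ U 3 (λ x y z → m * (⟦ h x y z ⟧ * cost x y z)) ≤ 10000 * n³ * ∑ⁿ U 3 weight
        total-cost = begin
          ∑ⁿ U 3 (λ x y z → m * (⟦ h x y z ⟧ * cost x y z)) ≡⟨ ∑ⁿ-*ˡ U 3 m _ ⟩
          m * ∑E cost                                        ≤⟨ m*∑E-cost≤ ⟩
          250 * (n³ * n³)                                    ≤⟨ *-monoʳ-≤ 250 (*-monoʳ-≤ n³ n³≤40weight) ⟩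
          250 * (n³ * (40 * ∑ⁿ U 3 weight))                  ≡⟨ shuffle n³ (∑ⁿ U 3 weight) ⟩
          10000 * n³ * ∑ⁿ U 3 weight                         ∎
        conclude : ∀ c x y z e l → l ≡ large x y → 0 < ⟦ e ⟧ * ⟦ l ⟧ → m * (⟦ e ⟧ * cost x y z) ≤ c * (⟦ e ⟧ * ⟦ l ⟧) →
          T e × n ≤ 5 * deg x y × m * cost x y z ≤ c
        conclude c x y z true true eq _ le = tt , ≤ᵇ⇒≤ n (5 * deg x y) (subst T eq tt) ,
          subst₂ _≤_ (cong (m *_) (*-identityˡ _)) (*-identityʳ c) le

  -- The vertices outside the three neighbourhoods of an edge

  module Partition {X : Set} (h : X → X → X → Bool)
    (h-swap₁ : ∀ x y z → h x y z ≡ h y x z) (h-swap₂ : ∀ x y z → h x y z ≡ h x z y)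
    (C₅⁻-free : ∀ {a b c d e} → T (h a b c) → T (h b c d) → T (h c d e) → T (h d e a) → b ≡ e)
    (U : List X) (unique : Unique U) (m t k : ℕ) (2≤m : 2 ≤ m) (0<t : 0 < t)
    (m²t≤n : m * m * t ≤ length U) (m²k≤t : m * m * k ≤ t) (m²≤k : m * m ≤ k) where

    open Sums {X}
    open ≤-Reasoning
    open Hypergraph h h-swap₁ h-swap₂ C₅⁻-free
    open Costs h h-swap₁ h-swap₂ C₅⁻-free U unique m t k 2≤m 0<t m²t≤n m²k≤t m²≤k
    open L using (deg; codeg; similar; sdeg)

    deg-sum≤ : ∀ x y z → deg x y + (deg x z + deg y z) ≤ n + coincidence x y z
    deg-sum≤ x y z = subst₂ _≤_
      (trans (∑-+ U _ _) (cong (deg x y +_) (∑-+ U _ _)))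
      (trans (∑-+ U _ _) (cong₂ _+_ (trans (∑-const U 1) (*-identityʳ n)) (trans (∑-+ U _ _) (cong (codeg x y z +_) (trans (∑-+ U _ _) (cong₂ _+_
         (∑-cong U λ w → cong (λ e → ⟦ e ⟧ * ⟦ h y z w ⟧) (h-swap₁ x y w))
         (∑-cong U λ w → cong₂ (λ e f → ⟦ e ⟧ * ⟦ f ⟧) (h-swap₁ x z w) (h-swap₁ y z w))))))))
      (∑-mono U λ w → bools (h x y w) (h x z w) (h y z w))
      where
      bools : ∀ c b a → ⟦ c ⟧ + (⟦ b ⟧ + ⟦ a ⟧) ≤ 1 + (⟦ c ⟧ * ⟦ b ⟧ + (⟦ c ⟧ * ⟦ a ⟧ + ⟦ b ⟧ * ⟦ a ⟧))
      bools true true true = s≤s (s≤s (s≤s z≤n))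
      bools true true false = ≤-refl
      bools true false true = ≤-refl
      bools true false false = ≤-refl
      bools false true true = ≤-refl
      bools false true false = ≤-refl
      bools false false true = ≤-refl
      bools false false false = z≤n

    -- Codegrees rarely exceed n / 3, since the three codegrees of a typical edge are nearly equal and sum to at most n.
    heavy : ℕ
    heavy = ∑ⁿ U 2 λ x y → 3 * deg x y ∸ n

    -- Where `3 * deg x y` exceeds `n`, multiplying by the former instead of the latter only
    -- increases the sum. It becomes a sum over edges, for which `light` compares the three
    -- codegrees of the edge.
    n*heavy≤ : n * heavy ≤ 3 * ∑E deviation
    n*heavy≤ = begin
      n * heavy                                                ≡⟨ sym (∑ⁿ-*ˡ U 2 n _) ⟩
      ∑ⁿ U 2 (λ x y → n * (3 * deg x y ∸ n))                   ≤⟨ ∑ⁿ-mono U 2 (λ x y → scale (deg x y)) ⟩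
      ∑ⁿ U 2 (λ x y → 3 * (deg x y * (3 * deg x y ∸ n)))       ≡⟨ ∑ⁿ-*ˡ U 2 3 _ ⟩
      3 * ∑ⁿ U 2 (λ x y → deg x y * (3 * deg x y ∸ n))         ≡⟨ cong (3 *_) (∑ⁿ-cong U 2 λ x y → sym (∑-*ʳ U (3 * deg x y ∸ n) _)) ⟩
      3 * ∑E (λ x y z → 3 * deg x y ∸ n)                       ≤⟨ *-monoʳ-≤ 3 (∑ⁿ-mono U 3 λ x y z → *-monoʳ-≤ ⟦ h x y z ⟧ (light x y z)) ⟩
      3 * ∑E deviation ∎
      where
      scale : ∀ d → n * (3 * d ∸ n) ≤ 3 * (d * (3 * d ∸ n))
      scale d with ≤-total (3 * d) n
      ... | inj₁ 3d≤n = subst (_≤ 3 * (d * (3 * d ∸ n))) (sym (trans (cong (n *_) (m≤n⇒m∸n≡0 3d≤n)) (*-zeroʳ n))) z≤n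
      ... | inj₂ n≤3d = ≤-trans (*-monoˡ-≤ (3 * d ∸ n) n≤3d) (≤-reflexive (*-assoc 3 d _))
      light : ∀ x y z → 3 * deg x y ∸ n ≤ deviation x y z
      light x y z = m≤n+o⇒m∸n≤o (3 * deg x y) n (certify 0
        (+-mono-≤ (deg-sum≤ x y z) (+-mono-≤ (m≤n+m∸n (deg x y) (deg x z)) (m≤n+m∸n (deg x y) (deg y z))))
        (arith n (deg x y) (deg x z) (deg y z) (deg x y ∸ deg x z) (deg x y ∸ deg y z) (coincidence x y z)))
        where
        arith : ∀ n a b c a-b a-c o → 3 * a + (n + o + (b + a-b + (c + a-c))) + 0 ≡ n + (a-c + a-b + o) + (a + (b + c) + (a + a))
        arith = solve-∀

    module Parts (x y z : X) where

      A B C W : X → Bool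
      A a = h a y z
      B b = h x b z
      C c = h x y c
      W w = not (A w ∨ (B w ∨ C w))

      α β γ ω ζ : ℕ
      α = ∑ U λ u → ⟦ A u ⟧
      β = ∑ U λ u → ⟦ B u ⟧
      γ = ∑ U λ u → ⟦ C u ⟧
      ω = ∑ U λ u → ⟦ W u ⟧
      ζ = ∑ U λ u → ⟦ B u ∨ C u ⟧

      γ≤α : γ ≤ α + deviation x y z
      γ≤α = ≤-trans (m≤n+m∸n γ (deg y z)) (+-mono-≤ (≤-reflexive (∑-cong U λ a → cong ⟦_⟧ (sym (h-rot a y z)))) (≤-trans (m≤m+n _ _) (m≤m+n _ _)))

      γ≤β : γ ≤ β + deviation x y z
      γ≤β = ≤-trans (m≤n+m∸n γ (deg x z)) (+-mono-≤ (≤-reflexive (∑-cong U λ a → cong ⟦_⟧ (h-swap₂ x z a))) (≤-trans (m≤n+m _ (γ ∸ deg y z)) (m≤m+n _ _)))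

      overlaps : ℕ
      overlaps = ∑ U λ w → ⟦ C w ⟧ * ⟦ B w ⟧ + (⟦ C w ⟧ * ⟦ A w ⟧ + ⟦ B w ⟧ * ⟦ A w ⟧)

      overlaps≤ : overlaps ≤ deviation x y z
      overlaps≤ = ≤-trans (≤-reflexive (trans (∑-+ U _ _) (cong₂ _+_ (∑-cong U λ w → cong (λ e → ⟦ C w ⟧ * ⟦ e ⟧) (h-swap₂ x w z))
         (trans (∑-+ U _ _) (cong₂ _+_ (∑-cong U λ w → cong₂ (λ e f → ⟦ e ⟧ * ⟦ f ⟧) (h-swap₁ x y w) (h-rot w y z))
           (∑-cong U λ w → cong₂ (λ e f → ⟦ e ⟧ * ⟦ f ⟧) (sym (h-rot z x w)) (h-swap₁₃ w y z)))))) ) (m≤n+m _ (asymmetry x y z))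

      private
        bools : ∀ aw bw cw a b e s s' s'' →
          ⟦ not (aw ∨ (bw ∨ cw)) ⟧ * (⟦ a ⟧ * (⟦ b ⟧ * ⟦ not s ⟧)) ≤
          ⟦ not (e ∨ (s ∨ (s' ∨ s''))) ⟧ + (⟦ a ⟧ * (⟦ b ⟧ * (⟦ e ⟧ * ⟦ not cw ⟧))
            + (⟦ b ⟧ * (⟦ a ⟧ * (⟦ s' ⟧ * ⟦ not bw ⟧)) + ⟦ a ⟧ * (⟦ b ⟧ * (⟦ s'' ⟧ * ⟦ not aw ⟧))))
        bools true _ _ _ _ _ _ _ _ = z≤n
        bools false true _ _ _ _ _ _ _ = z≤n
        bools false false true _ _ _ _ _ _ = z≤n
        bools false false false false _ _ _ _ _ = z≤n
        bools false false false true false _ _ _ _ = z≤n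
        bools false false false true true _ true _ _ = z≤n
        bools false false false true true true false _ _ = s≤s z≤n
        bools false false false true true false false true _ = s≤s z≤n
        bools false false false true true false false false true = s≤s z≤n
        bools false false false true true false false false false = s≤s z≤n

        ∨-swap : ∀ a b c → not (a ∨ (b ∨ c)) ≡ not (a ∨ (c ∨ b))
        ∨-swap true _ _ = refl
        ∨-swap false true true = refl
        ∨-swap false true false = refl
        ∨-swap false false true = refl
        ∨-swap false false false = refl

        bools-swap : ∀ aw bw cw a b e s s' s'' →
          ⟦ not (aw ∨ (bw ∨ cw)) ⟧ * (⟦ a ⟧ * (⟦ b ⟧ * ⟦ not s ⟧)) ≤
          ⟦ not (e ∨ (s ∨ (s' ∨ s''))) ⟧ + (⟦ a ⟧ * (⟦ b ⟧ * (⟦ e ⟧ * ⟦ not bw ⟧))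
            + (⟦ b ⟧ * (⟦ a ⟧ * (⟦ s' ⟧ * ⟦ not cw ⟧)) + ⟦ a ⟧ * (⟦ b ⟧ * (⟦ s'' ⟧ * ⟦ not aw ⟧))))
        bools-swap aw bw cw rewrite ∨-swap aw bw cw = bools aw cw bw

        cong-bools : ∀ s {a a' b b' w w'} → a ≡ a' → b ≡ b' → w ≡ w' →
          ⟦ a ⟧ * (⟦ b ⟧ * (⟦ s ⟧ * ⟦ not w ⟧)) ≡ ⟦ a' ⟧ * (⟦ b' ⟧ * (⟦ s ⟧ * ⟦ not w' ⟧))
        cong-bools s refl refl refl = refl

      failB failC : ℕ
      failB = ∑ⁿ U 3 λ w a b → ⟦ W w ⟧ * (⟦ A a ⟧ * (⟦ B b ⟧ * ⟦ not (similar w a b) ⟧))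
      failC = ∑ⁿ U 3 λ w a c → ⟦ W w ⟧ * (⟦ A a ⟧ * (⟦ C c ⟧ * ⟦ not (similar w a c) ⟧))

      -- A covered triple `w`, `a`, `b` is an edge or has a similar pair. As `w` lies in none of the
      -- three sets, an edge is stray, and a similarity at `a` or at `b` is stray as well; all that
      -- remains is the similarity at `w`.
      failB≤ : failB ≤ uncovered + (strayEdges x y z + (straySimilar y x z + straySimilar x y z))
      failB≤ = ≤-trans (∑ⁿ-mono U 3 λ w a b → bools (A w) (B w) (C w) (A a) (B b) (h w a b) (similar w a b) (similar a w b) (similar b w a))
        (≤-reflexive (trans (∑ⁿ-+ U 3 _ _) (cong (uncovered +_) (trans (∑ⁿ-+ U 3 _ _) (cong₂ _+_
          (∑-permute U (0 ∷ 1 ∷ []) 3 λ a b w → ⟦ A a ⟧ * (⟦ B b ⟧ * (⟦ h w a b ⟧ * ⟦ not (C w) ⟧)))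
          (trans (∑ⁿ-+ U 3 _ _) (cong₂ _+_
            (trans (∑-permute U (1 ∷ 0 ∷ 1 ∷ []) 3 λ b a w → ⟦ B b ⟧ * (⟦ A a ⟧ * (⟦ similar a w b ⟧ * ⟦ not (B w) ⟧)))
              (∑ⁿ-cong U 3 λ b a w → cong-bools (similar a w b) (h-swap₁ x b z) (h-swap₁ a y z) (h-swap₁ x w z)))
            (∑-permute U (0 ∷ 1 ∷ []) 3 λ a b w → ⟦ A a ⟧ * (⟦ B b ⟧ * (⟦ similar b w a ⟧ * ⟦ not (A w) ⟧))))))))))

      failC≤ : failC ≤ uncovered + (strayEdges x z y + (straySimilar z x y + straySimilar x z y))
      failC≤ = ≤-trans (∑ⁿ-mono U 3 λ w a c → 
          bools-swap (A w) (B w) (C w) (A a) (C c) (h w a c) (similar w a c) (similar a w c) (similar c w a))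
        (≤-reflexive (trans (∑ⁿ-+ U 3 _ _) (cong (uncovered +_) (trans (∑ⁿ-+ U 3 _ _) (cong₂ _+_
          (trans (∑-permute U (0 ∷ 1 ∷ []) 3 λ a c w → ⟦ A a ⟧ * (⟦ C c ⟧ * (⟦ h w a c ⟧ * ⟦ not (B w) ⟧)))
            (∑ⁿ-cong U 3 λ a c w → cong-bools (h w a c) (h-swap₂ a y z) (h-swap₂ x y c) (h-swap₂ x w z)))
          (trans (∑ⁿ-+ U 3 _ _) (cong₂ _+_
            (trans (∑-permute U (1 ∷ 0 ∷ 1 ∷ []) 3 λ c a w → ⟦ C c ⟧ * (⟦ A a ⟧ * (⟦ similar a w c ⟧ * ⟦ not (C w) ⟧)))
              (∑ⁿ-cong U 3 λ c a w → cong-bools (similar a w c) (sym (h-rot c x y)) (sym (h-rot z a y)) (sym (h-rot w x y))))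
            (trans (∑-permute U (0 ∷ 1 ∷ []) 3 λ a c w → ⟦ A a ⟧ * (⟦ C c ⟧ * (⟦ similar c w a ⟧ * ⟦ not (A w) ⟧)))
              (∑ⁿ-cong U 3 λ a c w → cong-bools (similar c w a) (h-swap₂ a y z) (h-swap₂ x y c) (h-swap₂ w y z))))))))))

      fail≤ : failB + failC ≤ 2 * uncovered + cost x y z
      fail≤ = certify (strayEdges y z x + n * n * deviation x y z) (+-mono-≤ failB≤ failC≤)
        (arith failB failC uncovered (strayEdges x y z) (strayEdges x z y) (strayEdges y z x)
          (straySimilar x y z) (straySimilar y x z) (straySimilar x z y) (straySimilar z x y) (n * n * deviation x y z))
        where
        arith : ∀ f g u e₁ e₂ e₃ s₁ s₂ s₃ s₄ d → f + g + (u + (e₁ + (s₂ + s₁)) + (u + (e₂ + (s₄ + s₃)))) + (e₃ + d) ≡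
          2 * u + (e₁ + (e₂ + e₃) + (s₁ + (s₂ + (s₃ + s₄)) + d)) + (f + g)
        arith = solve-∀

      ∑ζ : ω * (α * ζ) ≡ ∑ⁿ U 3 λ w a u → ⟦ W w ⟧ * (⟦ A a ⟧ * ⟦ B u ∨ C u ⟧)
      ∑ζ = sym (trans (∑-cong U λ w → trans (∑-cong U λ a → trans (∑-*ˡ U ⟦ W w ⟧ _) (cong (⟦ W w ⟧ *_) (∑-*ˡ U ⟦ A a ⟧ _)))
          (trans (∑-*ˡ U ⟦ W w ⟧ _) (cong (⟦ W w ⟧ *_) (∑-*ʳ U ζ _)))) (∑-*ʳ U (α * ζ) _))

      -- For `w` in W and `a` in A, the set B ∪ C apart from the failures is counted by `sdeg w a`,
      -- which exceeds n/3 only through the surplus or a heavy codegree.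
      ωαζ≤ : 3 * (ω * (α * ζ)) ≤ ω * (α * n) + heavy + 3 * surplus + 3 * (failB + failC)
      ωαζ≤ = begin
        3 * (ω * (α * ζ)) ≡⟨ cong (3 *_) ∑ζ ⟩
        3 * ∑ⁿ U 3 (λ w a u → ⟦ W w ⟧ * (⟦ A a ⟧ * ⟦ B u ∨ C u ⟧))
          ≤⟨ *-monoʳ-≤ 3 (∑ⁿ-mono U 3 λ w a u → cover (W w) (A a) (B u) (C u) (similar w a u)) ⟩
        3 * ∑ⁿ U 3 (λ w a u → ⟦ W w ⟧ * (⟦ A a ⟧ * ⟦ similar w a u ⟧) +
          (⟦ W w ⟧ * (⟦ A a ⟧ * (⟦ B u ⟧ * ⟦ not (similar w a u) ⟧)) + ⟦ W w ⟧ * (⟦ A a ⟧ * (⟦ C u ⟧ * ⟦ not (similar w a u) ⟧))))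
          ≡⟨ cong (3 *_) (trans (∑ⁿ-+ U 3 _ _) (cong₂ _+_ (∑ⁿ-cong U 2 λ w a → trans (∑-*ˡ U ⟦ W w ⟧ _) (cong (⟦ W w ⟧ *_) (∑-*ˡ U ⟦ A a ⟧ _))) (∑ⁿ-+ U 3 _ _))) ⟩
        3 * (∑ⁿ U 2 (λ w a → ⟦ W w ⟧ * (⟦ A a ⟧ * sdeg w a)) + (failB + failC))
          ≡⟨ trans (*-distribˡ-+ 3 (∑ⁿ U 2 weighted) (failB + failC)) (cong (_+ 3 * (failB + failC)) (sym (∑ⁿ-*ˡ U 2 3 weighted))) ⟩
        ∑ⁿ U 2 (λ w a → 3 * (⟦ W w ⟧ * (⟦ A a ⟧ * sdeg w a))) + 3 * (failB + failC)
          ≤⟨ +-monoˡ-≤ (3 * (failB + failC)) (∑ⁿ-mono U 2 λ w a → pointwise (W w) (A a) (deg w a) (sdeg w a)) ⟩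
        ∑ⁿ U 2 (λ w a → ⟦ W w ⟧ * (⟦ A a ⟧ * n) + (3 * deg w a ∸ n) + 3 * (sdeg w a ∸ deg w a)) + 3 * (failB + failC)
          ≡⟨ cong (_+ 3 * (failB + failC)) (trans (∑ⁿ-+ U 2 _ _) (cong₂ _+_ (trans (∑ⁿ-+ U 2 _ _) (cong (_+ heavy)
               (trans (∑-cong U λ w → trans (∑-*ˡ U ⟦ W w ⟧ _) (cong (⟦ W w ⟧ *_) (∑-*ʳ U n _))) (∑-*ʳ U (α * n) _)))) (∑ⁿ-*ˡ U 2 3 _))) ⟩
        ω * (α * n) + heavy + 3 * surplus + 3 * (failB + failC) ∎
        where
        weighted : X → X → ℕ
        weighted w a = ⟦ W w ⟧ * (⟦ A a ⟧ * sdeg w a)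
        cover : ∀ w a b c s → ⟦ w ⟧ * (⟦ a ⟧ * ⟦ b ∨ c ⟧) ≤ ⟦ w ⟧ * (⟦ a ⟧ * ⟦ s ⟧) + (⟦ w ⟧ * (⟦ a ⟧ * (⟦ b ⟧ * ⟦ not s ⟧)) + ⟦ w ⟧ * (⟦ a ⟧ * (⟦ c ⟧ * ⟦ not s ⟧)))
        cover false _ _ _ _ = z≤n
        cover true false _ _ _ = z≤n
        cover true true true _ true = s≤s z≤n
        cover true true true _ false = s≤s z≤n
        cover true true false true true = s≤s z≤n
        cover true true false true false = s≤s z≤n
        cover true true false false _ = z≤n
        pointwise : ∀ w a d P → 3 * (⟦ w ⟧ * (⟦ a ⟧ * P)) ≤ ⟦ w ⟧ * (⟦ a ⟧ * n) + (3 * d ∸ n) + 3 * (P ∸ d)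
        pointwise false _ _ _ = z≤n
        pointwise true false _ _ = z≤n
        pointwise true true d P = certify 0 (+-mono-≤ (*-monoʳ-≤ 3 (m≤n+m∸n P d)) (m≤n+m∸n (3 * d) n))
            (arith d P (P ∸ d) n (3 * d ∸ n))
          where
          arith : ∀ d P e n f → 3 * (1 * (1 * P)) + (3 * (d + e) + (n + f)) + 0 ≡ 1 * (1 * n) + f + 3 * e + (3 * P + 3 * d)
          arith = solve-∀

      ζ-lower : β + γ ≤ ζ + overlaps
      ζ-lower = subst₂ _≤_ (∑-+ U _ _) (∑-+ U _ _) (∑-mono U λ u → bools' (A u) (B u) (C u))
        where
        bools' : ∀ a b c → ⟦ b ⟧ + ⟦ c ⟧ ≤ ⟦ b ∨ c ⟧ + (⟦ c ⟧ * ⟦ b ⟧ + (⟦ c ⟧ * ⟦ a ⟧ + ⟦ b ⟧ * ⟦ a ⟧))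
        bools' _ true true = s≤s (s≤s z≤n)
        bools' _ true false = s≤s z≤n
        bools' _ false true = s≤s z≤n
        bools' _ false false = z≤n

  -- Three classes and the edges that respect them

  data Class : Set where
    c₁ c₂ c₃ : Class

  _≡ᶜ_ : Class → Class → Bool
  c₁ ≡ᶜ c₁ = true
  c₂ ≡ᶜ c₂ = true
  c₃ ≡ᶜ c₃ = true
  _ ≡ᶜ _ = false

  -- Whether a triple with vertices in the given classes is crossing or inside one class.
  good : Class → Class → Class → Bool
  good i j k = if i ≡ᶜ j then j ≡ᶜ k else not ((i ≡ᶜ k) ∨ (j ≡ᶜ k))

  -- Overlaps go to the earlier class and vertices outside all three sets to `c₃`; `misplaced` pays
  -- for both.
  classify : Bool → Bool → Class
  classify true _ = c₁
  classify false true = c₂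
  classify false false = c₃

  overlapsAt : Bool → Bool → Bool → ℕ
  overlapsAt a b c = ⟦ c ⟧ * ⟦ b ⟧ + (⟦ c ⟧ * ⟦ a ⟧ + ⟦ b ⟧ * ⟦ a ⟧)

  strayAt : Bool → (a b c a' b' c' a'' b'' c'' : Bool) → ℕ
  strayAt e a b c a' b' c' a'' b'' c'' = ⟦ a ⟧ * (⟦ b' ⟧ * (⟦ e ⟧ * ⟦ not c'' ⟧)) +
    (⟦ a ⟧ * (⟦ c' ⟧ * (⟦ e ⟧ * ⟦ not b'' ⟧)) + ⟦ b ⟧ * (⟦ c' ⟧ * (⟦ e ⟧ * ⟦ not a'' ⟧)))

  misplaced : Bool → Bool → Bool → ℕ
  misplaced a b c = ⟦ not (a ∨ (b ∨ c)) ⟧ + overlapsAt a b c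

  -- A bad edge has exactly two vertices in one class. Its first vertex therefore differs in class
  -- from the second or from the third, and the vertex left over is not in the remaining class.
  -- Unless some vertex is misplaced, the edge is stray in one of these four orders.
  bad-triple : ∀ e {e₁ e₂ e₃ e₄} → e₁ ≡ e → e₂ ≡ e → e₃ ≡ e → e₄ ≡ e → ∀ a b c a' b' c' a'' b'' c'' →
    ⟦ e ⟧ * ⟦ not (good (classify a b) (classify a' b') (classify a'' b'')) ⟧ ≤
    (strayAt e₁ a b c a' b' c' a'' b'' c'' + strayAt e₂ a' b' c' a b c a'' b'' c'') +
    (strayAt e₃ a b c a'' b'' c'' a' b' c' + strayAt e₄ a'' b'' c'' a b c a' b' c') +
    (misplaced a b c + (misplaced a' b' c' + misplaced a'' b'' c''))
  bad-triple e refl refl refl refl a b c a' b' c' a'' b'' c'' = ≤ᵇ⇒≤ _ _ (tautology-sound 10 (λ e a b c a' b' c' a'' b'' c'' →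
    ⟦ e ⟧ * ⟦ not (good (classify a b) (classify a' b') (classify a'' b'')) ⟧ ≤ᵇ
    (strayAt e a b c a' b' c' a'' b'' c'' + strayAt e a' b' c' a b c a'' b'' c'') +
    (strayAt e a b c a'' b'' c'' a' b' c' + strayAt e a'' b'' c'' a b c a' b' c') +
    (misplaced a b c + (misplaced a' b' c' + misplaced a'' b'' c''))) tt e a b c a' b' c' a'' b'' c'')

  class₂-cover : ∀ a b c → ⟦ b ⟧ ≤ ⟦ classify a b ≡ᶜ c₂ ⟧ + overlapsAt a b c
  class₂-cover a b c = ≤ᵇ⇒≤ _ _ (tautology-sound 3 (λ a b c → ⟦ b ⟧ ≤ᵇ ⟦ classify a b ≡ᶜ c₂ ⟧ + overlapsAt a b c) tt a b c)

  class₃-cover : ∀ a b c → ⟦ c ⟧ ≤ ⟦ classify a b ≡ᶜ c₃ ⟧ + overlapsAt a b c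
  class₃-cover a b c = ≤ᵇ⇒≤ _ _ (tautology-sound 3 (λ a b c → ⟦ c ⟧ ≤ᵇ ⟦ classify a b ≡ᶜ c₃ ⟧ + overlapsAt a b c) tt a b c)

  class₁-cover : ∀ a b → ⟦ a ⟧ ≤ ⟦ classify a b ≡ᶜ c₁ ⟧
  class₁-cover true _ = ≤-refl
  class₁-cover false _ = z≤n

  -- The partition given by a typical edge

  module Cutting {X : Set} (h : X → X → X → Bool)
    (h-swap₁ : ∀ x y z → h x y z ≡ h y x z) (h-swap₂ : ∀ x y z → h x y z ≡ h x z y)
    (C₅⁻-free : ∀ {a b c d e} → T (h a b c) → T (h b c d) → T (h c d e) → T (h d e a) → b ≡ e)
    (U : List X) (unique : Unique U) (m t k : ℕ) (2≤m : 2 ≤ m) (0<t : 0 < t)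
    (m²t≤n : m * m * t ≤ length U) (m²k≤t : m * m * k ≤ t) (m²≤k : m * m ≤ k) where

    open Sums {X}
    open ≤-Reasoning
    open Hypergraph h h-swap₁ h-swap₂ C₅⁻-free
    open Costs h h-swap₁ h-swap₂ C₅⁻-free U unique m t k 2≤m 0<t m²t≤n m²k≤t m²≤k
    open Partition h h-swap₁ h-swap₂ C₅⁻-free U unique m t k 2≤m 0<t m²t≤n m²k≤t m²≤k
    open L using (deg)

    module Bounds (x y z : X) (K : ℕ) (0<K : 0 < K) (100K≤m : 100 * K ≤ m)
      (10≤q : 10 ≤ q) (dense : q * n³ ≤ 4 * (q * edges) + n³)
      (n≤5deg : n ≤ 5 * deg x y) (m*cost≤ : m * cost x y z ≤ K * n³) where

      open Selection 10≤q dense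
      open Parts x y z

      private
        1≤n : 1 ≤ n
        1≤n = ≤-trans (≤-trans (s≤s z≤n) 2≤m) m≤n
        instance
          n≢0 : NonZero n
          n≢0 = >-nonZero 1≤n
          nn≢0 : NonZero (n * n)
          nn≢0 = m*n≢0 n n
          K≢0 : NonZero K
          K≢0 = >-nonZero 0<K

        dev : ℕ
        dev = deviation x y z

      m*heavy≤ : m * heavy ≤ 69 * n³
      m*heavy≤ = *-cancelˡ-≤ n (certify 0 (+-mono-≤ (*-monoʳ-≤ m n*heavy≤) (*-monoʳ-≤ 3 m*∑E-deviation≤))
          (arith n m heavy (∑E deviation) n³))
        where
        arith : ∀ n m V D N → n * (m * V) + (m * (3 * D) + 3 * (23 * (n * N))) + 0 ≡ n * (69 * N) + (m * (n * V) + 3 * (m * D))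
        arith = solve-∀

      m*dev≤ : m * dev ≤ K * n
      m*dev≤ = *-cancelˡ-≤ (n * n) (≤-trans (≤-reflexive (move (n * n) m dev)) (≤-trans (*-monoʳ-≤ m (≤-trans (m≤n+m _ (similars x y z)) (m≤n+m _ (strays x y z))))
          (≤-trans m*cost≤ (≤-reflexive (arith K n)))))
        where
        move : ∀ a m d → a * (m * d) ≡ m * (a * d)
        move = solve-∀
        arith : ∀ K n → K * (n * (n * n)) ≡ n * n * (K * n)
        arith = solve-∀

      100dev≤n : 100 * dev ≤ n
      100dev≤n = *-cancelˡ-≤ K (≤-trans (≤-reflexive (move K dev)) (≤-trans (*-monoˡ-≤ dev 100K≤m) m*dev≤))
        where
        move : ∀ K d → K * (100 * d) ≡ 100 * K * d
        move = solve-∀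

      n≤10α : n ≤ 10 * α
      n≤10α = *-cancelˡ-≤ 10 (certify (9 * n) (+-mono-≤ (*-monoʳ-≤ 20 n≤5deg) (+-mono-≤ (*-monoʳ-≤ 100 γ≤α) 100dev≤n)) (arith n α γ dev))
        where
        arith : ∀ n a c d → 10 * n + (20 * (5 * c) + (100 * (a + d) + n)) + 9 * n ≡ 10 * (10 * a) + (20 * n + (100 * c + 100 * d))
        arith = solve-∀

      19n≤100β : 19 * n ≤ 100 * β
      19n≤100β = certify 0 (+-mono-≤ (*-monoʳ-≤ 20 n≤5deg) (+-mono-≤ (*-monoʳ-≤ 100 γ≤β) 100dev≤n)) (arith n β γ dev)
        where
        arith : ∀ n a c d → 19 * n + (20 * (5 * c) + (100 * (a + d) + n)) + 0 ≡ (100 * a) + (20 * n + (100 * c + 100 * d))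
        arith = solve-∀

      100overlaps≤n : 100 * overlaps ≤ n
      100overlaps≤n = ≤-trans (*-monoʳ-≤ 100 overlaps≤) 100dev≤n

      -- B and C have at least 19/100 and 20/100 of the vertices and overlap in at most 1/100. The
      -- resulting 38/100 exceeds 11/30, which is above 1/3 by a fixed margin.
      11n≤30ζ : 11 * n ≤ 30 * ζ
      11n≤30ζ = *-cancelˡ-≤ 10 (certify (4 * n) (+-mono-≤ (+-mono-≤ (*-monoʳ-≤ 3 19n≤100β) (*-monoʳ-≤ 60 n≤5deg)) (+-mono-≤ (*-monoʳ-≤ 300 ζ-lower) (*-monoʳ-≤ 3 100overlaps≤n)))
          (arith n β γ ζ overlaps))
        where
        arith : ∀ n b c z o → 10 * (11 * n) + (3 * (100 * b) + 60 * (5 * c) + (300 * (z + o) + 3 * n)) + 4 * n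
          ≡ 10 * (30 * z) + (3 * (19 * n) + 60 * n + (300 * (b + c) + 3 * (100 * o)))
        arith = solve-∀

      rest : ℕ
      rest = heavy + 3 * surplus + 3 * (failB + failC)

      -- The 156 is `69 + 3 * 9 + 6 * 10`, from heavy codegrees, surplus and uncovered triples;
      -- `3 * K` comes from the cost.
      m*rest≤ : m * rest ≤ (156 + 3 * K) * n³
      m*rest≤ = certify 0 (+-mono-≤ (+-mono-≤ m*heavy≤ (*-monoʳ-≤ 3 m*surplus≤)) (+-mono-≤ (*-monoʳ-≤ (3 * m) fail≤) (+-mono-≤ (*-monoʳ-≤ 6 m*uncovered≤) (*-monoʳ-≤ 3 m*cost≤))))
          (arith m heavy surplus (failB + failC) uncovered (cost x y z) K n³)
        where
        arith : ∀ m V S F u c K N → m * (V + 3 * S + 3 * F) + (69 * N + 3 * (9 * N) + (3 * m * (2 * u + c) + (6 * (10 * N) + 3 * (K * N)))) + 0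
          ≡ (156 + 3 * K) * N + (m * V + 3 * (m * S) + (3 * m * F + (6 * (m * u) + 3 * (m * c))))
        arith = solve-∀

      -- The two main terms of `ωαζ≤` differ by the margin of `ζ` over a third of `n`, and a tenth
      -- of `ω * (α * n)` survives on the left.
      ωαn≤ : ω * (α * n) ≤ 10 * rest
      ωαn≤ = certify 0 (+-mono-≤ (*-monoʳ-≤ 10 ωαζ≤) (*-monoʳ-≤ (ω * α) 11n≤30ζ)) (arith ω α n ζ heavy surplus (failB + failC))
        where
        arith : ∀ w a n z V S F → w * (a * n) + (10 * (w * (a * n) + V + 3 * S + 3 * F) + w * a * (30 * z)) + 0
          ≡ 10 * (V + 3 * S + 3 * F) + (10 * (3 * (w * (a * z))) + w * a * (11 * n))
        arith = solve-∀

      m*ω≤ : m * ω ≤ 100 * (156 + 3 * K) * n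
      m*ω≤ = *-cancelˡ-≤ (n * n) (certify 0 (+-mono-≤ (*-monoʳ-≤ (m * ω * n) n≤10α) (+-mono-≤ (*-monoʳ-≤ (10 * m) ωαn≤) (*-monoʳ-≤ 100 m*rest≤)))
          (arith n m ω α rest K))
        where
        arith : ∀ n m w a r K → n * n * (m * w) + (m * w * n * (10 * a) + (10 * m * (10 * r) + 100 * ((156 + 3 * K) * (n * (n * n))))) + 0
          ≡ n * n * (100 * (156 + 3 * K) * n) + (m * w * n * n + (10 * m * (w * (a * n)) + 100 * (m * r)))
        arith = solve-∀

      class : X → Class
      class u = classify (A u) (B u)

      size : Class → ℕ
      size i = ∑ U λ u → ⟦ class u ≡ᶜ i ⟧

      bad : ℕ
      bad = ∑ⁿ U 3 λ p q r → ⟦ h p q r ⟧ * ⟦ not (good (class p) (class q) (class r)) ⟧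

      private
        stray : X → X → X → ℕ
        stray p q r = strayAt (h r p q) (A p) (B p) (C p) (A q) (B q) (C q) (A r) (B r) (C r)

        misplacedAt : X → ℕ
        misplacedAt u = misplaced (A u) (B u) (C u)

        ∑stray : ∑ⁿ U 3 stray ≡ strays x y z
        ∑stray = trans (∑ⁿ-+ U 3 _ _) (cong (strayEdges x y z +_) (trans (∑ⁿ-+ U 3 _ _) (cong₂ _+_
          (∑ⁿ-cong U 3 λ p q r → cong-stray (h r p q) (h-swap₂ p y z) (h-swap₂ x y q) (h-swap₂ x r z))
          (∑ⁿ-cong U 3 λ p q r → cong-stray (h r p q) (trans (h-swap₁ x p z) (h-swap₂ p x z)) (trans (h-swap₁ x y q) (h-swap₂ y x q)) (h-rot r y z)))))
          where
          cong-stray : ∀ e {a a' b b' c c'} → a ≡ a' → b ≡ b' → c ≡ c' →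
            ⟦ a ⟧ * (⟦ b ⟧ * (⟦ e ⟧ * ⟦ not c ⟧)) ≡ ⟦ a' ⟧ * (⟦ b' ⟧ * (⟦ e ⟧ * ⟦ not c' ⟧))
          cong-stray e refl refl refl = refl

        ∑misplaced : ∑ U misplacedAt ≡ ω + overlaps
        ∑misplaced = ∑-+ U _ _

      bad≤ : bad ≤ 4 * strays x y z + 3 * (n * n * (ω + overlaps))
      bad≤ = ≤-trans (∑ⁿ-mono U 3 λ p q r → bad-triple (h p q r) (h-rot r p q) (h-swap₁₃ r q p) (h-swap₁ q p r) (sym (h-rot p q r))
            (A p) (B p) (C p) (A q) (B q) (C q) (A r) (B r) (C r)) (≤-reflexive (trans (∑ⁿ-+ U 3 _ _) (trans (cong₂ _+_
          (trans (∑ⁿ-+ U 3 _ _) (cong₂ _+_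
            (trans (∑ⁿ-+ U 3 _ _) (cong₂ _+_ ∑stray (trans (∑-permute U (0 ∷ []) 3 stray) ∑stray)))
            (trans (∑ⁿ-+ U 3 _ _) (cong₂ _+_ (trans (∑-permute U (1 ∷ []) 3 stray) ∑stray) (trans (∑-permute U (1 ∷ 0 ∷ []) 3 stray) ∑stray)))))
          (trans (∑ⁿ-+ U 3 _ _) (cong₂ _+_
            (trans (∑-permute U (0 ∷ 1 ∷ []) 3 λ q r p → misplacedAt p) outer)
            (trans (∑ⁿ-+ U 3 _ _) (cong₂ _+_
              (trans (∑-permute U (1 ∷ []) 3 λ p r q → misplacedAt q) outer) outer)))))
          (collect (strays x y z) (n * n * (ω + overlaps))))))
        where
        outer : ∑ⁿ U 3 (λ p q r → misplacedAt r) ≡ n * n * (ω + overlaps)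
        outer = trans (∑-cong U λ _ → ∑-const U _) (trans (∑-const U _) (trans (sym (*-assoc n n _)) (cong (n * n *_) ∑misplaced)))
        collect : ∀ s d → s + s + (s + s) + (d + (d + d)) ≡ 4 * s + 3 * d
        collect = solve-∀

      m*bad≤ : m * bad ≤ (4 * K + 300 * (156 + 3 * K)) * n³
      -- Four copies of the cost pay for the strays and, through the deviation they contain, for the
      -- three overlap terms too.
      m*bad≤ = certify (m * (4 * similars x y z + n * n * dev)) (+-mono-≤ (+-mono-≤ (*-monoʳ-≤ m bad≤) (*-monoʳ-≤ 4 m*cost≤))
            (+-mono-≤ (*-monoʳ-≤ (3 * (n * n)) m*ω≤) (*-monoʳ-≤ (3 * m * (n * n)) overlaps≤)))
          (arith m n bad (strays x y z) (similars x y z) dev overlaps ω K)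
        where
        arith : ∀ m n b s t d o w K →
          m * b + (m * (4 * s + 3 * (n * n * (w + o))) + 4 * (K * (n * (n * n))) + (3 * (n * n) * (100 * (156 + 3 * K) * n) + 3 * m * (n * n) * d)) + m * (4 * t + n * n * d)
          ≡ (4 * K + 300 * (156 + 3 * K)) * (n * (n * n)) + (m * b + 4 * (m * (s + (t + n * n * d))) + (3 * (n * n) * (m * w) + 3 * m * (n * n) * o))
        arith = solve-∀

      size-lower : ∀ i → n ≤ 10 * size i
      size-lower c₁ = ≤-trans n≤10α (*-monoʳ-≤ 10 (∑-mono U λ u → class₁-cover (A u) (B u)))
      size-lower c₂ = *-cancelˡ-≤ 10 (certify (8 * n) (+-mono-≤ 19n≤100β (+-mono-≤ (*-monoʳ-≤ 100 cover) 100overlaps≤n)) (arith n β (size c₂) overlaps))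
        where
        cover : β ≤ size c₂ + overlaps
        cover = ≤-trans (∑-mono U λ u → class₂-cover (A u) (B u) (C u)) (≤-reflexive (∑-+ U _ _))
        arith : ∀ n b s o → 10 * n + (100 * b + (100 * (s + o) + n)) + 8 * n ≡ 10 * (10 * s) + (19 * n + (100 * b + 100 * o))
        arith = solve-∀
      size-lower c₃ = *-cancelˡ-≤ 10 (certify (9 * n) (+-mono-≤ (*-monoʳ-≤ 20 n≤5deg) (+-mono-≤ (*-monoʳ-≤ 100 cover) 100overlaps≤n)) (arith n γ (size c₃) overlaps))
        where
        cover : γ ≤ size c₃ + overlaps
        cover = ≤-trans (∑-mono U λ u → class₃-cover (A u) (B u) (C u)) (≤-reflexive (∑-+ U _ _))
        arith : ∀ n b s o → 10 * n + (20 * (5 * b) + (100 * (s + o) + n)) + 9 * n ≡ 10 * (10 * s) + (20 * n + (100 * b + 100 * o))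
        arith = solve-∀

  -- Density and cut for an arbitrary set of vertices

  abstract
    -- The factor in `m*bad≤` at `K = 10000`, the cost bound of the selected edge.
    cutConstant : ℕ
    cutConstant = 4 * 10000 + 300 * (156 + 3 * 10000)

  module Structure {X : Set} (h : X → X → X → Bool)
    (h-swap₁ : ∀ x y z → h x y z ≡ h y x z) (h-swap₂ : ∀ x y z → h x y z ≡ h x z y)
    (C₅⁻-free : ∀ {a b c d e} → T (h a b c) → T (h b c d) → T (h c d e) → T (h d e a) → b ≡ e) where

    open Sums {X}

    edges : List X → ℕ
    edges U = ∑ⁿ U 3 λ x y z → ⟦ h x y z ⟧

    classSize : List X → (X → Class) → Class → ℕ
    classSize U f i = ∑ U λ u → ⟦ f u ≡ᶜ i ⟧

    badEdges : List X → (X → Class) → ℕ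
    badEdges U f = ∑ⁿ U 3 λ p q r → ⟦ h p q r ⟧ * ⟦ not (good (f p) (f q) (f r)) ⟧

    module Parameters (m : ℕ) (2≤m : 2 ≤ m) (U : List X) (q³≤n : cube (m * m) ≤ length U) where

      q n t k : ℕ
      q = m * m
      n = length U

      private
        1≤q : 1 ≤ q
        1≤q = *-mono-≤ (≤-trans (s≤s z≤n) 2≤m) (≤-trans (s≤s z≤n) 2≤m)
        instance
          q≢0 : NonZero q
          q≢0 = >-nonZero 1≤q

      -- The scales are successive quotients by `q`; after two divisions `cube q ≤ n` still leaves
      -- `q ≤ k`.
      t = n / q
      k = t / q

      qt≤n : q * t ≤ n
      qt≤n = subst (_≤ n) (*-comm t q) (m/n*n≤m n q)

      qk≤t : q * k ≤ t
      qk≤t = subst (_≤ t) (*-comm k q) (m/n*n≤m t q)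

      qq≤t : q * q ≤ t
      qq≤t = subst (_≤ t) (trans (cong (_/ q) (*-comm q (q * q))) (m*n/n≡m (q * q) q)) (/-mono-≤ q³≤n (≤-refl {q}))

      q≤k : q ≤ k
      q≤k = subst (_≤ k) (m*n/n≡m q q) (/-mono-≤ qq≤t (≤-refl {q}))

      0<t : 0 < t
      0<t = ≤-trans (*-mono-≤ 1≤q 1≤q) qq≤t

    density : ∀ m → 2 ≤ m → ∀ U → Unique U → cube (m * m) ≤ length U →
      4 * (m * m * edges U) ≤ m * m * cube (length U) + 9 * cube (length U)
    density m 2≤m U unique q³≤n = Estimates.density h h-swap₁ h-swap₂ C₅⁻-free U unique m t k 2≤m 0<t qt≤n qk≤t q≤k
      where open Parameters m 2≤m U q³≤n

    Dense : ℕ → List X → Set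
    Dense q U = q * cube (length U) ≤ 4 * (q * edges U) + cube (length U)

    Cut : ℕ → ℕ → List X → Set
    Cut K m U = ∃ λ f → (∀ i → length U ≤ 10 * classSize U f i) × m * badEdges U f ≤ K * cube (length U)

    abstract
      cut : ∀ m → 2 ≤ m → cutConstant ≤ m → ∀ U → Unique U → cube (m * m) ≤ length U → Dense (m * m) U → Cut cutConstant m U
      cut = λ m 2≤m K≤m U unique q³≤n dense → from-selected m 2≤m U unique q³≤n 10000 (s≤s z≤n)
          (≤-trans (≤ᵇ⇒≤ _ _ tt) K≤m) dense
          (≤-trans (≤-trans (≤ᵇ⇒≤ 10 (4 * 10000 + 300 * (156 + 3 * 10000)) tt) K≤m) (m≤m² m 2≤m))
          (Costs.Selection.selected h h-swap₁ h-swap₂ C₅⁻-free U unique m (Parameters.t m 2≤m U q³≤n) (Parameters.k m 2≤m U q³≤n) 2≤m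
            (Parameters.0<t m 2≤m U q³≤n) (Parameters.qt≤n m 2≤m U q³≤n) (Parameters.qk≤t m 2≤m U q³≤n) (Parameters.q≤k m 2≤m U q³≤n)
            (≤-trans (≤-trans (≤ᵇ⇒≤ 10 (4 * 10000 + 300 * (156 + 3 * 10000)) tt) K≤m) (m≤m² m 2≤m)) dense)
        where
        m≤m² : ∀ m → 2 ≤ m → m ≤ m * m
        m≤m² m 2≤m = subst (_≤ m * m) (*-identityʳ m) (*-monoʳ-≤ m (≤-trans (s≤s z≤n) 2≤m))
        from-selected : ∀ m (2≤m : 2 ≤ m) U (unique : Unique U) (q³≤n : cube (m * m) ≤ length U) K → 0 < K → 100 * K ≤ m →
          Dense (m * m) U → 10 ≤ m * m →
          let open Parameters m 2≤m U q³≤n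
              open Costs h h-swap₁ h-swap₂ C₅⁻-free U unique m t k 2≤m 0<t qt≤n qk≤t q≤k using (cost; module L) in
          (∃ λ x → ∃ λ y → ∃ λ z → T (h x y z) × n ≤ 5 * L.deg x y × m * cost x y z ≤ K * cube n) →
          Cut (4 * K + 300 * (156 + 3 * K)) m U
        from-selected m 2≤m U unique q³≤n K 0<K 100K≤m dense 10≤q (x , y , z , _ , n≤5deg , cost≤) = class , size-lower , m*bad≤
          where
          open Parameters m 2≤m U q³≤n
          open Cutting h h-swap₁ h-swap₂ C₅⁻-free U unique m t k 2≤m 0<t qt≤n qk≤t q≤k
          open Bounds x y z K 0<K 100K≤m 10≤q dense n≤5deg cost≤

  -- Subsets as lists of vertices, and 3-sets as triples

  open Sums

  elements : ∀ {N} → Subset N → List (Fin N)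
  elements S = filterᵇ (lookup S) (allFin _)

  ∑-filter : ∀ {X : Set} (p : X → Bool) U (f : X → ℕ) → ∑ (filterᵇ p U) f ≡ ∑ U (λ u → ⟦ p u ⟧ * f u)
  ∑-filter p [] f = refl
  ∑-filter p (x ∷ U) f with p x
  ... | true = cong₂ _+_ (sym (+-identityʳ (f x))) (∑-filter p U f)
  ... | false = ∑-filter p U f

  ∈⇒T : ∀ {N} {S : Subset N} {x} → x ∈ S → T (lookup S x)
  ∈⇒T x∈S = subst T (sym ([]=⇒lookup x∈S)) tt

  T⇒≡ : ∀ {b} → T b → b ≡ true
  T⇒≡ {true} _ = refl

  ¬T⇒≡ : ∀ {b} → ¬ T b → b ≡ false
  ¬T⇒≡ {true} ¬t = ⊥-elim (¬t tt)
  ¬T⇒≡ {false} _ = refl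

  T⇒∈ : ∀ {N} {S : Subset N} {x} → T (lookup S x) → x ∈ S
  T⇒∈ {S = S} {x} t = lookup⇒[]= x S (T⇒≡ t)

  ∑-elements-mono : ∀ {N} (S : Subset N) {f g : Fin N → ℕ} → (∀ x → x ∈ S → f x ≤ g x) → ∑ (elements S) f ≤ ∑ (elements S) g
  ∑-elements-mono {N} S {f} {g} p = subst₂ _≤_ (sym (∑-filter (lookup S) (allFin N) f)) (sym (∑-filter (lookup S) (allFin N) g)) (∑-mono (allFin N) (λ x → at x (lookup S x) refl))
    where
    at : ∀ x b → lookup S x ≡ b → ⟦ b ⟧ * f x ≤ ⟦ b ⟧ * g x
    at x true eq = *-monoʳ-≤ 1 (p x (lookup⇒[]= x S eq))
    at x false eq = z≤n

  ∑-tabulate : ∀ {A : Set} {n} (g : Fin n → A) (f : A → ℕ) → ∑ (Data.List.tabulate g) f ≡ ∑ (allFin n) (f ∘ g)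
  ∑-tabulate g f = cong sum (trans (map-tabulate g f) (sym (map-tabulate id (f ∘ g))))

  ∑-allFin : ∀ {n} (f : Fin (suc n) → ℕ) → ∑ (allFin (suc n)) f ≡ f zero + ∑ (allFin n) (f ∘ suc)
  ∑-allFin f = cong (f zero +_) (∑-tabulate suc f)

  ∣∣≡∑ : ∀ {N} (S : Subset N) → ∣ S ∣ ≡ ∑ (allFin N) (λ u → ⟦ lookup S u ⟧)
  ∣∣≡∑ []ᵛ = refl
  ∣∣≡∑ (true ∷ᵛ S) = trans (cong suc (∣∣≡∑ S)) (sym (∑-allFin (λ u → ⟦ lookup (true ∷ᵛ S) u ⟧)))
  ∣∣≡∑ (false ∷ᵛ S) = trans (∣∣≡∑ S) (sym (∑-allFin (λ u → ⟦ lookup (false ∷ᵛ S) u ⟧)))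

  length-elements : ∀ {N} (S : Subset N) → length (elements S) ≡ ∣ S ∣
  length-elements {N} S = begin-equality
    length (elements S)                      ≡⟨ sym (trans (∑-const (elements S) 1) (*-identityʳ _)) ⟩
    ∑ (elements S) (λ _ → 1)                 ≡⟨ ∑-filter (lookup S) (allFin N) _ ⟩
    ∑ (allFin N) (λ u → ⟦ lookup S u ⟧ * 1)  ≡⟨ ∑-cong (allFin N) (λ u → *-identityʳ _) ⟩
    ∑ (allFin N) (λ u → ⟦ lookup S u ⟧)      ≡⟨ sym (∣∣≡∑ S) ⟩
    ∣ S ∣                                    ∎
    where open ≤-Reasoning

  unique-elements : ∀ {N} (S : Subset N) → Unique (elements S)
  unique-elements S = filter⁺ (T? ∘ lookup S) (allFin⁺ _)

  ∈-triple : ∀ {N} {a b c x : Fin N} → x ∈ triple a b c → x ≡ a ⊎ (x ≡ b ⊎ x ≡ c)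
  ∈-triple {a = a} {b} {c} p with x∈p∪q⁻ ⁅ a ⁆ _ p
  ... | inj₁ x∈a = inj₁ (x∈⁅y⁆⇒x≡y a x∈a)
  ... | inj₂ q with x∈p∪q⁻ ⁅ b ⁆ ⁅ c ⁆ q
  ...   | inj₁ x∈b = inj₂ (inj₁ (x∈⁅y⁆⇒x≡y b x∈b))
  ...   | inj₂ x∈c = inj₂ (inj₂ (x∈⁅y⁆⇒x≡y c x∈c))

  ∈-triple₁ : ∀ {N} (a b c : Fin N) → a ∈ triple a b c
  ∈-triple₁ a b c = x∈p∪q⁺ (inj₁ (x∈⁅x⁆ a))

  triple-swap₂ : ∀ {N} (a b c : Fin N) → triple a b c ≡ triple a c b
  triple-swap₂ a b c = cong (⁅ a ⁆ ∪_) (∪-comm ⁅ b ⁆ ⁅ c ⁆)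

  triple-swap₁ : ∀ {N} (a b c : Fin N) → triple a b c ≡ triple b a c
  triple-swap₁ a b c = trans (sym (∪-assoc ⁅ a ⁆ ⁅ b ⁆ ⁅ c ⁆)) (trans (cong (_∪ ⁅ c ⁆) (∪-comm ⁅ a ⁆ ⁅ b ⁆)) (∪-assoc ⁅ b ⁆ ⁅ a ⁆ ⁅ c ⁆))

  triple⊆ : ∀ {N} {a b c : Fin N} {S} → a ∈ S → b ∈ S → c ∈ S → triple a b c ⊆ S
  triple⊆ a b c p with ∈-triple p
  ... | inj₁ refl = a
  ... | inj₂ (inj₁ refl) = b
  ... | inj₂ (inj₂ refl) = c

  ∣triple∩∣≡1 : ∀ {N} {a b c : Fin N} {S} → a ∈ S → b ∉ S → c ∉ S → ∣ triple a b c ∩ S ∣ ≡ 1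
  ∣triple∩∣≡1 {a = a} {b} {c} {S} a∈ b∉ c∉ = trans (cong ∣_∣ (⊆-antisym forth back)) (∣⁅x⁆∣≡1 a)
    where
    forth : triple a b c ∩ S ⊆ ⁅ a ⁆
    forth p with x∈p∩q⁻ (triple a b c) S p
    ... | t , s with ∈-triple t
    ...   | inj₁ refl = x∈⁅x⁆ a
    ...   | inj₂ (inj₁ refl) = ⊥-elim (b∉ s)
    ...   | inj₂ (inj₂ refl) = ⊥-elim (c∉ s)
    back : ⁅ a ⁆ ⊆ triple a b c ∩ S
    back p with x∈⁅y⁆⇒x≡y a p
    ... | refl = x∈p∩q⁺ (∈-triple₁ a b c , a∈)

  ∣∣≡0 : ∀ {N} {S : Subset N} → (∀ x → x ∉ S) → ∣ S ∣ ≡ 0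
  ∣∣≡0 {N} empty = trans (cong ∣_∣ (Empty-unique λ (x , p) → empty x p)) (∣⊥∣≡0 N)

  -- The parts are approximated by separate graphs, and the glued graph agrees with each of them
  -- only on the 3-sets inside the corresponding part.
  IsTrec-cong : ∀ {N} {S : Subset N} {G G′ : Graph3 N} → (∀ e → e ⊆ S → ∣ e ∣ ≡ 3 → G e ≡ G′ e) → IsTrec S G → IsTrec S G′
  IsTrec-cong eq (small s none) = small s λ e e⊆S (three , edge) → none e e⊆S (three , trans (eq e e⊆S three) edge)
  IsTrec-cong {S = S} eq (split V₁ V₂ V₃ 3≤S V≡S d₁₂ d₁₃ d₂₃ n₁ n₂ n₃ t₁ t₂ t₃ crossing others) =
    split V₁ V₂ V₃ 3≤S V≡S d₁₂ d₁₃ d₂₃ n₁ n₂ n₃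
      (IsTrec-cong (λ e e⊆ → eq e λ p → sub₁ (e⊆ p)) t₁) (IsTrec-cong (λ e e⊆ → eq e λ p → sub₂ (e⊆ p)) t₂) (IsTrec-cong (λ e e⊆ → eq e λ p → sub₃ (e⊆ p)) t₃)
      (λ e e⊆S three c → trans (sym (eq e e⊆S three)) (crossing e e⊆S three c))
      (λ e e⊆S (three , edge) → others e e⊆S (three , trans (eq e e⊆S three) edge))
    where
    sub₁ : V₁ ⊆ S
    sub₁ p = subst (_ ∈_) V≡S (x∈p∪q⁺ (inj₁ p))
    sub₂ : V₂ ⊆ S
    sub₂ p = subst (_ ∈_) V≡S (x∈p∪q⁺ (inj₂ (x∈p∪q⁺ (inj₁ p))))
    sub₃ : V₃ ⊆ S
    sub₃ p = subst (_ ∈_) V≡S (x∈p∪q⁺ (inj₂ (x∈p∪q⁺ (inj₂ p))))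

  ≡ᶜ⇒≡ : ∀ i j → T (i ≡ᶜ j) → i ≡ j
  ≡ᶜ⇒≡ c₁ c₁ _ = refl
  ≡ᶜ⇒≡ c₂ c₂ _ = refl
  ≡ᶜ⇒≡ c₃ c₃ _ = refl

  ≡ᶜ-refl : ∀ i → T (i ≡ᶜ i)
  ≡ᶜ-refl c₁ = tt
  ≡ᶜ-refl c₂ = tt
  ≡ᶜ-refl c₃ = tt

  T-∧⁺ : ∀ {a b} → T a → T b → T (a ∧ b)
  T-∧⁺ {true} _ q = q

  T-∨ : ∀ a {b} → T (a ∨ b) → T a ⊎ T b
  T-∨ true _ = inj₁ tt
  T-∨ false q = inj₂ q

  -- Gluing constructions along a class function

  module Glue {N : ℕ} (S : Subset N) (f : Fin N → Class) where

    V : Class → Subset N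
    V i = tabulate λ u → lookup S u ∧ (f u ≡ᶜ i)

    ∈V⁻ : ∀ {i x} → x ∈ V i → x ∈ S × f x ≡ i
    ∈V⁻ {i} {x} p with T-∧ {lookup S x} (subst T (lookup∘tabulate _ x) (∈⇒T p))
    ... | s , c = T⇒∈ s , ≡ᶜ⇒≡ (f x) i c

    ∈V⁺ : ∀ {x} → x ∈ S → x ∈ V (f x)
    ∈V⁺ {x} p = T⇒∈ (subst T (sym (lookup∘tabulate _ x)) (T-∧⁺ (∈⇒T p) (≡ᶜ-refl (f x))))

    ∈V : ∀ {i x} → x ∈ S → f x ≡ i → x ∈ V i
    ∈V p refl = ∈V⁺ p

    ∉V : ∀ {i x} → f x ≢ i → x ∉ V i
    ∉V ≢i p = ≢i (proj₂ (∈V⁻ p))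

    ∑-part : ∀ i (g : Fin N → ℕ) → ∑ (elements (V i)) g ≡ ∑ (elements S) (λ u → ⟦ f u ≡ᶜ i ⟧ * g u)
    ∑-part i g = begin-equality
      ∑ (elements (V i)) g                                        ≡⟨ ∑-filter _ (allFin N) g ⟩
      ∑ (allFin N) (λ u → ⟦ lookup (V i) u ⟧ * g u)               ≡⟨ ∑-cong (allFin N) (λ u → trans (cong (λ b → ⟦ b ⟧ * g u) (lookup∘tabulate _ u))
                                                                       (trans (cong (_* g u) (⟦∧⟧ (lookup S u) _)) (*-assoc ⟦ lookup S u ⟧ _ _))) ⟩
      ∑ (allFin N) (λ u → ⟦ lookup S u ⟧ * (⟦ f u ≡ᶜ i ⟧ * g u))  ≡⟨ sym (∑-filter _ (allFin N) _) ⟩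
      ∑ (elements S) (λ u → ⟦ f u ≡ᶜ i ⟧ * g u)                   ∎
      where open ≤-Reasoning

    ∑³-part : ∀ i (g : Fin N → Fin N → Fin N → ℕ) → ∑ⁿ (elements (V i)) 3 g ≡
      ∑ⁿ (elements S) 3 (λ p q r → ⟦ f p ≡ᶜ i ⟧ * (⟦ f q ≡ᶜ i ⟧ * (⟦ f r ≡ᶜ i ⟧ * g p q r)))
    ∑³-part i g = trans (∑-part i _) (∑-cong (elements S) λ p → trans (cong (⟦ f p ≡ᶜ i ⟧ *_) (trans (∑-part i _)
        (∑-cong (elements S) λ q → trans (cong (⟦ f q ≡ᶜ i ⟧ *_) (∑-part i _)) (sym (∑-*ˡ (elements S) ⟦ f q ≡ᶜ i ⟧ _)))))
        (sym (trans (∑-cong (elements S) λ q → ∑-*ˡ (elements S) ⟦ f p ≡ᶜ i ⟧ _) (∑-*ˡ (elements S) ⟦ f p ≡ᶜ i ⟧ _))))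

    size : Class → ℕ
    size i = ∑ (elements S) λ u → ⟦ f u ≡ᶜ i ⟧

    length-part : ∀ i → length (elements (V i)) ≡ size i
    length-part i = trans (sym (trans (∑-const (elements (V i)) 1) (*-identityʳ _)))
      (trans (∑-part i _) (∑-cong (elements S) λ u → *-identityʳ _))

    nonempty : ∀ {i} → 0 < size i → Nonempty (V i)
    nonempty {i} pos with ∑-pos (allFin N) (subst (0 <_) (trans (sym (length-part i)) (trans (length-elements (V i)) (∣∣≡∑ (V i)))) pos)
    ... | x , t = x , T⇒∈ (0<⟦⟧⇒T _ t)

    module _ (G : Class → Graph3 N) where

      crossing : Graph3 N
      crossing e = (∣ e ∩ V c₁ ∣ ≡ᵇ 1) ∧ ((∣ e ∩ V c₂ ∣ ≡ᵇ 1) ∧ (∣ e ∩ V c₃ ∣ ≡ᵇ 1))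

      within : Class → Graph3 N
      within i e = does (e ⊆? V i) ∧ G i e

      glue : Graph3 N
      glue e = crossing e ∨ (within c₁ e ∨ (within c₂ e ∨ within c₃ e))

      private
        misses : ∀ {e i j} → e ⊆ V i → i ≢ j → ∣ e ∩ V j ∣ ≡ 0
        misses {e} {i} {j} e⊆ i≢j = ∣∣≡0 λ x p → let (x∈e , x∈Vj) = x∈p∩q⁻ e (V j) p in
          i≢j (trans (sym (proj₂ (∈V⁻ (e⊆ x∈e)))) (proj₂ (∈V⁻ x∈Vj)))

        not-within : ∀ {e i j} → e ⊆ V i → ∣ e ∣ ≡ 3 → i ≢ j → within j e ≡ false
        not-within {e} {i} {j} e⊆ three i≢j = cong (_∧ G j e) (dec-false (e ⊆? V j) λ e⊆j →
          contra (≤-trans (≤-reflexive (sym three)) (≤-trans (p⊆q⇒∣p∣≤∣q∣ (λ p → x∈p∩q⁺ (p , e⊆j p))) (≤-reflexive (misses e⊆ i≢j)))))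
          where
          contra : 3 ≤ 0 → ⊥₀
          contra ()

      -- A 3-set inside one part misses the other two, so it is neither crossing nor contained in
      -- another part.
      glue-within : ∀ i e → e ⊆ V i → ∣ e ∣ ≡ 3 → glue e ≡ G i e
      glue-within c₁ e e⊆ three rewrite misses {j = c₂} e⊆ (λ ()) | not-within {j = c₂} e⊆ three (λ ()) | not-within {j = c₃} e⊆ three (λ ())
        | dec-true (e ⊆? V c₁) e⊆ | ∧-zeroʳ (∣ e ∩ V c₁ ∣ ≡ᵇ 1) = ∨-identityʳ (G c₁ e)
      glue-within c₂ e e⊆ three rewrite misses {j = c₁} e⊆ (λ ()) | not-within {j = c₁} e⊆ three (λ ()) | not-within {j = c₃} e⊆ three (λ ())
        | dec-true (e ⊆? V c₂) e⊆ = ∨-identityʳ (G c₂ e)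
      glue-within c₃ e e⊆ three rewrite misses {j = c₁} e⊆ (λ ()) | not-within {j = c₁} e⊆ three (λ ()) | not-within {j = c₂} e⊆ three (λ ())
        | dec-true (e ⊆? V c₃) e⊆ = refl

      glue-crossing : ∀ e → Crossing (V c₁) (V c₂) (V c₃) e → glue e ≡ true
      glue-crossing e (o₁ , o₂ , o₃) rewrite o₁ | o₂ | o₃ = refl

      private
        within⁻ : ∀ i e → T (within i e) → e ⊆ V i
        within⁻ i e t with e ⊆? V i
        ... | yes p = p

      glue-edge : ∀ e → glue e ≡ true → Crossing (V c₁) (V c₂) (V c₃) e ⊎ (e ⊆ V c₁ ⊎ (e ⊆ V c₂ ⊎ e ⊆ V c₃))
      glue-edge e edge with T-∨ (crossing e) (subst T (sym edge) tt)
      ... | inj₁ c with T-∧ {∣ e ∩ V c₁ ∣ ≡ᵇ 1} c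
      ...   | o₁ , c′ with T-∧ {∣ e ∩ V c₂ ∣ ≡ᵇ 1} c′
      ...     | o₂ , o₃ = inj₁ (≡ᵇ⇒≡ _ 1 o₁ , ≡ᵇ⇒≡ _ 1 o₂ , ≡ᵇ⇒≡ _ 1 o₃)
      glue-edge e edge | inj₂ w with T-∨ (within c₁ e) w
      ... | inj₁ w₁ = inj₂ (inj₁ λ {x} → within⁻ c₁ e w₁ {x})
      ... | inj₂ w′ with T-∨ (within c₂ e) w′
      ...   | inj₁ w₂ = inj₂ (inj₂ (inj₁ λ {x} → within⁻ c₂ e w₂ {x}))
      ...   | inj₂ w₃ = inj₂ (inj₂ (inj₂ λ {x} → within⁻ c₃ e w₃ {x}))

      private
        disjoint : ∀ {i j} → i ≢ j → V i ∩ V j ≡ ⊥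
        disjoint {i} {j} i≢j = Empty-unique λ (x , p) → let (pi , pj) = x∈p∩q⁻ (V i) (V j) p in
          i≢j (trans (sym (proj₂ (∈V⁻ pi))) (proj₂ (∈V⁻ pj)))

        covers : V c₁ ∪ (V c₂ ∪ V c₃) ≡ S
        covers = ⊆-antisym forth back
          where
          forth : V c₁ ∪ (V c₂ ∪ V c₃) ⊆ S
          forth p with x∈p∪q⁻ (V c₁) _ p
          ... | inj₁ q = proj₁ (∈V⁻ q)
          ... | inj₂ p′ with x∈p∪q⁻ (V c₂) (V c₃) p′
          ...   | inj₁ q = proj₁ (∈V⁻ q)
          ...   | inj₂ q = proj₁ (∈V⁻ q)
          back : S ⊆ V c₁ ∪ (V c₂ ∪ V c₃)
          back {x} p with f x in eq
          ... | c₁ = x∈p∪q⁺ (inj₁ (∈V p eq))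
          ... | c₂ = x∈p∪q⁺ (inj₂ (x∈p∪q⁺ (inj₁ (∈V p eq))))
          ... | c₃ = x∈p∪q⁺ (inj₂ (x∈p∪q⁺ (inj₂ (∈V p eq))))

      glue-isTrec : 3 ≤ ∣ S ∣ → (∀ i → Nonempty (V i)) → (∀ i → IsTrec (V i) (G i)) → IsTrec S glue
      glue-isTrec 3≤S ne trec = split (V c₁) (V c₂) (V c₃) 3≤S covers (disjoint λ ()) (disjoint λ ()) (disjoint λ ()) (ne c₁) (ne c₂) (ne c₃)
          (piece c₁) (piece c₂) (piece c₃) (λ e _ _ → glue-crossing e) (λ e _ (_ , edge) → glue-edge e edge)
        where
        piece : ∀ i → IsTrec (V i) glue
        piece i = IsTrec-cong (λ e e⊆ three → sym (glue-within i e e⊆ three)) (trec i)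

  ∃∉ : ∀ {N} (S P : Subset N) → ∣ P ∣ < ∣ S ∣ → ∃ λ x → x ∈ S × x ∉ P
  ∃∉ S P P<S with any? (λ x → (x ∈? S) ×-dec ¬? (x ∈? P))
  ... | yes found = found
  ... | no none = ⊥-elim (<⇒≱ P<S (p⊆q⇒∣p∣≤∣q∣ λ {x} x∈S → decidable-stable (x ∈? P) λ x∉P → none (x , x∈S , x∉P)))

  ∣⁅⁆∪∣≤ : ∀ {N} (x y : Fin N) → ∣ ⁅ x ⁆ ∪ ⁅ y ⁆ ∣ ≤ 2
  ∣⁅⁆∪∣≤ x y = ≤-trans (∣p∪q∣≤ ⁅ x ⁆ ⁅ y ⁆) (≤-reflexive (cong₂ _+_ (∣⁅x⁆∣≡1 x) (∣⁅x⁆∣≡1 y)))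
    where
    ∣p∪q∣≤ : ∀ {N} (p q : Subset N) → ∣ p ∪ q ∣ ≤ ∣ p ∣ + ∣ q ∣
    ∣p∪q∣≤ []ᵛ []ᵛ = z≤n
    ∣p∪q∣≤ (true ∷ᵛ p) (true ∷ᵛ q) = s≤s (≤-trans (∣p∪q∣≤ p q) (+-monoʳ-≤ ∣ p ∣ (n≤1+n _)))
    ∣p∪q∣≤ (true ∷ᵛ p) (false ∷ᵛ q) = s≤s (∣p∪q∣≤ p q)
    ∣p∪q∣≤ (false ∷ᵛ p) (true ∷ᵛ q) = ≤-trans (s≤s (∣p∪q∣≤ p q)) (≤-reflexive (sym (+-suc ∣ p ∣ ∣ q ∣)))
    ∣p∪q∣≤ (false ∷ᵛ p) (false ∷ᵛ q) = ∣p∪q∣≤ p q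

  one-each : ∀ {N} (S : Subset N) → 3 ≤ ∣ S ∣ → ∃ λ x → ∃ λ y → ∃ λ z → x ∈ S × y ∈ S × z ∈ S × x ≢ y × x ≢ z × y ≢ z
  one-each {N} S 3≤S with ∃∉ S ⊥ (≤-trans (s≤s (≤-reflexive (∣⊥∣≡0 N))) (≤-trans (s≤s z≤n) 3≤S))
  ... | x , x∈ , _ with ∃∉ S ⁅ x ⁆ (≤-trans (s≤s (≤-reflexive (∣⁅x⁆∣≡1 x))) (≤-trans (s≤s (s≤s z≤n)) 3≤S))
  ... | y , y∈ , y∉ with ∃∉ S (⁅ x ⁆ ∪ ⁅ y ⁆) (≤-trans (s≤s (∣⁅⁆∪∣≤ x y)) 3≤S)
  ... | z , z∈ , z∉ = x , y , z , x∈ , y∈ , z∈ , (λ { refl → y∉ (x∈⁅x⁆ x) })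
    , (λ { refl → z∉ (x∈p∪q⁺ (inj₁ (x∈⁅x⁆ x))) }) , (λ { refl → z∉ (x∈p∪q⁺ (inj₂ (x∈⁅x⁆ y))) })

  -- Serves as the approximation at depth zero. The parts are as unbalanced as possible, `x` alone,
  -- `y` alone and everything else; the bound `s` makes the recursion structural.
  isTrec-exists : ∀ {N} s (S : Subset N) → ∣ S ∣ ≤ s → ∃ λ G → IsTrec S G
  isTrec-exists s S ∣S∣≤s with 3 ≤? ∣ S ∣
  ... | no ¬3≤ = (λ _ → false) , small ¬3≤ λ { _ _ (_ , ()) }
  isTrec-exists zero S ∣S∣≤s | yes 3≤S = ⊥-elim (<⇒≱ (≤-trans (s≤s z≤n) 3≤S) ∣S∣≤s)
  isTrec-exists {N} (suc s) S ∣S∣≤s | yes 3≤S with one-each S 3≤S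
  ... | x , y , z , x∈ , y∈ , z∈ , x≢y , x≢z , y≢z = glue G , glue-isTrec G 3≤S ne trec
    where
    f : Fin N → Class
    f u = classify (does (u Data.Fin.≟ x)) (does (u Data.Fin.≟ y))
    fx : f x ≡ c₁
    fx rewrite dec-true (x Data.Fin.≟ x) refl = refl
    fy : f y ≡ c₂
    fy rewrite dec-false (y Data.Fin.≟ x) (x≢y ∘ sym) | dec-true (y Data.Fin.≟ y) refl = refl
    fz : f z ≡ c₃
    fz rewrite dec-false (z Data.Fin.≟ x) (x≢z ∘ sym) | dec-false (z Data.Fin.≟ y) (y≢z ∘ sym) = refl
    open Glue S f
    ne : ∀ i → Nonempty (V i)
    ne c₁ = x , ∈V x∈ fx
    ne c₂ = y , ∈V y∈ fy
    ne c₃ = z , ∈V z∈ fz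
    proper : ∀ i {u} → u ∈ S → f u ≢ i → ∣ V i ∣ < ∣ S ∣
    proper i u∈ ≢i = p⊂q⇒∣p∣<∣q∣ ((λ p → proj₁ (∈V⁻ p)) , _ , u∈ , ∉V ≢i)
    smaller : ∀ i → ∣ V i ∣ ≤ s
    smaller c₁ = s≤s⁻¹ (≤-trans (proper c₁ y∈ (λ p → case-absurd (trans (sym fy) p))) ∣S∣≤s)
      where
      case-absurd : c₂ ≡ c₁ → ⊥₀
      case-absurd ()
    smaller c₂ = s≤s⁻¹ (≤-trans (proper c₂ x∈ (λ p → case-absurd (trans (sym fx) p))) ∣S∣≤s)
      where
      case-absurd : c₁ ≡ c₂ → ⊥₀
      case-absurd ()
    smaller c₃ = s≤s⁻¹ (≤-trans (proper c₃ x∈ (λ p → case-absurd (trans (sym fx) p))) ∣S∣≤s)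
      where
      case-absurd : c₁ ≡ c₃ → ⊥₀
      case-absurd ()
    G : Class → Graph3 N
    G i = proj₁ (isTrec-exists s (V i) (smaller i))
    trec : ∀ i → IsTrec (V i) (G i)
    trec i = proj₂ (isTrec-exists s (V i) (smaller i))

  -- Case analysis on class patterns

  ClassFun : ℕ → Set
  ClassFun zero = Bool
  ClassFun (suc k) = Class → ClassFun k

  tautologyᶜ : ∀ k → ClassFun k → Bool
  tautologyᶜ zero b = b
  tautologyᶜ (suc k) f = tautologyᶜ k (f c₁) ∧ (tautologyᶜ k (f c₂) ∧ tautologyᶜ k (f c₃))

  Holdsᶜ : ∀ k → ClassFun k → Set
  Holdsᶜ zero b = T b
  Holdsᶜ (suc k) f = ∀ i → Holdsᶜ k (f i)

  tautologyᶜ-sound : ∀ k (f : ClassFun k) → T (tautologyᶜ k f) → Holdsᶜ k f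
  tautologyᶜ-sound zero b p = p
  tautologyᶜ-sound (suc k) f p with T-∧ {tautologyᶜ k (f c₁)} p
  ... | p₁ , p′ with T-∧ {tautologyᶜ k (f c₂)} p′
  ... | p₂ , p₃ = λ { c₁ → tautologyᶜ-sound k (f c₁) p₁ ; c₂ → tautologyᶜ-sound k (f c₂) p₂ ; c₃ → tautologyᶜ-sound k (f c₃) p₃ }

  Rainbow : Class → Class → Class → Set
  Rainbow i j k = i ≢ j × j ≢ k × i ≢ k

  good-cases : ∀ i j k → (i ≡ j × j ≡ k) ⊎ (good i j k ≡ false ⊎ Rainbow i j k)
  good-cases i j k with T? (i ≡ᶜ j) | T? (j ≡ᶜ k) | T? (i ≡ᶜ k)
  ... | yes ij | yes jk | _ = inj₁ (≡ᶜ⇒≡ i j ij , ≡ᶜ⇒≡ j k jk)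
  ... | yes ij | no ¬jk | _ rewrite T⇒≡ ij | ¬T⇒≡ ¬jk = inj₂ (inj₁ refl)
  ... | no ¬ij | yes jk | _ rewrite ¬T⇒≡ ¬ij | T⇒≡ jk | ∨-zeroʳ (i ≡ᶜ k) = inj₂ (inj₁ refl)
  ... | no ¬ij | no ¬jk | yes ik rewrite ¬T⇒≡ ¬ij | T⇒≡ ik = inj₂ (inj₁ refl)
  ... | no ¬ij | no ¬jk | no ¬ik = inj₂ (inj₂ (apart ¬ij , apart ¬jk , apart ¬ik))
    where
    apart : ∀ {i j} → ¬ T (i ≡ᶜ j) → i ≢ j
    apart {i} ne refl = ne (≡ᶜ-refl i)

  rainbow-covers : ∀ {i j k} → Rainbow i j k → ∀ c → i ≡ c ⊎ (j ≡ c ⊎ k ≡ c)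
  rainbow-covers {i} {j} {k} (i≢j , j≢k , i≢k) c with T-∨ ((i ≡ᶜ c) ∨ ((j ≡ᶜ c) ∨ (k ≡ᶜ c))) (tautologyᶜ-sound 4
      (λ i j k c → ((i ≡ᶜ c) ∨ ((j ≡ᶜ c) ∨ (k ≡ᶜ c))) ∨ ((i ≡ᶜ j) ∨ ((j ≡ᶜ k) ∨ (i ≡ᶜ k)))) tt i j k c)
  ... | inj₁ p with T-∨ (i ≡ᶜ c) p
  ...   | inj₁ ic = inj₁ (≡ᶜ⇒≡ i c ic)
  ...   | inj₂ p′ with T-∨ (j ≡ᶜ c) p′
  ...     | inj₁ jc = inj₂ (inj₁ (≡ᶜ⇒≡ j c jc))
  ...     | inj₂ kc = inj₂ (inj₂ (≡ᶜ⇒≡ k c kc))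
  rainbow-covers {i} {j} {k} (i≢j , j≢k , i≢k) c | inj₂ p with T-∨ (i ≡ᶜ j) p
  ...   | inj₁ ij = ⊥-elim (i≢j (≡ᶜ⇒≡ i j ij))
  ...   | inj₂ p′ with T-∨ (j ≡ᶜ k) p′
  ...     | inj₁ jk = ⊥-elim (j≢k (≡ᶜ⇒≡ j k jk))
  ...     | inj₂ ik = ⊥-elim (i≢k (≡ᶜ⇒≡ i k ik))

  member : Class → Class → ℕ
  member i c = ⟦ i ≡ᶜ c ⟧

  -- Written as six products so that the sum over all triples factors into class sizes.
  rainbowCount : Class → Class → Class → ℕ
  rainbowCount i j k =
    (member i c₁ * (member j c₂ * member k c₃) + (member i c₁ * (member j c₃ * member k c₂) + member i c₂ * (member j c₁ * member k c₃))) +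
    (member i c₂ * (member j c₃ * member k c₁) + (member i c₃ * (member j c₁ * member k c₂) + member i c₃ * (member j c₂ * member k c₁)))

  inClass : Class → Class → Class → Class → ℕ → ℕ
  inClass c i j k e = member i c * (member j c * (member k c * e))

  edge-cover : ∀ e i j k → ⟦ e ⟧ ≤ ⟦ e ⟧ * ⟦ not (good i j k) ⟧ +
    (inClass c₁ i j k ⟦ e ⟧ + (inClass c₂ i j k ⟦ e ⟧ + inClass c₃ i j k ⟦ e ⟧)) + rainbowCount i j k
  edge-cover false i j k = z≤n
  edge-cover true i j k = ≤ᵇ⇒≤ _ _ (tautologyᶜ-sound 3 (λ i j k → 1 ≤ᵇ 1 * ⟦ not (good i j k) ⟧ +
    (inClass c₁ i j k 1 + (inClass c₂ i j k 1 + inClass c₃ i j k 1)) + rainbowCount i j k) tt i j k)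

  -- Edges as indicators of ordered triples

  triple-distinct : ∀ {N} {a b c : Fin N} → ∣ triple a b c ∣ ≡ 3 → a ≢ b
  triple-distinct {a = a} {c = c} three refl = <⇒≱ (s≤s (∣⁅⁆∪∣≤ a c)) (≤-trans (≤-reflexive (sym three)) (p⊆q⇒∣p∣≤∣q∣ collapse))
    where
    collapse : triple a a c ⊆ ⁅ a ⁆ ∪ ⁅ c ⁆
    collapse p with ∈-triple p
    ... | inj₁ refl = x∈p∪q⁺ (inj₁ (x∈⁅x⁆ a))
    ... | inj₂ (inj₁ refl) = x∈p∪q⁺ (inj₁ (x∈⁅x⁆ a))
    ... | inj₂ (inj₂ refl) = x∈p∪q⁺ (inj₂ (x∈⁅x⁆ c))

  indicator : ∀ {N} → Graph3 N → Fin N → Fin N → Fin N → Bool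
  indicator H x y z = (∣ triple x y z ∣ ≡ᵇ 3) ∧ H (triple x y z)

  indicator⇒edge : ∀ {N} (H : Graph3 N) x y z → T (indicator H x y z) → IsEdge H (triple x y z)
  indicator⇒edge H x y z t = let (three , edge) = T-∧ {∣ triple x y z ∣ ≡ᵇ 3} t in ≡ᵇ⇒≡ _ 3 three , T⇒≡ edge

  edge-distinct : ∀ {N} (H : Graph3 N) x y z → IsEdge H (triple x y z) → x ≢ y × x ≢ z × y ≢ z
  edge-distinct H x y z (three , _) = triple-distinct three
    , triple-distinct (trans (cong ∣_∣ (triple-swap₂ x z y)) three)
    , triple-distinct (trans (cong ∣_∣ (trans (triple-swap₂ y z x) (triple-swap₁ y x z))) three)

  -- Of the ten pairs among the five vertices only `b`, `e` lies in none of the four edges. The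
  -- others are distinct automatically, so `b ≢ e` would complete a copy.
  C53-free⇒ : ∀ {N} (H : Graph3 N) → C53-free H → ∀ {a b c d e} →
    T (indicator H a b c) → T (indicator H b c d) → T (indicator H c d e) → T (indicator H d e a) → b ≡ e
  C53-free⇒ {N} H free {a} {b} {c} {d} {e} t₁ t₂ t₃ t₄ with b Data.Fin.≟ e
  ... | yes b≡e = b≡e
  ... | no b≢e = ⊥-elim (free (lookup vertices , (λ {i} {j} → lookup-injective distinct i j) , e₁ , e₂ , e₃ , e₄))
    where
    vertices : Vec (Fin N) 5
    vertices = a ∷ᵛ b ∷ᵛ c ∷ᵛ d ∷ᵛ e ∷ᵛ []ᵛ
    e₁ = indicator⇒edge H a b c t₁
    e₂ = indicator⇒edge H b c d t₂
    e₃ = indicator⇒edge H c d e t₃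
    e₄ = indicator⇒edge H d e a t₄
    distinct : VecUnique vertices
    distinct with edge-distinct H a b c e₁ | edge-distinct H b c d e₂ | edge-distinct H c d e e₃ | edge-distinct H d e a e₄
    ... | a≢b , a≢c , b≢c | _ , b≢d , c≢d | _ , c≢e , d≢e | _ , d≢a , e≢a =
      (a≢b ∷ᵃ a≢c ∷ᵃ (d≢a ∘ sym) ∷ᵃ (e≢a ∘ sym) ∷ᵃ []ᵃ) ∷ᵖ (b≢c ∷ᵃ b≢d ∷ᵃ b≢e ∷ᵃ []ᵃ) ∷ᵖ (c≢d ∷ᵃ c≢e ∷ᵃ []ᵃ) ∷ᵖ (d≢e ∷ᵃ []ᵃ) ∷ᵖ []ᵃ ∷ᵖ []ᵖ

  -- Arithmetic of one recursion level

  cube-mono : ∀ {a b} → a ≤ b → cube a ≤ cube b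
  cube-mono p = *-mono-≤ p (*-mono-≤ p p)

  -- The cube of the sum equals the sum of the cubes plus `3 * (a * (b + c)²)` and its two analogues
  -- minus `12 * (a * (b * c))`, and each square is at least four times the product of its terms.
  cube-superadditive : ∀ a b c → cube a + (cube b + cube c) + 24 * (a * (b * c)) ≤ cube (a + (b + c))
  cube-superadditive a b c = certify 0 (*-monoʳ-≤ 3 (+-mono-≤ (*-monoʳ-≤ a (4ab≤[a+b]² b c)) (+-mono-≤ (*-monoʳ-≤ b (4ab≤[a+b]² a c)) (*-monoʳ-≤ c (4ab≤[a+b]² a b)))))
      (arith a b c)
    where
    arith : ∀ a b c → a * (a * a) + (b * (b * b) + c * (c * c)) + 24 * (a * (b * c)) +
      3 * (a * ((b + c) * (b + c)) + (b * ((a + c) * (a + c)) + c * ((a + b) * (a + b)))) + 0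
      ≡ (a + (b + c)) * ((a + (b + c)) * (a + (b + c))) + 3 * (a * (4 * (b * c)) + (b * (4 * (a * c)) + c * (4 * (a * b))))
    arith = solve-∀

  -- The parts `b` and `c` obey the density bound, so nearly the whole deficit falls on `a`: 4K from
  -- bad edges, 1 from the given deficit and twice 9 from `density`, all times n³/m. As
  -- `n ≤ 10 * a`, passing from n³ to a³ costs the factor 1000.
  child-dense : ∀ m K M n a b c E Ea Eb Ec bad → n ≡ a + (b + c) →
    1 ≤ m → 1000 * (4 * K + 19) * M ≤ m → n ≤ 10 * a →
    m * m * cube n ≤ 4 * (m * m * E) + cube n →
    E ≤ bad + (Ea + (Eb + Ec)) + 6 * (a * (b * c)) →
    m * bad ≤ K * cube n →
    4 * (m * m * Eb) ≤ m * m * cube b + 9 * cube b →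
    4 * (m * m * Ec) ≤ m * m * cube c + 9 * cube c →
    M * cube a ≤ 4 * (M * Ea) + cube a
  child-dense m K M n a b c E Ea Eb Ec bad refl 1≤m large n≤10a dense decomposition bad≤ density-b density-c =
      *-cancelˡ-≤ (m * m) {{m*n≢0 m m {{>-nonZero 1≤m}} {{>-nonZero 1≤m}}}}
        (≤-trans (certify 0 (+-mono-≤ (*-monoʳ-≤ M deficit) (*-monoʳ-≤ (m * (4 * K + 19) * M) n³≤1000a³)) (arith₂ m K M (cube a) Ea (cube n)))
          (≤-trans (+-monoʳ-≤ (m * m * (4 * (M * Ea))) (≤-trans (≤-reflexive (arith₃ m K M (cube a))) (*-monoˡ-≤ (cube a) (*-monoʳ-≤ m large))))
            (≤-reflexive (sym (*-distribˡ-+ (m * m) (4 * (M * Ea)) (cube a))))))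
    where
    b≤n : b ≤ n
    b≤n = ≤-trans (m≤m+n b c) (m≤n+m (b + c) a)
    c≤n : c ≤ n
    c≤n = ≤-trans (m≤n+m c b) (m≤n+m (b + c) a)
    1≤mK : cube n ≤ m * cube n
    1≤mK = ≤-trans (≤-reflexive (sym (*-identityˡ (cube n)))) (*-monoˡ-≤ (cube n) 1≤m)
    deficit : m * m * cube a ≤ 4 * (m * m * Ea) + m * (4 * K + 19) * cube n
    deficit = certify 0 (+-mono-≤ (+-mono-≤ (+-mono-≤ dense (*-monoʳ-≤ (4 * (m * m)) decomposition)) (+-mono-≤ (*-monoʳ-≤ (4 * m) bad≤) (*-monoʳ-≤ (m * m) (cube-superadditive a b c))))
        (+-mono-≤ (+-mono-≤ density-b density-c) (+-mono-≤ (+-mono-≤ (*-monoʳ-≤ 9 (cube-mono b≤n)) (*-monoʳ-≤ 9 (cube-mono c≤n))) (*-monoʳ-≤ 19 1≤mK))))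
      (arith₁ m K (cube a) (cube b) (cube c) (cube n) E Ea Eb Ec bad (a * (b * c)))
      where
      arith₁ : ∀ m K A B C N E Ea Eb Ec bad p →
        m * m * A + (4 * (m * m * E) + N + 4 * (m * m) * (bad + (Ea + (Eb + Ec)) + 6 * p) + (4 * m * (K * N) + m * m * N)
          + (m * m * B + 9 * B + (m * m * C + 9 * C) + (9 * N + 9 * N + 19 * (m * N)))) + 0
        ≡ 4 * (m * m * Ea) + m * (4 * K + 19) * N + (m * m * N + 4 * (m * m) * E + (4 * m * (m * bad) + m * m * (A + (B + C) + 24 * p))
          + (4 * (m * m * Eb) + 4 * (m * m * Ec) + (9 * B + 9 * C + 19 * N)))
      arith₁ = solve-∀
    n³≤1000a³ : cube n ≤ 1000 * cube a
    n³≤1000a³ = ≤-trans (cube-mono n≤10a) (≤-reflexive (scale a))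
      where
      scale : ∀ a → 10 * a * (10 * a * (10 * a)) ≡ 1000 * (a * (a * a))
      scale = solve-∀
    arith₂ : ∀ m K M A Ea N → m * m * (M * A) + (M * (4 * (m * m * Ea) + m * (4 * K + 19) * N) + m * (4 * K + 19) * M * (1000 * A)) + 0
      ≡ m * m * (4 * (M * Ea)) + m * (1000 * ((4 * K + 19) * M)) * A + (M * (m * m * A) + m * (4 * K + 19) * M * N)
    arith₂ = solve-∀
    arith₃ : ∀ m K M A → m * (1000 * ((4 * K + 19) * M)) * A ≡ m * (1000 * (4 * K + 19) * M) * A
    arith₃ = solve-∀

  -- Two parts of size at least n/10 leave at most 4n/5 for the third. Bounding two of the three
  -- factors of each cube this way, the remaining ones add up to n.
  cubes-shrink : ∀ a b c → let n = a + (b + c) in n ≤ 10 * a → n ≤ 10 * b → n ≤ 10 * c →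
    25 * (cube a + (cube b + cube c)) ≤ 16 * cube n
  cubes-shrink a b c pa pb pc = certify 0 (+-mono-≤ (*-monoʳ-≤ a (*-mono-≤ 5a≤4n 5a≤4n)) (+-mono-≤ (*-monoʳ-≤ b (*-mono-≤ 5b≤4n 5b≤4n)) (*-monoʳ-≤ c (*-mono-≤ 5c≤4n 5c≤4n))))
      (arith a b c)
    where
    n = a + (b + c)
    5a≤4n : 5 * a ≤ 4 * n
    5a≤4n = *-cancelˡ-≤ 2 (certify 0 (+-mono-≤ pb pc) (lemma a b c))
      where
      lemma : ∀ a b c → 2 * (5 * a) + (10 * b + 10 * c) + 0 ≡ 2 * (4 * (a + (b + c))) + (a + (b + c) + (a + (b + c)))
      lemma = solve-∀
    5b≤4n : 5 * b ≤ 4 * n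
    5b≤4n = *-cancelˡ-≤ 2 (certify 0 (+-mono-≤ pa pc) (lemma a b c))
      where
      lemma : ∀ a b c → 2 * (5 * b) + (10 * a + 10 * c) + 0 ≡ 2 * (4 * (a + (b + c))) + (a + (b + c) + (a + (b + c)))
      lemma = solve-∀
    5c≤4n : 5 * c ≤ 4 * n
    5c≤4n = *-cancelˡ-≤ 2 (certify 0 (+-mono-≤ pa pb) (lemma a b c))
      where
      lemma : ∀ a b c → 2 * (5 * c) + (10 * a + 10 * b) + 0 ≡ 2 * (4 * (a + (b + c))) + (a + (b + c) + (a + (b + c)))
      lemma = solve-∀
    arith : ∀ a b c → 25 * (a * (a * a) + (b * (b * b) + c * (c * c))) +
      (a * (4 * (a + (b + c)) * (4 * (a + (b + c)))) + (b * (4 * (a + (b + c)) * (4 * (a + (b + c)))) + c * (4 * (a + (b + c)) * (4 * (a + (b + c)))))) + 0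
      ≡ 16 * ((a + (b + c)) * ((a + (b + c)) * (a + (b + c)))) + (a * (5 * a * (5 * a)) + (b * (5 * b * (5 * b)) + c * (5 * c * (5 * c))))
    arith = solve-∀

  -- The parts contribute at most `16/25` of `v / u`, and `large` keeps the bad edges below
  -- `N / 12u`; the two fractions add up to less than 3/4.
  removal-step : ∀ m K u v N bad r r₁ r₂ r₃ N₁ N₂ N₃ → 1 ≤ v → 1 ≤ K → 12 * u * K ≤ m →
    r ≤ bad + (r₁ + (r₂ + r₃)) → m * bad ≤ K * N → 25 * (N₁ + (N₂ + N₃)) ≤ 16 * N →
    u * r₁ ≤ v * N₁ → u * r₂ ≤ v * N₂ → u * r₃ ≤ v * N₃ → 4 * u * r ≤ 3 * v * N
  removal-step m K u v N bad r r₁ r₂ r₃ N₁ N₂ N₃ 1≤v 1≤K large r≤ bad≤ shrink p₁ p₂ p₃ = *-cancelˡ-≤ 75 (certify (8 * (v * N))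
      (+-mono-≤ (+-mono-≤ (*-monoʳ-≤ (300 * u) r≤) (*-monoʳ-≤ 25 12ubad≤N)) (+-mono-≤ (*-monoʳ-≤ (12 * v) shrink)
        (+-mono-≤ (*-monoʳ-≤ 25 (*-monoˡ-≤ N 1≤v)) (+-mono-≤ (*-monoʳ-≤ 300 p₁) (+-mono-≤ (*-monoʳ-≤ 300 p₂) (*-monoʳ-≤ 300 p₃))))))
      (arith u v N bad r r₁ r₂ r₃ N₁ N₂ N₃))
    where
    12ubad≤N : 12 * u * bad ≤ N
    12ubad≤N = *-cancelˡ-≤ K {{>-nonZero 1≤K}} (≤-trans (≤-reflexive (move K u bad)) (≤-trans (*-monoˡ-≤ bad large) bad≤))
      where
      move : ∀ K u b → K * (12 * u * b) ≡ 12 * u * K * b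
      move = solve-∀
    arith : ∀ u v N bad r r₁ r₂ r₃ N₁ N₂ N₃ →
      75 * (4 * u * r) + (300 * u * (bad + (r₁ + (r₂ + r₃))) + 25 * N + (12 * v * (16 * N) + (25 * (v * N) + (300 * (v * N₁) + (300 * (v * N₂) + 300 * (v * N₃)))))) + 8 * (v * N)
      ≡ 75 * (3 * v * N) + (300 * u * r + 25 * (12 * u * bad) + (12 * v * (25 * (N₁ + (N₂ + N₃))) + (25 * (1 * N) + (300 * (u * r₁) + (300 * (u * r₂) + 300 * (u * r₃))))))
    arith = solve-∀

  -- Edges and removals across a split

  edgeSum : ∀ {N} → Graph3 N → List (Fin N) → ℕ
  edgeSum H U = ∑ⁿ U 3 λ x y z → ⟦ indicator H x y z ⟧

  removed : ∀ {N} → Graph3 N → Subset N → Graph3 N → ℕ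
  removed H S G = ∑ⁿ (elements S) 3 λ p q r → ⟦ indicator H p q r ⟧ * ⟦ not (G (triple p q r)) ⟧

  ∑³-product : ∀ {X : Set} (U : List X) (f g h : X → ℕ) → ∑ⁿ U 3 (λ p q r → f p * (g q * h r)) ≡ ∑ U f * (∑ U g * ∑ U h)
  ∑³-product U f g h = trans (∑-cong U λ p → trans (∑-cong U λ q → trans (∑-*ˡ U (f p) _) (cong (f p *_) (∑-*ˡ U (g q) h)))
      (trans (∑-*ˡ U (f p) _) (cong (f p *_) (∑-*ʳ U (∑ U h) g)))) (∑-*ʳ U _ f)

  ∑³-elements-mono : ∀ {N} (S : Subset N) {f g : Fin N → Fin N → Fin N → ℕ} →
    (∀ {x y z} → x ∈ S → y ∈ S → z ∈ S → f x y z ≤ g x y z) → ∑ⁿ (elements S) 3 f ≤ ∑ⁿ (elements S) 3 g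
  ∑³-elements-mono S p = ∑-elements-mono S λ x x∈ → ∑-elements-mono S λ y y∈ → ∑-elements-mono S λ z z∈ → p x∈ y∈ z∈

  module Split {N : ℕ} (H : Graph3 N) (S : Subset N) (f : Fin N → Class) where
    open Glue S f

    U : List (Fin N)
    U = elements S

    bad : ℕ
    bad = ∑ⁿ U 3 λ p q r → ⟦ indicator H p q r ⟧ * ⟦ not (good (f p) (f q) (f r)) ⟧

    length-split : length U ≡ size c₁ + (size c₂ + size c₃)
    length-split = trans (sym (trans (∑-const U 1) (*-identityʳ _))) (trans (∑-cong U λ u → one (f u)) (trans (∑-+ U _ _) (cong (size c₁ +_) (∑-+ U _ _))))
      where
      one : ∀ i → 1 ≡ member i c₁ + (member i c₂ + member i c₃)
      one c₁ = refl
      one c₂ = refl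
      one c₃ = refl

    ∑-inClass : ∀ (F : Fin N → Fin N → Fin N → ℕ) → ∑ⁿ U 3 (λ p q r → inClass c₁ (f p) (f q) (f r) (F p q r) +
        (inClass c₂ (f p) (f q) (f r) (F p q r) + inClass c₃ (f p) (f q) (f r) (F p q r)))
      ≡ ∑ⁿ (elements (V c₁)) 3 F + (∑ⁿ (elements (V c₂)) 3 F + ∑ⁿ (elements (V c₃)) 3 F)
    ∑-inClass F = trans (∑ⁿ-+ U 3 _ _) (cong₂ _+_ (sym (∑³-part c₁ F)) (trans (∑ⁿ-+ U 3 _ _) (cong₂ _+_ (sym (∑³-part c₂ F)) (sym (∑³-part c₃ F)))))

    ∑-rainbow : ∑ⁿ U 3 (λ p q r → rainbowCount (f p) (f q) (f r)) ≡ 6 * (size c₁ * (size c₂ * size c₃))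
    ∑-rainbow = trans (trans (∑ⁿ-+ U 3 _ _) (cong₂ _+_ (trans (∑ⁿ-+ U 3 _ _) (cong₂ _+_ (term c₁ c₂ c₃) (trans (∑ⁿ-+ U 3 _ _) (cong₂ _+_ (term c₁ c₃ c₂) (term c₂ c₁ c₃)))))
        (trans (∑ⁿ-+ U 3 _ _) (cong₂ _+_ (term c₂ c₃ c₁) (trans (∑ⁿ-+ U 3 _ _) (cong₂ _+_ (term c₃ c₁ c₂) (term c₃ c₂ c₁)))))))
        (collect (size c₁) (size c₂) (size c₃))
      where
      term : ∀ i j k → ∑ⁿ U 3 (λ p q r → member (f p) i * (member (f q) j * member (f r) k)) ≡ size i * (size j * size k)
      term i j k = ∑³-product U (λ u → member (f u) i) (λ u → member (f u) j) (λ u → member (f u) k)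
      collect : ∀ a b c → a * (b * c) + (a * (c * b) + b * (a * c)) + (b * (c * a) + (c * (a * b) + c * (b * a))) ≡ 6 * (a * (b * c))
      collect = solve-∀

    edges-split : edgeSum H U ≤ bad + (edgeSum H (elements (V c₁)) + (edgeSum H (elements (V c₂)) + edgeSum H (elements (V c₃)))) + 6 * (size c₁ * (size c₂ * size c₃))
    edges-split = ≤-trans (∑ⁿ-mono U 3 λ p q r → edge-cover (indicator H p q r) (f p) (f q) (f r))
      (≤-reflexive (trans (∑ⁿ-+ U 3 _ _) (cong₂ _+_ (trans (∑ⁿ-+ U 3 _ _) (cong (bad +_) (∑-inClass λ p q r → ⟦ indicator H p q r ⟧))) ∑-rainbow)))

    module _ (G : Class → Graph3 N) where

      private
        missed : Graph3 N → Fin N → Fin N → Fin N → ℕ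
        missed G p q r = ⟦ indicator H p q r ⟧ * ⟦ not (G (triple p q r)) ⟧

        crosses : ∀ {p q r} → p ∈ S → q ∈ S → r ∈ S → Rainbow (f p) (f q) (f r) → Crossing (V c₁) (V c₂) (V c₃) (triple p q r)
        crosses {p} {q} {r} p∈ q∈ r∈ (p≢q , q≢r , p≢r) = meets c₁ , meets c₂ , meets c₃
          where
          meets : ∀ c → ∣ triple p q r ∩ V c ∣ ≡ 1
          meets c with rainbow-covers (p≢q , q≢r , p≢r) c
          ... | inj₁ p≡c = ∣triple∩∣≡1 (∈V p∈ p≡c) (∉V λ q≡c → p≢q (trans p≡c (sym q≡c))) (∉V λ r≡c → p≢r (trans p≡c (sym r≡c)))
          ... | inj₂ (inj₁ q≡c) = trans (cong (λ e → ∣ e ∩ V c ∣) (triple-swap₁ p q r))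
            (∣triple∩∣≡1 (∈V q∈ q≡c) (∉V λ p≡c → p≢q (trans p≡c (sym q≡c))) (∉V λ r≡c → q≢r (trans q≡c (sym r≡c))))
          ... | inj₂ (inj₂ r≡c) = trans (cong (λ e → ∣ e ∩ V c ∣) (trans (triple-swap₂ p q r) (triple-swap₁ p r q)))
            (∣triple∩∣≡1 (∈V r∈ r≡c) (∉V λ p≡c → p≢r (trans p≡c (sym r≡c))) (∉V λ q≡c → q≢r (trans q≡c (sym r≡c))))

        pieces : Fin N → Fin N → Fin N → ℕ
        pieces p q r = inClass c₁ (f p) (f q) (f r) (missed (G c₁) p q r) +
          (inClass c₂ (f p) (f q) (f r) (missed (G c₂) p q r) + inClass c₃ (f p) (f q) (f r) (missed (G c₃) p q r))

        own-piece : ∀ c p q r → f p ≡ c → f q ≡ c → f r ≡ c → missed (G c) p q r ≤ pieces p q r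
        own-piece c₁ p q r e₁ e₂ e₃ rewrite e₁ | e₂ | e₃ = ≤-trans (≤-reflexive (three-ones _)) (m≤m+n _ _)
          where
          three-ones : ∀ e → e ≡ 1 * (1 * (1 * e))
          three-ones = solve-∀
        own-piece c₂ p q r e₁ e₂ e₃ rewrite e₁ | e₂ | e₃ = ≤-trans (≤-reflexive (three-ones _)) (m≤m+n _ _)
          where
          three-ones : ∀ e → e ≡ 1 * (1 * (1 * e))
          three-ones = solve-∀
        own-piece c₃ p q r e₁ e₂ e₃ rewrite e₁ | e₂ | e₃ = ≤-reflexive (three-ones _)
          where
          three-ones : ∀ e → e ≡ 1 * (1 * (1 * e))
          three-ones = solve-∀

        cases : ∀ {p q r} → p ∈ S → q ∈ S → r ∈ S → ∀ b → b ≡ indicator H p q r →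
          ⟦ b ⟧ * ⟦ not (glue G (triple p q r)) ⟧ ≤ ⟦ b ⟧ * ⟦ not (good (f p) (f q) (f r)) ⟧ + pieces p q r
        cases p∈ q∈ r∈ false _ = z≤n
        cases {p} {q} {r} p∈ q∈ r∈ true eq with good-cases (f p) (f q) (f r)
        ... | inj₁ (p≡q , q≡r) = ≤-trans (≤-reflexive (trans (cong (λ b → 1 * ⟦ not b ⟧) same) (cong (λ b → ⟦ b ⟧ * ⟦ not (G (f p) (triple p q r)) ⟧) eq)))
                (≤-trans (own-piece (f p) p q r refl (sym p≡q) (sym (trans p≡q q≡r))) (m≤n+m (pieces p q r) (1 * ⟦ not (good (f p) (f q) (f r)) ⟧)))
          where
          same : glue G (triple p q r) ≡ G (f p) (triple p q r)
          same = glue-within G (f p) (triple p q r) (triple⊆ (∈V p∈ refl) (∈V q∈ (sym p≡q)) (∈V r∈ (sym (trans p≡q q≡r))))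
            (proj₁ (indicator⇒edge H p q r (subst T eq tt)))
        ... | inj₂ (inj₁ notgood) rewrite notgood = ≤-trans (*-monoʳ-≤ 1 (⟦⟧≤1 (not (glue G (triple p q r))))) (m≤m+n 1 _)
        ... | inj₂ (inj₂ rainbow) rewrite glue-crossing G (triple p q r) (crosses p∈ q∈ r∈ rainbow) = z≤n

      -- The glued graph contains every rainbow edge, so a removed edge is bad or lies inside one
      -- part, where the graph of that part already misses it.
      removed-split : removed H S (glue G) ≤ bad + (removed H (V c₁) (G c₁) + (removed H (V c₂) (G c₂) + removed H (V c₃) (G c₃)))
      removed-split = ≤-trans (∑³-elements-mono S λ {p} {q} {r} p∈ q∈ r∈ → cases p∈ q∈ r∈ (indicator H p q r) refl)
        (≤-reflexive (trans (∑ⁿ-+ U 3 _ _) (cong (bad +_) (trans (∑ⁿ-+ U 3 _ _) (cong₂ _+_ (sym (∑³-part c₁ (missed (G c₁))))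
          (trans (∑ⁿ-+ U 3 _ _) (cong₂ _+_ (sym (∑³-part c₂ (missed (G c₂)))) (sym (∑³-part c₃ (missed (G c₃)))))))))))

  -- Recursion on the number of levels

  DenseOn : ∀ {N} → Graph3 N → ℕ → Subset N → Set
  DenseOn H q S = q * cube ∣ S ∣ ≤ 4 * (q * edgeSum H (elements S)) + cube ∣ S ∣

  -- `M` is the required closeness to density 1/4, with relative deficit `1 / M`. Arbitrary subsets
  -- `S` of a fixed vertex set are allowed, so that the recursion can enter the parts.
  ApproximableWith : ℕ → ℕ → ℕ → Set
  ApproximableWith L M N₀ = ∀ {N} (H : Graph3 N) → C53-free H → ∀ S → N₀ ≤ ∣ S ∣ → DenseOn H M S →
    ∃ λ G → IsTrec S G × 4 ^ L * removed H S G ≤ 3 ^ L * cube ∣ S ∣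

  Approximable : ℕ → Set
  Approximable L = ∃ λ M → ∃ λ N₀ → ApproximableWith L M N₀

  approximable-zero : Approximable 0
  -- For `M = 0` the density assumption is empty, and no construction removes more than all ordered
  -- triples.
  approximable-zero = 0 , 0 , λ H _ S _ _ → let (G , trec) = isTrec-exists ∣ S ∣ S ≤-refl in G , trec ,
    *-monoʳ-≤ 1 (≤-trans (∑ⁿ-mono (elements S) 3 {g = λ _ _ _ → 1} λ p q r → ≤-trans (⟦⟧*≤ (indicator H p q r) _) (⟦⟧≤1 _))
      (≤-reflexive (trans (∑³-1 (elements S)) (cong cube (length-elements S)))))

  module Step (L M N₁ : ℕ) (approximate : ApproximableWith L M N₁) (m : ℕ) (2≤m : 2 ≤ m) (K≤m : suc cutConstant ≤ m)
    (M-large : 1000 * (4 * suc cutConstant + 19) * M ≤ m) (u-large : 12 * 4 ^ L * suc cutConstant ≤ m) where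

    private
      K u v : ℕ
      -- The successor makes positivity evident, since `removal-step` cancels `K`.
      K = suc cutConstant
      u = 4 ^ L
      v = 3 ^ L

    -- The factor 10 hands the size bounds down to the parts: `cube (m * m)` for the density bound
    -- in each part and `N₁` for the level below. The 3 allows a split.
    step : ∀ {N} (H : Graph3 N) → C53-free H → ∀ S → 10 * (cube (m * m) + N₁) + 3 ≤ ∣ S ∣ → DenseOn H (m * m) S →
      ∃ λ G → IsTrec S G × 4 ^ suc L * removed H S G ≤ 3 ^ suc L * cube ∣ S ∣
    step {N} H free S N₀≤ dense = split-along (cut m 2≤m (≤-trans (n≤1+n cutConstant) K≤m) (elements S) (unique-elements S) q³≤n (subst (λ n → m * m * cube n ≤ 4 * (m * m * edgeSum H (elements S)) + cube n) (sym (length-elements S)) dense))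
      where
      open Structure (indicator H) (λ x y z → cong (λ e → (∣ e ∣ ≡ᵇ 3) ∧ H e) (triple-swap₁ x y z))
        (λ x y z → cong (λ e → (∣ e ∣ ≡ᵇ 3) ∧ H e) (triple-swap₂ x y z)) (C53-free⇒ H free)
      n : ℕ
      n = length (elements S)
      q³≤n : cube (m * m) ≤ n
      q³≤n = subst (cube (m * m) ≤_) (sym (length-elements S)) (≤-trans (≤-trans (m≤m+n (cube (m * m)) N₁) (m≤n*m _ 10)) (≤-trans (m≤m+n (10 * (cube (m * m) + N₁)) 3) N₀≤))

      split-along : Cut cutConstant m (elements S) → ∃ λ G → IsTrec S G × 4 ^ suc L * removed H S G ≤ 3 ^ suc L * cube ∣ S ∣
      split-along (f , sizes , bad≤′) = glue G , glue-isTrec G (≤-trans (m≤n+m 3 (10 * (cube (m * m) + N₁))) N₀≤) (λ i → nonempty (*-cancelˡ-< 10 0 _ (≤-trans 0<n (sizes i)))) trec ,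
          subst (λ s → 4 * u * removed H S (glue G) ≤ 3 * v * cube s) (length-elements S)
            (removal-step m K u v (cube n) bad (removed H S (glue G)) (removed H (V c₁) (G c₁)) (removed H (V c₂) (G c₂)) (removed H (V c₃) (G c₃))
              (cube (size c₁)) (cube (size c₂)) (cube (size c₃)) (m^n>0 3 L) (s≤s z≤n) u-large (removed-split G) bad≤
              (subst (λ s → 25 * (cube (size c₁) + (cube (size c₂) + cube (size c₃))) ≤ 16 * cube s) (sym length-split)
                (cubes-shrink (size c₁) (size c₂) (size c₃) (sizes′ c₁) (sizes′ c₂) (sizes′ c₃)))
              (removed≤ c₁) (removed≤ c₂) (removed≤ c₃))
        where
        open Glue S f
        open Split H S f

        0<n : 0 < n
        0<n = subst (0 <_) (sym (length-elements S)) (≤-trans (s≤s z≤n) (≤-trans (m≤n+m 3 (10 * (cube (m * m) + N₁))) N₀≤))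

        sizes′ : ∀ i → size c₁ + (size c₂ + size c₃) ≤ 10 * size i
        sizes′ i = subst (_≤ 10 * size i) length-split (sizes i)

        bad≤ : m * bad ≤ K * cube n
        bad≤ = ≤-trans bad≤′ (*-monoˡ-≤ (cube n) (n≤1+n cutConstant))

        ∣V∣≡size : ∀ i → ∣ V i ∣ ≡ size i
        ∣V∣≡size i = trans (sym (length-elements (V i))) (length-part i)

        size-large : ∀ i → cube (m * m) + N₁ ≤ size i
        size-large i = *-cancelˡ-≤ 10 (≤-trans (≤-trans (m≤m+n (10 * (cube (m * m) + N₁)) 3) N₀≤) (subst (_≤ 10 * size i) (length-elements S) (sizes i)))

        E : Class → ℕ
        E i = edgeSum H (elements (V i))

        density′ : ∀ i → 4 * (m * m * E i) ≤ m * m * cube (size i) + 9 * cube (size i)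
        density′ i = subst (λ s → 4 * (m * m * E i) ≤ m * m * cube s + 9 * cube s) (length-part i)
          (density m 2≤m (elements (V i)) (unique-elements (V i)) (subst (cube (m * m) ≤_) (sym (length-part i)) (≤-trans (m≤m+n (cube (m * m)) N₁) (size-large i))))

        dense′ : m * m * cube n ≤ 4 * (m * m * edgeSum H (elements S)) + cube n
        dense′ = subst (λ n → m * m * cube n ≤ 4 * (m * m * edgeSum H (elements S)) + cube n) (sym (length-elements S)) dense

        swap₁₂ : ∀ a b c → a + (b + c) ≡ b + (a + c)
        swap₁₂ = solve-∀
        rotate : ∀ a b c → a + (b + c) ≡ c + (a + b)
        rotate = solve-∀
        swap-product : ∀ a b c → 6 * (a * (b * c)) ≡ 6 * (b * (a * c))
        swap-product = solve-∀
        rotate-product : ∀ a b c → 6 * (a * (b * c)) ≡ 6 * (c * (a * b))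
        rotate-product = solve-∀

        -- Each part takes the role of `a` in `child-dense` once, while `density′` caps the other
        -- two.
        child : ∀ i → DenseOn H M (V i)
        child i = subst (λ s → M * cube s ≤ 4 * (M * E i) + cube s) (sym (∣V∣≡size i)) (dense-size i)
          where
          dense-size : ∀ i → M * cube (size i) ≤ 4 * (M * E i) + cube (size i)
          dense-size c₁ = child-dense m K M n (size c₁) (size c₂) (size c₃) (edgeSum H (elements S)) (E c₁) (E c₂) (E c₃) bad length-split
            (≤-trans (s≤s z≤n) 2≤m) M-large (sizes c₁) dense′ edges-split bad≤ (density′ c₂) (density′ c₃)
          dense-size c₂ = child-dense m K M n (size c₂) (size c₁) (size c₃) (edgeSum H (elements S)) (E c₂) (E c₁) (E c₃) bad (trans length-split (swap₁₂ (size c₁) (size c₂) (size c₃)))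
            (≤-trans (s≤s z≤n) 2≤m) M-large (sizes c₂) dense′ (≤-trans edges-split (≤-reflexive (cong₂ (λ e p → bad + e + p) (swap₁₂ (E c₁) (E c₂) (E c₃)) (swap-product (size c₁) (size c₂) (size c₃))))) bad≤ (density′ c₁) (density′ c₃)
          dense-size c₃ = child-dense m K M n (size c₃) (size c₁) (size c₂) (edgeSum H (elements S)) (E c₃) (E c₁) (E c₂) bad (trans length-split (rotate (size c₁) (size c₂) (size c₃)))
            (≤-trans (s≤s z≤n) 2≤m) M-large (sizes c₃) dense′ (≤-trans edges-split (≤-reflexive (cong₂ (λ e p → bad + e + p) (rotate (E c₁) (E c₂) (E c₃)) (rotate-product (size c₁) (size c₂) (size c₃))))) bad≤ (density′ c₁) (density′ c₂)

        approximated : ∀ i → ∃ λ G → IsTrec (V i) G × u * removed H (V i) G ≤ v * cube ∣ V i ∣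
        approximated i = approximate H free (V i) (subst (N₁ ≤_) (sym (∣V∣≡size i)) (≤-trans (m≤n+m N₁ (cube (m * m))) (size-large i))) (child i)

        G : Class → Graph3 N
        G i = proj₁ (approximated i)

        trec : ∀ i → IsTrec (V i) (G i)
        trec i = proj₁ (proj₂ (approximated i))

        removed≤ : ∀ i → u * removed H (V i) (G i) ≤ v * cube (size i)
        removed≤ i = subst (λ s → u * removed H (V i) (G i) ≤ v * cube s) (∣V∣≡size i) (proj₂ (proj₂ (approximated i)))

  approximable-suc : ∀ L → Approximable L → Approximable (suc L)
  approximable-suc L (M , N₁ , approximate) = m * m , 10 * (cube (m * m) + N₁) + 3 ,
      Step.step L M N₁ approximate m (m≤m+n 2 _) (≤-trans (m≤m+n K _) (m≤n+m _ 2))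
        (≤-trans (m≤m+n _ (12 * 4 ^ L * K)) (≤-trans (m≤n+m _ K) (m≤n+m _ 2)))
        (≤-trans (m≤n+m _ (1000 * (4 * K + 19) * M)) (≤-trans (m≤n+m _ K) (m≤n+m _ 2)))
    where
    K m : ℕ
    K = suc cutConstant
    -- The sum of the lower bounds demanded by `Step`; the density parameter `M` of the level below
    -- is already fixed here.
    m = 2 + (K + (1000 * (4 * K + 19) * M + 12 * 4 ^ L * K))

  approximable : ∀ L → Approximable L
  approximable zero = approximable-zero
  approximable (suc L) = approximable-suc L (approximable L)

  -- From ordered triples to 3-sets

  _≟ˢ_ : ∀ {N} (p q : Subset N) → Dec (p ≡ q)
  _≟ˢ_ = ≡-dec Data.Bool._≟_

  ∑-++ : ∀ {A : Set} (U V : List A) (f : A → ℕ) → ∑ (U ++ V) f ≡ ∑ U f + ∑ V f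
  ∑-++ [] V f = refl
  ∑-++ (x ∷ U) V f = trans (cong (f x +_) (∑-++ U V f)) (sym (+-assoc (f x) (∑ U f) (∑ V f)))

  ∑-map : ∀ {A B : Set} (g : A → B) U (f : B → ℕ) → ∑ (map g U) f ≡ ∑ U (f ∘ g)
  ∑-map g [] f = refl
  ∑-map g (x ∷ U) f = cong (f (g x) +_) (∑-map g U f)

  ∑-zero : ∀ {A : Set} (U : List A) → ∑ U (λ _ → 0) ≡ 0
  ∑-zero U = trans (∑-const U 0) (*-zeroʳ (length U))

  ∑-single : ∀ N (t : Subset N) (F : Subset N → ℕ) → ∑ (allSubsets N) (λ e → ⟦ does (e ≟ˢ t) ⟧ * F e) ≡ F t
  ∑-single zero []ᵛ F = trans (+-identityʳ _) (+-identityʳ _)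
  ∑-single (suc N) (true ∷ᵛ t) F = trans (∑-++ (map (false ∷ᵛ_) (allSubsets N)) _ _) (cong₂ _+_
    (trans (∑-map (false ∷ᵛ_) (allSubsets N) _) (∑-zero (allSubsets N))) (trans (∑-map (true ∷ᵛ_) (allSubsets N) _) (∑-single N t (F ∘ (true ∷ᵛ_)))))
  ∑-single (suc N) (false ∷ᵛ t) F = trans (∑-++ (map (false ∷ᵛ_) (allSubsets N)) _ _) (trans (cong₂ _+_
    (trans (∑-map (false ∷ᵛ_) (allSubsets N) _) (∑-single N t (F ∘ (false ∷ᵛ_)))) (trans (∑-map (true ∷ᵛ_) (allSubsets N) _) (∑-zero (allSubsets N)))) (+-identityʳ _))

  ∑-swap′ : ∀ {A B : Set} (U : List A) (V : List B) (f : A → B → ℕ) → ∑ U (λ x → ∑ V (f x)) ≡ ∑ V (λ y → ∑ U (λ x → f x y))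
  ∑-swap′ [] V f = sym (∑-zero V)
  ∑-swap′ (x ∷ U) V f = trans (cong (∑ V (f x) +_) (∑-swap′ U V f)) (sym (∑-+ V (f x) _))

  ∣p-x∣ : ∀ {N} {p : Subset N} {x} → x ∈ p → ∣ p ∣ ≡ suc ∣ p - x ∣
  ∣p-x∣ {p = true ∷ᵛ p} {zero} Data.Vec.here = cong suc (cong ∣_∣ (sym (p─⊥≡p p)))
  ∣p-x∣ {p = true ∷ᵛ p} {suc x} (Data.Vec.there q) = cong suc (∣p-x∣ q)
  ∣p-x∣ {p = false ∷ᵛ p} {suc x} (Data.Vec.there q) = ∣p-x∣ q

  x∉p-x : ∀ {N} (p : Subset N) x → x ∉ p - x
  x∉p-x (s ∷ᵛ p) zero ()
  x∉p-x (s ∷ᵛ p) (suc x) (Data.Vec.there q) = x∉p-x p x q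

  module OrderedTriples (N : ℕ) where

    Fins : List (Fin N)
    Fins = allFin N

    -- Elements are deleted as they are chosen, so a 3-set has `3 * 2 * 1` enumerations and repeated
    -- entries are excluded.
    enumerates : Subset N → Fin N → Fin N → Fin N → ℕ
    enumerates e x y z = ⟦ lookup e x ⟧ * (⟦ lookup (e - x) y ⟧ * ⟦ lookup (e - x - y) z ⟧)

    private
      weighted : ∀ (p : Subset N) c (f : Fin N → ℕ) → (∀ x → x ∈ p → f x ≡ c) → ∑ Fins (λ x → ⟦ lookup p x ⟧ * f x) ≡ ∣ p ∣ * c
      weighted p c f eq = trans (∑-cong Fins λ x → at x (lookup p x) refl) (trans (∑-*ʳ Fins c _) (cong (_* c) (sym (∣∣≡∑ p))))
        where
        at : ∀ x b → lookup p x ≡ b → ⟦ b ⟧ * f x ≡ ⟦ b ⟧ * c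
        at x true lx = cong (1 *_) (eq x (lookup⇒[]= x p lx))
        at x false lx = refl

    six-orders : ∀ e → ∣ e ∣ ≡ 3 → ∑ⁿ Fins 3 (enumerates e) ≡ 6
    six-orders e three = begin-equality
      ∑ⁿ Fins 3 (enumerates e)
        ≡⟨ ∑-cong Fins (λ x → trans (∑-cong Fins λ y → trans (∑-*ˡ Fins ⟦ lookup e x ⟧ _) (cong (⟦ lookup e x ⟧ *_) (trans (∑-*ˡ Fins ⟦ lookup (e - x) y ⟧ _) (cong (⟦ lookup (e - x) y ⟧ *_) (sym (∣∣≡∑ (e - x - y)))))))
             (∑-*ˡ Fins ⟦ lookup e x ⟧ _)) ⟩
      ∑ Fins (λ x → ⟦ lookup e x ⟧ * ∑ Fins (λ y → ⟦ lookup (e - x) y ⟧ * ∣ e - x - y ∣))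
        ≡⟨ weighted e 2 _ (λ x x∈ → trans (weighted (e - x) 1 _ λ y y∈ → suc-injective (trans (sym (∣p-x∣ y∈)) (two x x∈))) (trans (*-identityʳ _) (two x x∈))) ⟩
      ∣ e ∣ * 2
        ≡⟨ cong (_* 2) three ⟩
      6 ∎
      where
      open ≤-Reasoning
      two : ∀ x → x ∈ e → ∣ e - x ∣ ≡ 2
      two x x∈ = suc-injective (trans (sym (∣p-x∣ x∈)) three)

    private
      forces : ∀ {e : Subset N} {x y z : Fin N} → ∣ e ∣ ≡ 3 → x ∈ e → y ∈ e - x → z ∈ e - x - y → e ≡ triple x y z
      forces {e} {x} {y} {z} three x∈ y∈ z∈ = ⊆-antisym e⊆ (triple⊆ x∈ (p─q⊆p e ⁅ x ⁆ y∈) (p─q⊆p e ⁅ x ⁆ (p─q⊆p (e - x) ⁅ y ⁆ z∈)))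
        where
        rest-empty : ∣ e - x - y - z ∣ ≡ 0
        rest-empty = suc-injective (suc-injective (suc-injective (trans (cong suc (cong suc (sym (∣p-x∣ z∈)))) (trans (cong suc (sym (∣p-x∣ y∈))) (trans (sym (∣p-x∣ x∈)) three)))))
        e⊆ : e ⊆ triple x y z
        e⊆ {w} w∈ with w Data.Fin.≟ x | w Data.Fin.≟ y | w Data.Fin.≟ z
        ... | yes refl | _ | _ = x∈p∪q⁺ (inj₁ (x∈⁅x⁆ w))
        ... | no _ | yes refl | _ = x∈p∪q⁺ (inj₂ (x∈p∪q⁺ (inj₁ (x∈⁅x⁆ w))))
        ... | no _ | no _ | yes refl = x∈p∪q⁺ (inj₂ (x∈p∪q⁺ (inj₂ (x∈⁅x⁆ w))))
        ... | no w≢x | no w≢y | no w≢z = ⊥-elim (0≢1+n (trans (sym rest-empty) (∣p-x∣ (x∈p∧x≢y⇒x∈p-y (x∈p∧x≢y⇒x∈p-y (x∈p∧x≢y⇒x∈p-y w∈ w≢x) w≢y) w≢z))))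

      enumerates-triple : ∀ x y z → ∣ triple x y z ∣ ≡ 3 → enumerates (triple x y z) x y z ≡ 1
      enumerates-triple x y z three with edge-distinct (λ _ → true) x y z (three , refl)
      ... | x≢y , x≢z , y≢z = cong₂ _*_ (on x∈) (cong₂ _*_ (on (x∈p∧x≢y⇒x∈p-y y∈ (x≢y ∘ sym))) (on (x∈p∧x≢y⇒x∈p-y (x∈p∧x≢y⇒x∈p-y z∈ (x≢z ∘ sym)) (y≢z ∘ sym))))
        where
        on : ∀ {p : Subset N} {w} → w ∈ p → ⟦ lookup p w ⟧ ≡ 1
        on w∈ = cong ⟦_⟧ ([]=⇒lookup w∈)
        x∈ : x ∈ triple x y z
        x∈ = ∈-triple₁ x y z
        y∈ : y ∈ triple x y z
        y∈ = x∈p∪q⁺ (inj₂ (x∈p∪q⁺ (inj₁ (x∈⁅x⁆ y))))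
        z∈ : z ∈ triple x y z
        z∈ = x∈p∪q⁺ (inj₂ (x∈p∪q⁺ (inj₂ (x∈⁅x⁆ z))))

      pointwise : ∀ (F : Subset N → ℕ) e x y z → ⟦ ∣ e ∣ ≡ᵇ 3 ⟧ * F e * enumerates e x y z ≡ ⟦ does (e ≟ˢ triple x y z) ⟧ * (⟦ ∣ e ∣ ≡ᵇ 3 ⟧ * F e)
      pointwise F e x y z with T? (∣ e ∣ ≡ᵇ 3)
      ... | no ¬three rewrite ¬T⇒≡ ¬three = sym (*-zeroʳ ⟦ does (e ≟ˢ triple x y z) ⟧)
      ... | yes three with e ≟ˢ triple x y z
      ...   | yes refl = trans (cong (⟦ ∣ triple x y z ∣ ≡ᵇ 3 ⟧ * F (triple x y z) *_) (enumerates-triple x y z (≡ᵇ⇒≡ _ 3 three))) (trans (*-identityʳ _) (sym (+-identityʳ _)))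
      ...   | no e≢ = trans (cong (⟦ ∣ e ∣ ≡ᵇ 3 ⟧ * F e *_) (off (lookup e x) (lookup (e - x) y) (lookup (e - x - y) z) refl refl refl)) (*-zeroʳ (⟦ ∣ e ∣ ≡ᵇ 3 ⟧ * F e))
        where
        off : ∀ a b c → a ≡ lookup e x → b ≡ lookup (e - x) y → c ≡ lookup (e - x - y) z → ⟦ a ⟧ * (⟦ b ⟧ * ⟦ c ⟧) ≡ 0
        off false _ _ _ _ _ = refl
        off true false _ _ _ _ = refl
        off true true false _ _ _ = refl
        off true true true p q r = ⊥-elim (e≢ (forces (≡ᵇ⇒≡ _ 3 three) (lookup⇒[]= x e (sym p)) (lookup⇒[]= y _ (sym q)) (lookup⇒[]= z _ (sym r))))

    -- Double counting of pairs of a 3-set and one of its enumerations.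
    ∑-ordered : ∀ (F : Subset N → ℕ) → ∑ⁿ Fins 3 (λ x y z → ⟦ ∣ triple x y z ∣ ≡ᵇ 3 ⟧ * F (triple x y z)) ≡ 6 * ∑ (allSubsets N) (λ e → ⟦ ∣ e ∣ ≡ᵇ 3 ⟧ * F e)
    ∑-ordered F = begin-equality
      ∑ⁿ Fins 3 (λ x y z → Φ (triple x y z))
        ≡⟨ ∑ⁿ-cong Fins 3 (λ x y z → trans (sym (∑-single N (triple x y z) Φ)) (∑-cong (allSubsets N) λ e → sym (pointwise F e x y z))) ⟩
      ∑ⁿ Fins 3 (λ x y z → ∑ (allSubsets N) λ e → Φ e * enumerates e x y z)
        ≡⟨ trans (∑-cong Fins λ x → trans (∑-cong Fins λ y → ∑-swap′ Fins (allSubsets N) _) (∑-swap′ Fins (allSubsets N) _)) (∑-swap′ Fins (allSubsets N) _) ⟩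
      ∑ (allSubsets N) (λ e → ∑ⁿ Fins 3 λ x y z → Φ e * enumerates e x y z)
        ≡⟨ ∑-cong (allSubsets N) (λ e → trans (∑ⁿ-*ˡ Fins 3 (Φ e) (enumerates e)) (orders e)) ⟩
      ∑ (allSubsets N) (λ e → 6 * Φ e) ≡⟨ ∑-*ˡ (allSubsets N) 6 Φ ⟩
      6 * ∑ (allSubsets N) Φ ∎
      where
      open ≤-Reasoning
      Φ : Subset N → ℕ
      Φ e = ⟦ ∣ e ∣ ≡ᵇ 3 ⟧ * F e
      orders : ∀ e → Φ e * ∑ⁿ Fins 3 (enumerates e) ≡ 6 * Φ e
      orders e with T? (∣ e ∣ ≡ᵇ 3)
      ... | yes three = trans (cong (Φ e *_) (six-orders e (≡ᵇ⇒≡ _ 3 three))) (*-comm (Φ e) 6)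
      ... | no ¬three rewrite ¬T⇒≡ ¬three = refl

  elements-⊤ : ∀ N → elements (⊤ {N}) ≡ allFin N
  elements-⊤ N = keep (allFin N)
    where
    keep : ∀ U → filterᵇ (lookup ⊤) U ≡ U
    keep [] = refl
    keep (x ∷ U) rewrite lookup-replicate x true = cong (x ∷_) (keep U)

  if≡⟦⟧ : ∀ b → (if b then 1 else 0) ≡ ⟦ b ⟧
  if≡⟦⟧ true = refl
  if≡⟦⟧ false = refl

  edgeSum-⊤ : ∀ {N} (H : Graph3 N) → edgeSum H (elements ⊤) ≡ 6 * edgeCount H
  edgeSum-⊤ {N} H rewrite elements-⊤ N = trans (∑ⁿ-cong (allFin N) 3 λ x y z → ⟦∧⟧ (∣ triple x y z ∣ ≡ᵇ 3) (H (triple x y z)))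
    (trans (OrderedTriples.∑-ordered N λ e → ⟦ H e ⟧) (cong (6 *_) (∑-cong (allSubsets N) λ e → sym (trans (if≡⟦⟧ _) (⟦∧⟧ (∣ e ∣ ≡ᵇ 3) (H e))))))

  _∧ᴳ_ : ∀ {N} → Graph3 N → Graph3 N → Graph3 N
  (H ∧ᴳ G) e = H e ∧ G e

  removed-⊤ : ∀ {N} (H G : Graph3 N) → removed H ⊤ G ≡ 6 * removedCount H (H ∧ᴳ G)
  removed-⊤ {N} H G rewrite elements-⊤ N = trans
    (∑ⁿ-cong (allFin N) 3 λ x y z → trans (cong (_* ⟦ not (G (triple x y z)) ⟧) (⟦∧⟧ (∣ triple x y z ∣ ≡ᵇ 3) (H (triple x y z)))) (*-assoc ⟦ ∣ triple x y z ∣ ≡ᵇ 3 ⟧ _ _))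
    (trans (OrderedTriples.∑-ordered N λ e → ⟦ H e ⟧ * ⟦ not (G e) ⟧) (cong (6 *_) (∑-cong (allSubsets N) λ e → sym (trans (if≡⟦⟧ _) (bools (∣ e ∣ ≡ᵇ 3) (H e) (G e))))))
    where
    bools : ∀ a b c → ⟦ a ∧ b ∧ not (b ∧ c) ⟧ ≡ ⟦ a ⟧ * (⟦ b ⟧ * ⟦ not c ⟧)
    bools false _ _ = refl
    bools true false _ = refl
    bools true true true = refl
    bools true true false = refl

  -- Binomial coefficients, the depth, and stability over ℕ

  2*nC2 : ∀ n → 2 * (n C 2) + n ≡ n * n
  2*nC2 zero = refl
  2*nC2 (suc n) = begin-equality
    2 * (suc n C 2) + suc n              ≡⟨ cong (λ c → 2 * c + suc n) (sym (nCk+nC[k+1]≡[n+1]C[k+1] n 1)) ⟩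
    2 * (n C 1 + n C 2) + suc n          ≡⟨ cong (λ c → 2 * (c + n C 2) + suc n) (nC1≡n n) ⟩
    2 * (n + n C 2) + suc n              ≡⟨ shuffle n (n C 2) ⟩
    2 * (n C 2) + n + (2 * n + 1)        ≡⟨ cong (_+ (2 * n + 1)) (2*nC2 n) ⟩
    n * n + (2 * n + 1)                  ≡⟨ square n ⟩
    suc n * suc n                        ∎
    where
    open ≤-Reasoning
    shuffle : ∀ n c → 2 * (n + c) + suc n ≡ 2 * c + n + (2 * n + 1)
    shuffle = solve-∀
    square : ∀ n → n * n + (2 * n + 1) ≡ suc n * suc n
    square = solve-∀

  6*nC3 : ∀ n → 6 * (n C 3) + 3 * (n * n) ≡ cube n + 2 * n
  6*nC3 zero = refl
  6*nC3 (suc n) = begin-equality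
    6 * (suc n C 3) + 3 * (suc n * suc n)                         ≡⟨ cong (λ c → 6 * c + 3 * (suc n * suc n)) (sym (nCk+nC[k+1]≡[n+1]C[k+1] n 2)) ⟩
    6 * (n C 2 + n C 3) + 3 * (suc n * suc n)                     ≡⟨ shuffle n (n C 2) (n C 3) ⟩
    3 * (2 * (n C 2) + n) + (6 * (n C 3) + 3 * (n * n)) + 3 * n + 3 ≡⟨ cong₂ (λ a b → 3 * a + b + 3 * n + 3) (2*nC2 n) (6*nC3 n) ⟩
    3 * (n * n) + (cube n + 2 * n) + 3 * n + 3                    ≡⟨ expand n ⟩
    cube (suc n) + 2 * suc n                                      ∎
    where
    open ≤-Reasoning
    shuffle : ∀ n b c → 6 * (b + c) + 3 * (suc n * suc n) ≡ 3 * (2 * b + n) + (6 * c + 3 * (n * n)) + 3 * n + 3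
    shuffle = solve-∀
    expand : ∀ n → 3 * (n * n) + (n * (n * n) + 2 * n) + 3 * n + 3 ≡ suc n * (suc n * suc n) + 2 * suc n
    expand = solve-∀

  -- Bernoulli's inequality for `(1 + 1/3)^L`, cleared of denominators. At `L = 3 * j` it shows that
  -- `3 * j` levels bring the factor `(3/4)^L` below `1 / j`.
  bernoulli : ∀ L → (3 + L) * 3 ^ L ≤ 3 * 4 ^ L
  bernoulli zero = ≤-refl
  bernoulli (suc L) = certify (3 ^ L * L) (*-monoʳ-≤ 4 (bernoulli L)) (arith L (3 ^ L) (4 ^ L))
    where
    arith : ∀ L a b → (3 + suc L) * (3 * a) + 4 * (3 * b) + a * L ≡ 3 * (4 * b) + 4 * ((3 + L) * a)
    arith = solve-∀

  j*3^3j≤4^3j : ∀ j → j * 3 ^ (3 * j) ≤ 4 ^ (3 * j)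
  j*3^3j≤4^3j j = *-cancelˡ-≤ 3 (certify (3 * 3 ^ (3 * j)) (bernoulli (3 * j)) (arith j (3 ^ (3 * j)) (4 ^ (3 * j))))
    where
    arith : ∀ j a b → 3 * (j * a) + 3 * b + 3 * a ≡ 3 * b + (3 + 3 * j) * a
    arith = solve-∀

  -- The theorem for `δ = 1 / D` and `ε = 1 / j` with denominators cleared.
  Stability : ℕ → ℕ → ℕ → Set
  Stability j D N₀ = ∀ n → N₀ ≤ n → (H : Graph3 n) → C53-free H → D * (n C 3) ≤ 4 * D * edgeCount H + 4 * cube n →
    ∃ λ H′ → H′ ⊑ H × j * removedCount H H′ ≤ cube n × IsTrecSubconstruction H′

  stability : ∀ j → ∃ λ d → ∃ λ N₀ → Stability j (suc d) N₀
  stability j = from (approximable (3 * j))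
    where
    from : Approximable (3 * j) → ∃ λ d → ∃ λ N₀ → Stability j (suc d) N₀
    -- The allowed deficit n³/M is spent in halves: `D = 48 * (M + 1)` takes care of the term with
    -- δ, and `6 * M ≤ n` of the 3n² by which n³ may exceed `6 * (n C 3)`.
    from (M , N₀ , approximate) = 47 + 48 * M , N₀ + 6 * M , λ n N₀≤n H free edges≥ → finish n H (approximate H free ⊤
        (subst (N₀ ≤_) (sym (∣⊤∣≡n n)) (≤-trans (m≤m+n N₀ _) N₀≤n))
        (subst₂ (λ s E → M * cube s ≤ 4 * (M * E) + cube s) (sym (∣⊤∣≡n n)) (sym (edgeSum-⊤ H)) (dense n (edgeCount H) (≤-trans (m≤n+m _ N₀) N₀≤n) edges≥)))
      where
      dense : ∀ n E → 6 * M ≤ n → suc (47 + 48 * M) * (n C 3) ≤ 4 * suc (47 + 48 * M) * E + 4 * cube n →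
        M * cube n ≤ 4 * (M * (6 * E)) + cube n
      dense n E 6M≤n edges≥ = *-cancelˡ-≤ (48 * suc M) (certify (48 * suc M * (2 * n * M) + 24 * cube n)
          (+-mono-≤ (*-monoʳ-≤ (6 * M) edges≥) (+-mono-≤ (*-monoʳ-≤ (48 * suc M * M) (≤-reflexive (sym (6*nC3 n)))) (*-monoʳ-≤ (24 * suc M) (*-monoˡ-≤ (n * n) 6M≤n))))
          (arith M n (n C 3) E))
        where
        arith : ∀ M n c E → 48 * suc M * (M * (n * (n * n))) + (6 * M * (4 * suc (47 + 48 * M) * E + 4 * (n * (n * n))) +
            (48 * suc M * M * (6 * c + 3 * (n * n)) + 24 * suc M * (n * (n * n)))) + (48 * suc M * (2 * n * M) + 24 * (n * (n * n)))
          ≡ 48 * suc M * (4 * (M * (6 * E)) + n * (n * n)) + (6 * M * (suc (47 + 48 * M) * c) + (48 * suc M * M * (n * (n * n) + 2 * n) + 24 * suc M * (6 * M * (n * n))))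
        arith = solve-∀

      finish : ∀ n (H : Graph3 n) → (∃ λ G → IsTrec ⊤ G × 4 ^ (3 * j) * removed H ⊤ G ≤ 3 ^ (3 * j) * cube ∣ ⊤ {n} ∣) →
        ∃ λ H′ → H′ ⊑ H × j * removedCount H H′ ≤ cube n × IsTrecSubconstruction H′
      finish n H (G , trec , few) = H ∧ᴳ G , (λ e (three , edge) → three , proj₁ (both edge)) , bound , G , trec , λ e (three , edge) → three , proj₂ (both edge)
        where
        both : ∀ {a b} → a ∧ b ≡ true → a ≡ true × b ≡ true
        both {true} {true} _ = refl , refl
        rc : ℕ
        rc = removedCount H (H ∧ᴳ G)
        few′ : 4 ^ (3 * j) * (6 * rc) ≤ 3 ^ (3 * j) * cube n
        few′ = subst₂ (λ r s → 4 ^ (3 * j) * r ≤ 3 ^ (3 * j) * cube s) (removed-⊤ H G) (∣⊤∣≡n n) few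
        bound : j * rc ≤ cube n
        bound = *-cancelˡ-≤ (4 ^ (3 * j)) {{m^n≢0 4 (3 * j)}} (certify (5 * (4 ^ (3 * j) * (j * rc)))
          (+-mono-≤ (*-monoʳ-≤ j few′) (*-monoˡ-≤ (cube n) (j*3^3j≤4^3j j))) (arith j (4 ^ (3 * j)) (3 ^ (3 * j)) rc (cube n)))
          where
          arith : ∀ j u v r N → u * (j * r) + (j * (v * N) + u * N) + 5 * (u * (j * r)) ≡ u * N + (j * (u * (6 * r)) + j * v * N)
          arith = solve-∀

  -- Passage to rational ε and δ

  module ℚ-Bridge where
    open import Data.Integer using (+_; +≤+)
    import Data.Integer as ℤ
    import Data.Integer.Properties as ℤ
    import Data.Integer.Tactic.RingSolver as ℤ-Solver
    open import Data.Rational using (ℚ; mkℚ; 0ℚ; toℚᵘ)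
    import Data.Rational as ℚ
    import Data.Rational.Properties as ℚ
    open import Data.Rational.Unnormalised using (ℚᵘ; mkℚᵘ; *≤*)
    import Data.Rational.Unnormalised as ℚᵘ
    import Data.Rational.Unnormalised.Properties as ℚᵘ

    toℚᵘ-/ : ∀ i d → toℚᵘ (i ℚ./ suc d) ℚᵘ.≃ mkℚᵘ i d
    toℚᵘ-/ i d = ℚ.toℚᵘ-fromℚᵘ (mkℚᵘ i d)

    private
      move : ∀ c D n → (c ℤ.* D ℤ.+ (ℤ.- (+ 1 ℤ.* n)) ℤ.* + 4) ℤ.* + 1 ℤ.+ + 4 ℤ.* n ≡ D ℤ.* c
      move = ℤ-Solver.solve-∀

    clear : ∀ c D n e → (+ c ℤ.* + D ℤ.+ (ℤ.- (+ 1 ℤ.* + n)) ℤ.* + 4) ℤ.* + 1 ℤ.≤ + e ℤ.* + (4 * D) → D * c ≤ 4 * D * e + 4 * n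
    clear c D n e p = ℤ.drop‿+≤+ (subst₂ ℤ._≤_ (trans (move (+ c) (+ D) (+ n)) (sym (ℤ.pos-* D c)))
      (trans (cong₂ ℤ._+_ (trans (sym (ℤ.pos-* e (4 * D))) (cong +_ (*-comm e (4 * D)))) (sym (ℤ.pos-* 4 n))) (sym (ℤ.pos-+ (4 * D * e) (4 * n))))
      (ℤ.+-monoˡ-≤ (+ 4 ℤ.* + n) p))

    -- Unnormalised fractions keep their denominators as written, so clearing them is plain integer
    -- arithmetic.
    c/4-n/D≤e⇒ : ∀ c d n e → (+ c ℚ./ 4) ℚ.- (+ 1 ℚ./ suc d) ℚ.* (+ n ℚ./ 1) ℚ.≤ (+ e ℚ./ 1) →
      suc d * c ≤ 4 * suc d * e + 4 * n
    c/4-n/D≤e⇒ c d n e le = from (ℚᵘ.≤-respʳ-≃ (toℚᵘ-/ (+ e) 0) (ℚᵘ.≤-respˡ-≃ lhs (ℚ.toℚᵘ-mono-≤ le)))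
      where
      lhs : toℚᵘ ((+ c ℚ./ 4) ℚ.- (+ 1 ℚ./ suc d) ℚ.* (+ n ℚ./ 1)) ℚᵘ.≃ mkℚᵘ (+ c) 3 ℚᵘ.- mkℚᵘ (+ 1) d ℚᵘ.* mkℚᵘ (+ n) 0
      lhs = ℚᵘ.≃-trans (ℚ.toℚᵘ-homo-+ (+ c ℚ./ 4) _) (ℚᵘ.+-cong (toℚᵘ-/ (+ c) 3)
        (ℚᵘ.≃-trans (ℚ.toℚᵘ-homo‿- _) (ℚᵘ.-‿cong (ℚᵘ.≃-trans (ℚ.toℚᵘ-homo-* (+ 1 ℚ./ suc d) _) (ℚᵘ.*-cong (toℚᵘ-/ (+ 1) d) (toℚᵘ-/ (+ n) 0))))))
      from : mkℚᵘ (+ c) 3 ℚᵘ.- mkℚᵘ (+ 1) d ℚᵘ.* mkℚᵘ (+ n) 0 ℚᵘ.≤ mkℚᵘ (+ e) 0 → suc d * c ≤ 4 * suc d * e + 4 * n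
      from (*≤* p) = subst (λ D → D * c ≤ 4 * D * e + 4 * n) (cong suc (*-identityʳ d)) (clear c (suc (d * 1)) n e p)

    -- The numerator of a positive `ε` is at least 1, so `ε` is at least the reciprocal of its
    -- denominator.
    j*r≤n⇒ : ∀ ε → 0ℚ ℚ.< ε → ∀ r n → suc (ℚ.denominator-1 ε) * r ≤ n → (+ r ℚ./ 1) ℚ.≤ ε ℚ.* (+ n ℚ./ 1)
    j*r≤n⇒ (mkℚ (+ zero) d c) (ℚ.*<* (ℤ.+<+ ())) r n le
    j*r≤n⇒ (mkℚ (ℤ.-[1+ a ]) d c) (ℚ.*<* ()) r n le
    j*r≤n⇒ ε@(mkℚ (+ suc a) d c) _ r n le = ℚ.toℚᵘ-cancel-≤ (ℚᵘ.≤-respʳ-≃ (ℚᵘ.≃-sym rhs) (ℚᵘ.≤-respˡ-≃ (ℚᵘ.≃-sym (toℚᵘ-/ (+ r) 0)) (*≤* (subst₂ ℤ._≤_ left right (ℤ.+≤+ (≤-trans le (m≤m+n n (a * n))))))))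
      where
      left : + (suc d * r) ≡ + r ℤ.* + suc (d * 1)
      left = trans (cong +_ (trans (*-comm (suc d) r) (cong (λ d → r * suc d) (sym (*-identityʳ d))))) (ℤ.pos-* r (suc (d * 1)))
      right : + (suc a * n) ≡ (+ suc a ℤ.* + n) ℤ.* + 1
      right = trans (ℤ.pos-* (suc a) n) (sym (ℤ.*-identityʳ _))
      rhs : toℚᵘ (ε ℚ.* (+ n ℚ./ 1)) ℚᵘ.≃ mkℚᵘ (+ suc a) d ℚᵘ.* mkℚᵘ (+ n) 0
      rhs = ℚᵘ.≃-trans (ℚ.toℚᵘ-homo-* ε (+ n ℚ./ 1)) (ℚᵘ.*-cong {mkℚᵘ (+ suc a) d} ℚᵘ.≃-refl (toℚᵘ-/ (+ n) 0))

    cube≡^3 : ∀ n → cube n ≡ n ^ 3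
    cube≡^3 n = cong (λ m → n * (n * m)) (sym (*-identityʳ n))

    rational-stability : (ε : ℚ) → 0ℚ ℚ.< ε →
      Σ ℚ λ δ → 0ℚ ℚ.< δ × Σ ℕ λ N₀ → (n : ℕ) → n ≥ N₀ →
      (H : Graph3 n) → C53-free H →
      (+ (n C 3) ℚ./ 4) ℚ.- δ ℚ.* (+ (n ^ 3) ℚ./ 1) ℚ.≤ (+ edgeCount H ℚ./ 1) →
      ∃ λ (H' : Graph3 n) → (H' ⊑ H) × ((+ removedCount H H' ℚ./ 1) ℚ.≤ ε ℚ.* (+ (n ^ 3) ℚ./ 1)) × IsTrecSubconstruction H'
    rational-stability ε 0<ε = from (stability j)
      where
      j : ℕ
      j = suc (ℚ.denominator-1 ε)
      from : (∃ λ d → ∃ λ N₀ → Stability j (suc d) N₀) → _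
      from (d , N₀ , stable) = + 1 ℚ./ suc d , ℚ.positive⁻¹ (+ 1 ℚ./ suc d) {{ℚ.normalize-pos 1 (suc d)}} , N₀ , λ n N₀≤n H free edges≥ →
        let (H' , sub , few , trec) = stable n N₀≤n H free
              (subst (λ c → suc d * (n C 3) ≤ 4 * suc d * edgeCount H + 4 * c) (sym (cube≡^3 n)) (c/4-n/D≤e⇒ (n C 3) d (n ^ 3) (edgeCount H) edges≥))
        in H' , sub , j*r≤n⇒ ε 0<ε (removedCount H H') (n ^ 3) (subst (j * removedCount H H' ≤_) (cube≡^3 n) few) , trec

open import Data.Nat using (ℕ; _≥_; _^_)
open import Data.Nat.Combinatorics using (_C_)
open import Data.Integer using (+_)
open import Data.Rational using (ℚ; 0ℚ; _<_; _≤_; _/_; _*_; _-_)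
open import Data.Product using (Σ; _×_; ∃)

theorem1p2 : (ε : ℚ) → 0ℚ < ε →
    Σ ℚ λ δ → 0ℚ < δ × Σ ℕ λ N₀ → (n : ℕ) → n ≥ N₀ →
    (H : Graph3 n) → C53-free H →
    (+ (n C 3) / 4) - δ * (+ (n ^ 3) / 1) ≤ (+ edgeCount H / 1) →
    ∃ λ (H' : Graph3 n) → (H' ⊑ H) ×
    ((+ removedCount H H' / 1) ≤ ε * (+ (n ^ 3) / 1)) ×
    IsTrecSubconstruction H'
theorem1p2 = Development.ℚ-Bridge.rational-stability
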